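{- In every psi-calculus, strong bisimilarity $\dot\sim$ (i.e. $\dot\sim_{\mathbf 1}$) and context bisimilarity $\dot\sim^c$ coincide: for all agents $P,Q$, $P \mathrel{\dot\sim} Q$ if and only if $P \mathrel{\dot\sim^c} Q$.
   Context: Names: a countably infinite set $\mathcal N$ of atomic names. A nominal set is a set equipped with name swapping operations $(a\;b)\cdot X$ satisfying the usual axioms; the support $\mathrm n(X)$ of an element is the set of names affected by swappings, assumed finite; $a \# X$ ("$a$ fresh for $X$") means $a\notin \mathrm n(X)$, and $A\#X$ for a set/sequence $A$ means every element of $A$ is fresh for $X$. A function/relation is equivariant if it commutes with all swappings. $\tilde a$ denotes a finite sequence of names (also used as the set of its elements). Psi-calculus: given by three nominal datatypes $\mathbf T$ (terms, ranged over by $M,N,K,L$), $\mathbf C$ (conditions, $\varphi$), $\mathbf A$ (assertions, $\Psi$), equivariant operators $\leftrightarrow:\mathbf T\times\mathbf T\to\mathbf C$ (channel equivalence), $\otimes:\mathbf A\times\mathbf A\to\mathbf A$ (composition), $\mathbf 1\in\mathbf A$ (unit), $\vdash\subseteq\mathbf A\times\mathbf C$ (entailment), and equivariant substitution functions $X[\tilde a:=\tilde T]$ (substituting terms for distinct names) on $\mathbf T,\mathbf C,\mathbf A$ satisfying: (S1) if $\tilde a\subseteq\mathrm n(X)$ and $b\in\mathrm n(\tilde T)$ then $b\in\mathrm n(X[\tilde a:=\tilde T])$; (S2) if $\tilde b\# X,\tilde a$ then $X[\tilde a:=\tilde T]=((\tilde b\;\tilde a)\cdot X)[\tilde b:=\tilde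 T]$. Assertions are equivalent, $\Psi\simeq\Psi'$, if for all $\varphi$: $\Psi\vdash\varphi\iff\Psi'\vdash\varphi$. Required: $\Psi\vdash M\leftrightarrow N\Rightarrow\Psi\vdash N\leftrightarrow M$; $\Psi\vdash M\leftrightarrow N\wedge\Psi\vdash N\leftrightarrow L\Rightarrow\Psi\vdash M\leftrightarrow L$; $\Psi\simeq\Psi'\Rightarrow\Psi\otimes\Psi''\simeq\Psi'\otimes\Psi''$; $\Psi\otimes\mathbf 1\simeq\Psi$; $(\Psi\otimes\Psi')\otimes\Psi''\simeq\Psi\otimes(\Psi'\otimes\Psi'')$; $\Psi\otimes\Psi'\simeq\Psi'\otimes\Psi$. Frames: $(\nu\tilde b)\Psi$ with $\tilde b$ binding into $\Psi$, identified up to alpha-equivalence; $(\nu\tilde b_1)\Psi_1\otimes(\nu\tilde b_2)\Psi_2=(\nu\tilde b_1\tilde b_2)(\Psi_1\otimes\Psi_2)$ with $\tilde b_1\#\tilde b_2,\Psi_2$ and $\tilde b_2\#\tilde b_1,\Psi_1$; $F\vdash\varphi$ iff some alpha-variant $(\nu\tilde b)\Psi$ of $F$ has $\tilde b\#\varphi$ and $\Psi\vdash\varphi$; $F\simeq G$ iff for all $\varphi$, $F\vdash\varphi\iff G\vdash\varphi$; an assertion $\Psi$ is identified with the frame $(\nu\epsilon)\Psi$. Agents: $\mathbf 0$; $\overline M N.P$ (output); $\underline M(\lambda\tilde x)N.P$ (input, $\tilde x\subseteq\mathrm n(N)$ without duplicates, binding in $N$ and $P$); $\mathbf{case}\ \varphi_1:P_1\,[\!]\cdots[\!]\,\varphi_n:P_n$;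 $(\nu a)P$ (binds $a$); $P\mid Q$; $!P$; $(\!|\Psi|\!)$ (assertion). Agents are identified up to alpha-equivalence. In $!P$ and in each branch $P_i$ of a case, every assertion must occur under an input or output prefix. Substitution on agents is defined homomorphically from substitution on terms, conditions, assertions, avoiding capture. Frame of an agent: $\mathcal F(\mathbf 0)=\mathcal F(\text{input})=\mathcal F(\text{output})=\mathcal F(\mathbf{case}\ldots)=\mathcal F(!P)=\mathbf 1$, $\mathcal F((\!|\Psi|\!))=\Psi$, $\mathcal F(P\mid Q)=\mathcal F(P)\otimes\mathcal F(Q)$, $\mathcal F((\nu b)P)=(\nu b)\mathcal F(P)$. We write $\mathcal F(P)=(\nu\tilde b_P)\Psi_P$. Actions: output $\overline M(\nu\tilde a)N$ with $\tilde a\subseteq\mathrm n(N)$, input $\underline M N$, and $\tau$; $\mathrm{bn}(\overline M(\nu\tilde a)N)=\tilde a$, otherwise $\emptyset$; $\mathrm n(\tau)=\emptyset$, else $\mathrm n(M)\cup\mathrm n(N)$; $M$ is the subject. Transitions $\Psi\rhd P\xrightarrow{\alpha}P'$ are the least relation closed under (symmetric versions of Com and Par included): In: $\Psi\vdash M\leftrightarrow K$ implies $\Psi\rhd\underline M(\lambda\tilde y)N.P\xrightarrow{\underline K\,N[\tilde y:=\tilde L]}P[\tilde y:=\tilde L]$ for any $\tilde L$. Out: $\Psi\vdash M\leftrightarrow K$ implies $\Psi\rhd\overline MN.P\xrightarrow{\overline KN}P$. Case: $\Psi\rhd P_i\xrightarrow\alpha P'$ and $\Psi\vdash\varphi_i$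 imply $\Psi\rhd\mathbf{case}\ \tilde\varphi:\tilde P\xrightarrow\alpha P'$. Com: with $\mathcal F(P)=(\nu\tilde b_P)\Psi_P$, $\mathcal F(Q)=(\nu\tilde b_Q)\Psi_Q$, $\tilde b_P\#\Psi,\tilde b_Q,Q,M,P$, $\tilde b_Q\#\Psi,\tilde b_P,P,K,Q$: if $\Psi_Q\otimes\Psi\rhd P\xrightarrow{\overline M(\nu\tilde a)N}P'$, $\Psi_P\otimes\Psi\rhd Q\xrightarrow{\underline KN}Q'$, $\Psi\otimes\Psi_P\otimes\Psi_Q\vdash M\leftrightarrow K$ and $\tilde a\#Q$, then $\Psi\rhd P\mid Q\xrightarrow\tau(\nu\tilde a)(P'\mid Q')$. Par: with $\mathcal F(Q)=(\nu\tilde b_Q)\Psi_Q$, $\tilde b_Q\#\Psi,P,\alpha$: if $\Psi_Q\otimes\Psi\rhd P\xrightarrow\alpha P'$ and $\mathrm{bn}(\alpha)\#Q$ then $\Psi\rhd P\mid Q\xrightarrow\alpha P'\mid Q$. Scope: $\Psi\rhd P\xrightarrow\alpha P'$, $b\#\alpha,\Psi$ imply $\Psi\rhd(\nu b)P\xrightarrow\alpha(\nu b)P'$. Open: $\Psi\rhd P\xrightarrow{\overline M(\nu\tilde a)N}P'$, $b\#\tilde a,\Psi,M$, $b\in\mathrm n(N)$ imply $\Psi\rhd(\nu b)P\xrightarrow{\overline M(\nu\tilde a\cup\{b\})N}P'$. Rep: $\Psi\rhd P\mid !P\xrightarrow\alpha P'$ implies $\Psi\rhd !P\xrightarrow\alpha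 P'$. $\mathrm{bn}(\alpha)$ binds into the object and derivative; transitions are identified up to alpha-equivalence. $P\xrightarrow\alpha P'$ means $\mathbf 1\rhd P\xrightarrow\alpha P'$. Bisimulation: a ternary relation $\mathcal R$ on (assertion, agent, agent) such that $\mathcal R(\Psi,P,Q)$ implies (1) $\Psi\otimes\mathcal F(P)\simeq\Psi\otimes\mathcal F(Q)$; (2) $\mathcal R(\Psi,Q,P)$; (3) $\mathcal R(\Psi\otimes\Psi',P,Q)$ for all $\Psi'$; (4) for all $\alpha,P'$ with $\mathrm{bn}(\alpha)\#\Psi,Q$, if $\Psi\rhd P\xrightarrow\alpha P'$ then there is $Q'$ with $\Psi\rhd Q\xrightarrow\alpha Q'$ and $\mathcal R(\Psi,P',Q')$. $P\mathrel{\dot\sim_\Psi}Q$ iff some bisimulation contains $(\Psi,P,Q)$; $\dot\sim$ is $\dot\sim_{\mathbf 1}$. Context bisimulation: a binary relation $\mathcal R$ on agents such that $\mathcal R(P,Q)$ implies (1) $\mathcal F(P)\simeq\mathcal F(Q)$; (2) $\mathcal R(Q,P)$; (3) for all $\Psi$, $\mathcal R((\!|\Psi|\!)\mid P,(\!|\Psi|\!)\mid Q)$; (4) for all $\alpha,P'$ with $\mathrm{bn}(\alpha)\#Q$, if $\mathbf 1\rhd P\xrightarrow\alpha P'$ then there is $Q'$ with $\mathbf 1\rhd Q\xrightarrow\alpha Q'$ and $\mathcal R(P',Q')$. $P\mathrel{\dot\sim^c}Q$ iff some context bisimulation contains $(P,Q)$. -}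

module Defs where

open import Level using (Level) renaming (suc to lsuc)
open import Data.Nat.Base as ℕ using (ℕ; zero; suc)
import Data.Nat.Properties as ℕₚ
open import Data.List.Base using (List; []; _∷_; _++_; map; filter; foldr; length; concatMap)
open import Data.List.Membership.Propositional using (_∈_; _∉_)
import Data.List.Membership.DecPropositional as DecMembership
open import Data.List.Relation.Binary.Disjoint.Propositional using (Disjoint)
open import Data.List.Relation.Binary.Pointwise.Base using (Pointwise)
open import Data.List.Relation.Binary.Subset.Propositional using (_⊆_)
open import Data.List.Relation.Unary.All using (All)
open import Data.List.Relation.Unary.Unique.Propositional using (Unique)
open import Data.Product.Base using (_×_; _,_; ∃; ∃₂; proj₁; proj₂)
import Data.Product.Relation.Binary.Pointwise.NonDependent as Product
open import Function.Bundles using (_↔_; _⇔_; Inverse)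
open import Function.Properties.Inverse using (↔⇒↣)
open import Relation.Binary.Bundles using (Setoid)
open import Relation.Binary.Core using (Rel)
open import Relation.Binary.Definitions using (DecidableEquality)
open import Relation.Binary.PropositionalEquality using (_≡_)
open import Relation.Nullary using (¬_; Dec; yes; no; ¬?)
open import Relation.Nullary.Decidable using (via-injection)

record Names : Set₁ where
  field
    Name        : Set
    enumeration : Name ↔ ℕ

  open Inverse enumeration using (to; from)

  infix 4 _≟_
  _≟_ : DecidableEquality Name
  _≟_ = via-injection (↔⇒↣ enumeration) ℕₚ._≟_

  open DecMembership _≟_ public using (_∈?_)

  swapName : Name → Name → Name → Name
  swapName a b c with c ≟ a | c ≟ b
  ... | yes _ | _     = b
  ... | no _  | yes _ = a
  ... | no _  | no _  = c

  fresh : List Name → Name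
  fresh A = from (suc (foldr (λ a m → to a ℕ.⊔ m) 0 A))

  freshes : ℕ → List Name → List Name
  freshes zero    A = []
  freshes (suc n) A = fresh A ∷ freshes n (fresh A ∷ A)

  -- (c₁ b₁)·(c₂ b₂)·…·X.  The last swapping is applied first, so that
  -- renaming the binders of (νb₁)(νb₂)…X in this way respects shadowing when
  -- the bᵢ contain repetitions.
  swaps : ∀ {ℓ} {X : Set ℓ} → (Name → Name → X → X) →
          List Name → List Name → X → X
  swaps swap (c ∷ c̃) (b ∷ b̃) X = swap c b (swaps swap c̃ b̃ X)
  swaps swap _       _       X = X

  infixl 6 _∖_
  _∖_ : List Name → List Name → List Name
  A ∖ B = filter (λ a → ¬? (a ∈? B)) A

  infix 4 _#_
  _#_ : List Name → List Name → Set
  _#_ = Disjoint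

  -- c̃ may replace the binding sequence b̃ in an object whose names are in A.
  record FreshVariant (c̃ b̃ A : List Name) : Set where
    field
      distinct   : Unique c̃
      sameLength : length c̃ ≡ length b̃
      avoids     : c̃ # b̃ ++ A

-- Sets are setoids, so that a nominal set may itself be a quotient such as
-- terms up to alpha-equivalence.
record NominalSet (𝓝 : Names) (ℓ : Level) : Set (lsuc ℓ) where
  open Names 𝓝
  field
    setoid : Setoid ℓ ℓ

  open Setoid setoid public

  field
    swap            : Name → Name → Carrier → Carrier
    swap-cong       : ∀ {a b X Y} → X ≈ Y → swap a b X ≈ swap a b Y
    swap-id         : ∀ {a X} → swap a a X ≈ X
    swap-involutive : ∀ {a b X} → swap a b (swap a b X) ≈ X
    swap-swap       : ∀ {a b c d X} →
                      swap a b (swap c d X) ≈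
                      swap (swapName a b c) (swapName a b d) (swap a b X)

    -- n(X), listed.  The two laws say that it is the least finite set
    -- supporting X, which determines it up to order and repetition.
    supp          : Carrier → List Name
    supp-supports : ∀ {a b X} → a ∉ supp X → b ∉ supp X → swap a b X ≈ X
    supp-affected : ∀ {a b X} → a ∈ supp X → b ∉ supp X → ¬ (swap a b X ≈ X)

record Substitution {𝓝 : Names} {ℓ : Level} (𝐓 𝐗 : NominalSet 𝓝 ℓ) : Set ℓ where
  open Names 𝓝
  private
    module T = NominalSet 𝐓
    module X = NominalSet 𝐗

  -- X [ ã := T̃ ] is meaningful for distinct ã, as many as there are T̃;
  -- nothing is required of it otherwise.
  infix 30 _[_:=_]
  field
    _[_:=_] : X.Carrier → List Name → List T.Carrier → X.Carrier

    subst-cong : ∀ {X X′ ã T̃ T̃′} → Unique ã → length ã ≡ length T̃ →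
                 X X.≈ X′ → Pointwise T._≈_ T̃ T̃′ →
                 X [ ã := T̃ ] X.≈ X′ [ ã := T̃′ ]

    subst-equivariant : ∀ {X ã T̃ a b} → Unique ã → length ã ≡ length T̃ →
                        X.swap a b (X [ ã := T̃ ]) X.≈
                        X.swap a b X [ map (swapName a b) ã := map (T.swap a b) T̃ ]

    subst-supp : ∀ {X ã T̃ b} → Unique ã → length ã ≡ length T̃ →
                 ã ⊆ X.supp X → b ∈ concatMap T.supp T̃ →
                 b ∈ X.supp (X [ ã := T̃ ])

    subst-alpha : ∀ {X ã T̃ b̃} → Unique ã → length ã ≡ length T̃ →
                  FreshVariant b̃ ã (X.supp X) →
                  X [ ã := T̃ ] X.≈ swaps X.swap b̃ ã X [ b̃ := T̃ ]

record PsiCalculus (𝓝 : Names) (ℓ : Level) : Set (lsuc ℓ) where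
  open Names 𝓝
  field
    𝐓 𝐂 𝐀 : NominalSet 𝓝 ℓ

  module T = NominalSet 𝐓
  module C = NominalSet 𝐂
  module A = NominalSet 𝐀

  Term : Set ℓ
  Term = T.Carrier

  Condition : Set ℓ
  Condition = C.Carrier

  Assertion : Set ℓ
  Assertion = A.Carrier

  infix  20 _↔̇_
  infixl 20 _⊗_
  infix  10 _⊢_ _≃_
  field
    substᵀ : Substitution 𝐓 𝐓
    substᶜ : Substitution 𝐓 𝐂
    substᴬ : Substitution 𝐓 𝐀

    _↔̇_ : Term → Term → Condition
    _⊗_ : Assertion → Assertion → Assertion
    𝟏   : Assertion
    _⊢_ : Assertion → Condition → Set ℓ

    ↔̇-cong : ∀ {M M′ N N′} → M T.≈ M′ → N T.≈ N′ → (M ↔̇ N) C.≈ (M′ ↔̇ N′)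
    ⊗-cong : ∀ {Ψ Ψ′ Φ Φ′} → Ψ A.≈ Ψ′ → Φ A.≈ Φ′ → (Ψ ⊗ Φ) A.≈ (Ψ′ ⊗ Φ′)
    ⊢-resp : ∀ {Ψ Ψ′ φ φ′} → Ψ A.≈ Ψ′ → φ C.≈ φ′ → Ψ ⊢ φ → Ψ′ ⊢ φ′

    ↔̇-equivariant : ∀ {a b M N} →
                    C.swap a b (M ↔̇ N) C.≈ (T.swap a b M ↔̇ T.swap a b N)
    ⊗-equivariant : ∀ {a b Ψ Ψ′} →
                    A.swap a b (Ψ ⊗ Ψ′) A.≈ (A.swap a b Ψ ⊗ A.swap a b Ψ′)
    𝟏-equivariant : ∀ {a b} → A.swap a b 𝟏 A.≈ 𝟏
    ⊢-equivariant : ∀ {a b Ψ φ} → Ψ ⊢ φ → A.swap a b Ψ ⊢ C.swap a b φ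

  _≃_ : Assertion → Assertion → Set ℓ
  Ψ ≃ Ψ′ = ∀ φ → Ψ ⊢ φ ⇔ Ψ′ ⊢ φ

  field
    ↔̇-symmetric   : ∀ {Ψ M N} → Ψ ⊢ M ↔̇ N → Ψ ⊢ N ↔̇ M
    ↔̇-transitive  : ∀ {Ψ M N L} → Ψ ⊢ M ↔̇ N → Ψ ⊢ N ↔̇ L → Ψ ⊢ M ↔̇ L
    ⊗-compositional : ∀ {Ψ Ψ′ Ψ″} → Ψ ≃ Ψ′ → Ψ ⊗ Ψ″ ≃ Ψ′ ⊗ Ψ″
    ⊗-identity      : ∀ {Ψ} → Ψ ⊗ 𝟏 ≃ Ψ
    ⊗-associative   : ∀ {Ψ Ψ′ Ψ″} → (Ψ ⊗ Ψ′) ⊗ Ψ″ ≃ Ψ ⊗ (Ψ′ ⊗ Ψ″)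
    ⊗-commutative   : ∀ {Ψ Ψ′} → Ψ ⊗ Ψ′ ≃ Ψ′ ⊗ Ψ

module Psi {𝓝 : Names} {ℓ : Level} (𝒫 : PsiCalculus 𝓝 ℓ) where
  open Names 𝓝
  open PsiCalculus 𝒫

  private
    module Tₛ = Substitution substᵀ
    module Cₛ = Substitution substᶜ
    module Aₛ = Substitution substᴬ

  infix 15 ⟨ν_⟩_
  data Frame : Set ℓ where
    ⟨ν_⟩_ : List Name → Assertion → Frame

  infix 4 _≡ᶠ_
  data _≡ᶠ_ : Rel Frame ℓ where
    cong  : ∀ {b̃ Ψ Ψ′} → Ψ A.≈ Ψ′ → ⟨ν b̃ ⟩ Ψ ≡ᶠ ⟨ν b̃ ⟩ Ψ′
    alpha : ∀ {b̃ c̃ Ψ} → FreshVariant c̃ b̃ (A.supp Ψ) →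
            ⟨ν b̃ ⟩ Ψ ≡ᶠ ⟨ν c̃ ⟩ swaps A.swap c̃ b̃ Ψ
    sym   : ∀ {F G} → F ≡ᶠ G → G ≡ᶠ F
    trans : ∀ {F G H} → F ≡ᶠ G → G ≡ᶠ H → F ≡ᶠ H

  -- Composition of frames: both binding sequences are first renamed to fresh,
  -- disjoint ones, which achieves the freshness conditions
  -- b̃₁ # b̃₂,Ψ₂ and b̃₂ # b̃₁,Ψ₁.
  infixl 20 _⊗ᶠ_
  _⊗ᶠ_ : Frame → Frame → Frame
  (⟨ν b̃₁ ⟩ Ψ₁) ⊗ᶠ (⟨ν b̃₂ ⟩ Ψ₂) =
    ⟨ν c̃₁ ++ c̃₂ ⟩ (swaps A.swap c̃₁ b̃₁ Ψ₁ ⊗ swaps A.swap c̃₂ b̃₂ Ψ₂)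
    where
    used c̃₁ c̃₂ : List Name
    used = b̃₁ ++ A.supp Ψ₁ ++ b̃₂ ++ A.supp Ψ₂
    c̃₁   = freshes (length b̃₁) used
    c̃₂   = freshes (length b̃₂) (c̃₁ ++ used)

  infix 10 _⊢ᶠ_ _≃ᶠ_
  _⊢ᶠ_ : Frame → Condition → Set ℓ
  F ⊢ᶠ φ = ∃₂ λ b̃ Ψ → F ≡ᶠ ⟨ν b̃ ⟩ Ψ × b̃ # C.supp φ × Ψ ⊢ φ

  _≃ᶠ_ : Frame → Frame → Set ℓ
  F ≃ᶠ G = ∀ φ → F ⊢ᶠ φ ⇔ G ⊢ᶠ φ

  assertionFrame : Assertion → Frame
  assertionFrame Ψ = ⟨ν [] ⟩ Ψ

  -- Preagents are concrete syntax: neither well-formed nor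
  -- identified up to alpha-equivalence.

  infixr 20 _∣_
  data Preagent : Set ℓ where
    𝟎      : Preagent
    output : Term → Term → Preagent → Preagent              -- M̄ N . P
    input  : Term → List Name → Term → Preagent → Preagent  -- M(λx̃)N . P
    case   : List (Condition × Preagent) → Preagent
    ν      : Name → Preagent → Preagent
    _∣_    : Preagent → Preagent → Preagent
    !_     : Preagent → Preagent
    ⦅_⦆    : Assertion → Preagent

  ν* : List Name → Preagent → Preagent
  ν* ã P = foldr ν P ã

  mutual
    swap : Name → Name → Preagent → Preagent
    swap a b 𝟎              = 𝟎
    swap a b (output M N P) = output (T.swap a b M) (T.swap a b N) (swap a b P)
    swap a b (input M x̃ N P) =
      input (T.swap a b M) (map (swapName a b) x̃) (T.swap a b N) (swap a b P)
    swap a b (case B)       = case (swapBranches a b B)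
    swap a b (ν c P)        = ν (swapName a b c) (swap a b P)
    swap a b (P ∣ Q)        = swap a b P ∣ swap a b Q
    swap a b (! P)          = ! swap a b P
    swap a b ⦅ Ψ ⦆          = ⦅ A.swap a b Ψ ⦆

    swapBranches : Name → Name → List (Condition × Preagent) → List (Condition × Preagent)
    swapBranches a b []            = []
    swapBranches a b ((φ , P) ∷ B) = (C.swap a b φ , swap a b P) ∷ swapBranches a b B

  -- n(P) for the agent represented by P.  As agents are identified up to
  -- alpha-equivalence, the support consists of the free names.
  mutual
    n : Preagent → List Name
    n 𝟎               = []
    n (output M N P)  = T.supp M ++ T.supp N ++ n P
    n (input M x̃ N P) = T.supp M ++ ((T.supp N ++ n P) ∖ x̃)
    n (case B)        = nBranches B
    n (ν a P)         = n P ∖ (a ∷ [])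
    n (P ∣ Q)         = n P ++ n Q
    n (! P)           = n P
    n ⦅ Ψ ⦆           = A.supp Ψ

    nBranches : List (Condition × Preagent) → List Name
    nBranches []            = []
    nBranches ((φ , P) ∷ B) = C.supp φ ++ n P ++ nBranches B

  -- Alpha-equivalence: the least congruence that allows bound names to be
  -- replaced by fresh ones.
  infix 4 _≡α_
  data _≡α_ : Rel Preagent ℓ where
    refl  : ∀ {P} → P ≡α P
    sym   : ∀ {P Q} → P ≡α Q → Q ≡α P
    trans : ∀ {P Q R} → P ≡α Q → Q ≡α R → P ≡α R

    alpha-input : ∀ {M x̃ z̃ N P} → FreshVariant z̃ x̃ (T.supp N ++ n P) →
                  input M x̃ N P ≡α input M z̃ (swaps T.swap z̃ x̃ N) (swaps swap z̃ x̃ P)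
    alpha-ν     : ∀ {a b P} → b ∉ n P → ν a P ≡α ν b (swap b a P)

    output : ∀ {M M′ N N′ P P′} → M T.≈ M′ → N T.≈ N′ → P ≡α P′ →
             output M N P ≡α output M′ N′ P′
    input  : ∀ {M M′ x̃ N N′ P P′} → M T.≈ M′ → N T.≈ N′ → P ≡α P′ →
             input M x̃ N P ≡α input M′ x̃ N′ P′
    case   : ∀ {B B′} → Pointwise (Product.Pointwise C._≈_ _≡α_) B B′ →
             case B ≡α case B′
    ν      : ∀ {a P P′} → P ≡α P′ → ν a P ≡α ν a P′
    _∣_    : ∀ {P P′ Q Q′} → P ≡α P′ → Q ≡α Q′ → (P ∣ Q) ≡α (P′ ∣ Q′)
    !_     : ∀ {P P′} → P ≡α P′ → ! P ≡α ! P′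
    ⦅_⦆    : ∀ {Ψ Ψ′} → Ψ A.≈ Ψ′ → ⦅ Ψ ⦆ ≡α ⦅ Ψ′ ⦆

  -- Every assertion in the agent is under an input or output prefix.
  data Guarded : Preagent → Set ℓ where
    𝟎      : Guarded 𝟎
    output : ∀ {M N P} → Guarded (output M N P)
    input  : ∀ {M x̃ N P} → Guarded (input M x̃ N P)
    case   : ∀ {B} → All (λ φP → Guarded (proj₂ φP)) B → Guarded (case B)
    ν      : ∀ {a P} → Guarded P → Guarded (ν a P)
    _∣_    : ∀ {P Q} → Guarded P → Guarded Q → Guarded (P ∣ Q)
    !_     : ∀ {P} → Guarded P → Guarded (! P)

  data WellFormed : Preagent → Set ℓ where
    𝟎      : WellFormed 𝟎
    output : ∀ {M N P} → WellFormed P → WellFormed (output M N P)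
    input  : ∀ {M x̃ N P} → Unique x̃ → x̃ ⊆ T.supp N → WellFormed P →
             WellFormed (input M x̃ N P)
    case   : ∀ {B} → All (λ φP → WellFormed (proj₂ φP) × Guarded (proj₂ φP)) B →
             WellFormed (case B)
    ν      : ∀ {a P} → WellFormed P → WellFormed (ν a P)
    _∣_    : ∀ {P Q} → WellFormed P → WellFormed Q → WellFormed (P ∣ Q)
    !_     : ∀ {P} → WellFormed P → Guarded P → WellFormed (! P)
    ⦅_⦆    : ∀ Ψ → WellFormed ⦅ Ψ ⦆

  record Agent : Set ℓ where
    constructor agent
    field
      pre        : Preagent
      wellFormed : WellFormed pre
  open Agent public

  infix 4 _≡ₐ_
  _≡ₐ_ : Rel Agent ℓ
  P ≡ₐ Q = pre P ≡α pre Q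

  infixr 20 ⦅_⦆∣_
  ⦅_⦆∣_ : Assertion → Agent → Agent
  ⦅ Ψ ⦆∣ P = agent (⦅ Ψ ⦆ ∣ pre P) (⦅ Ψ ⦆ ∣ wellFormed P)

  -- P [ ỹ := L̃ ]≔ P′ is the graph of substitution on representatives whose
  -- binders are not captured.  A P whose binders do clash with ỹ or L̃ has to be
  -- alpha-converted first; the rule `alpha' of the transition relation does so.
  infix 4 _[_:=_]≔_
  data _[_:=_]≔_ : Preagent → List Name → List Term → Preagent → Set ℓ where
    𝟎      : ∀ {ỹ L̃} → 𝟎 [ ỹ := L̃ ]≔ 𝟎
    output : ∀ {ỹ L̃ M N P P′} → P [ ỹ := L̃ ]≔ P′ →
             output M N P [ ỹ := L̃ ]≔ output (M Tₛ.[ ỹ := L̃ ]) (N Tₛ.[ ỹ := L̃ ]) P′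
    input  : ∀ {ỹ L̃ M x̃ N P P′} → x̃ # ỹ ++ concatMap T.supp L̃ → P [ ỹ := L̃ ]≔ P′ →
             input M x̃ N P [ ỹ := L̃ ]≔ input (M Tₛ.[ ỹ := L̃ ]) x̃ (N Tₛ.[ ỹ := L̃ ]) P′
    case   : ∀ {ỹ L̃ B B′} →
             Pointwise (Product.Pointwise (λ φ φ′ → φ Cₛ.[ ỹ := L̃ ] ≡ φ′)
                                          (λ P P′ → P [ ỹ := L̃ ]≔ P′)) B B′ →
             case B [ ỹ := L̃ ]≔ case B′
    ν      : ∀ {ỹ L̃ a P P′} → a ∉ ỹ ++ concatMap T.supp L̃ → P [ ỹ := L̃ ]≔ P′ →
             ν a P [ ỹ := L̃ ]≔ ν a P′
    _∣_    : ∀ {ỹ L̃ P P′ Q Q′} → P [ ỹ := L̃ ]≔ P′ → Q [ ỹ := L̃ ]≔ Q′ →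
             (P ∣ Q) [ ỹ := L̃ ]≔ (P′ ∣ Q′)
    !_     : ∀ {ỹ L̃ P P′} → P [ ỹ := L̃ ]≔ P′ → (! P) [ ỹ := L̃ ]≔ (! P′)
    ⦅_⦆    : ∀ {ỹ L̃} Ψ → ⦅ Ψ ⦆ [ ỹ := L̃ ]≔ ⦅ Ψ Aₛ.[ ỹ := L̃ ] ⦆

  νᶠ : Name → Frame → Frame
  νᶠ b (⟨ν b̃ ⟩ Ψ) = ⟨ν b ∷ b̃ ⟩ Ψ

  𝓕 : Preagent → Frame
  𝓕 𝟎               = assertionFrame 𝟏
  𝓕 (output _ _ _)  = assertionFrame 𝟏
  𝓕 (input _ _ _ _) = assertionFrame 𝟏
  𝓕 (case _)        = assertionFrame 𝟏
  𝓕 (! _)           = assertionFrame 𝟏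
  𝓕 ⦅ Ψ ⦆           = assertionFrame Ψ
  𝓕 (P ∣ Q)         = 𝓕 P ⊗ᶠ 𝓕 Q
  𝓕 (ν b P)         = νᶠ b (𝓕 P)

  -- The condition ã ⊆ n(N) on out M ã N is not imposed here: it holds for the
  -- label of every transition, by the rule `open′'.
  data Action : Set ℓ where
    out : Term → List Name → Term → Action
    inp : Term → Term → Action
    τ   : Action

  bn : Action → List Name
  bn (out _ ã _) = ã
  bn (inp _ _)   = []
  bn τ           = []

  nᵃ : Action → List Name
  nᵃ (out M _ N) = T.supp M ++ T.supp N
  nᵃ (inp M N)   = T.supp M ++ T.supp N
  nᵃ τ           = []

  -- Alpha-equivalence of residuals: bn(α) binds into the object of α and the
  -- derivative, but not into the subject.
  infix 4 _≡ʳ_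
  data _≡ʳ_ : Rel (Action × Preagent) ℓ where
    out   : ∀ {M M′ ã N N′ P P′} → M T.≈ M′ → N T.≈ N′ → P ≡α P′ →
            (out M ã N , P) ≡ʳ (out M′ ã N′ , P′)
    inp   : ∀ {M M′ N N′ P P′} → M T.≈ M′ → N T.≈ N′ → P ≡α P′ →
            (inp M N , P) ≡ʳ (inp M′ N′ , P′)
    τ     : ∀ {P P′} → P ≡α P′ → (τ , P) ≡ʳ (τ , P′)
    alpha : ∀ {M ã c̃ N P} → FreshVariant c̃ ã (T.supp N ++ n P) →
            (out M ã N , P) ≡ʳ (out M c̃ (swaps T.swap c̃ ã N) , swaps swap c̃ ã P)
    sym   : ∀ {ρ ρ′} → ρ ≡ʳ ρ′ → ρ′ ≡ʳ ρ
    trans : ∀ {ρ ρ′ ρ″} → ρ ≡ʳ ρ′ → ρ′ ≡ʳ ρ″ → ρ ≡ʳ ρ″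

  infix 4 _▷_─[_]→_
  data _▷_─[_]→_ : Assertion → Preagent → Action → Preagent → Set ℓ where
    -- Assertions, agents and residuals are taken up to their equalities.
    alpha : ∀ {Ψ Ψ₀ P P₀ α α₀ P′ P₀′} →
            Ψ A.≈ Ψ₀ → P ≡α P₀ → Ψ₀ ▷ P₀ ─[ α₀ ]→ P₀′ → (α₀ , P₀′) ≡ʳ (α , P′) →
            Ψ ▷ P ─[ α ]→ P′

    input : ∀ {Ψ M K ỹ N L̃ P P′} →
            Ψ ⊢ M ↔̇ K → length ỹ ≡ length L̃ → P [ ỹ := L̃ ]≔ P′ →
            Ψ ▷ input M ỹ N P ─[ inp K (N Tₛ.[ ỹ := L̃ ]) ]→ P′

    output : ∀ {Ψ M K N P} →
             Ψ ⊢ M ↔̇ K →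
             Ψ ▷ output M N P ─[ out K [] N ]→ P

    case : ∀ {Ψ B φ P α P′} →
           Ψ ▷ P ─[ α ]→ P′ → (φ , P) ∈ B → Ψ ⊢ φ →
           Ψ ▷ case B ─[ α ]→ P′

    comˡ : ∀ {Ψ P Q b̃P ΨP b̃Q ΨQ M K ã N P′ Q′} →
           𝓕 P ≡ᶠ ⟨ν b̃P ⟩ ΨP → 𝓕 Q ≡ᶠ ⟨ν b̃Q ⟩ ΨQ →
           b̃P # A.supp Ψ ++ b̃Q ++ n Q ++ T.supp M ++ n P →
           b̃Q # A.supp Ψ ++ b̃P ++ n P ++ T.supp K ++ n Q →
           ΨQ ⊗ Ψ ▷ P ─[ out M ã N ]→ P′ →
           ΨP ⊗ Ψ ▷ Q ─[ inp K N ]→ Q′ →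
           Ψ ⊗ ΨP ⊗ ΨQ ⊢ M ↔̇ K →
           ã # n Q →
           Ψ ▷ P ∣ Q ─[ τ ]→ ν* ã (P′ ∣ Q′)

    comʳ : ∀ {Ψ P Q b̃P ΨP b̃Q ΨQ M K ã N P′ Q′} →
           𝓕 P ≡ᶠ ⟨ν b̃P ⟩ ΨP → 𝓕 Q ≡ᶠ ⟨ν b̃Q ⟩ ΨQ →
           b̃P # A.supp Ψ ++ b̃Q ++ n Q ++ T.supp M ++ n P →
           b̃Q # A.supp Ψ ++ b̃P ++ n P ++ T.supp K ++ n Q →
           ΨQ ⊗ Ψ ▷ P ─[ inp M N ]→ P′ →
           ΨP ⊗ Ψ ▷ Q ─[ out K ã N ]→ Q′ →
           Ψ ⊗ ΨP ⊗ ΨQ ⊢ M ↔̇ K →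
           ã # n P →
           Ψ ▷ P ∣ Q ─[ τ ]→ ν* ã (P′ ∣ Q′)

    parˡ : ∀ {Ψ P Q b̃Q ΨQ α P′} →
           𝓕 Q ≡ᶠ ⟨ν b̃Q ⟩ ΨQ → b̃Q # A.supp Ψ ++ n P ++ nᵃ α →
           ΨQ ⊗ Ψ ▷ P ─[ α ]→ P′ →
           bn α # n Q →
           Ψ ▷ P ∣ Q ─[ α ]→ P′ ∣ Q

    parʳ : ∀ {Ψ P Q b̃P ΨP α Q′} →
           𝓕 P ≡ᶠ ⟨ν b̃P ⟩ ΨP → b̃P # A.supp Ψ ++ n Q ++ nᵃ α →
           ΨP ⊗ Ψ ▷ Q ─[ α ]→ Q′ →
           bn α # n P →
           Ψ ▷ P ∣ Q ─[ α ]→ P ∣ Q′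

    scope : ∀ {Ψ P b α P′} →
            Ψ ▷ P ─[ α ]→ P′ → b ∉ nᵃ α ++ A.supp Ψ →
            Ψ ▷ ν b P ─[ α ]→ ν b P′

    -- ã ∪ {b} is the sequence ã with b inserted anywhere.
    open′ : ∀ {Ψ P b M ã₁ ã₂ N P′} →
            Ψ ▷ P ─[ out M (ã₁ ++ ã₂) N ]→ P′ →
            b ∉ ã₁ ++ ã₂ ++ A.supp Ψ ++ T.supp M → b ∈ T.supp N →
            Ψ ▷ ν b P ─[ out M (ã₁ ++ b ∷ ã₂) N ]→ P′

    rep : ∀ {Ψ P α P′} →
          Ψ ▷ P ∣ (! P) ─[ α ]→ P′ →
          Ψ ▷ ! P ─[ α ]→ P′

  -- A relation on agents is one on well-formed preagents that
  -- respects alpha-equivalence.  Transitions are between preagents, because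
  -- the substitution laws do not guarantee that P [ ỹ := L̃ ] is well-formed;
  -- bisimulations consider those whose derivative is an agent.
  record IsBisimulation (R : Assertion → Agent → Agent → Set ℓ) : Set ℓ where
    field
      respects  : ∀ {Ψ Ψ′ P P′ Q Q′} → Ψ A.≈ Ψ′ → P ≡ₐ P′ → Q ≡ₐ Q′ →
                  R Ψ P Q → R Ψ′ P′ Q′
      static    : ∀ {Ψ P Q} → R Ψ P Q →
                  assertionFrame Ψ ⊗ᶠ 𝓕 (pre P) ≃ᶠ assertionFrame Ψ ⊗ᶠ 𝓕 (pre Q)
      symmetric : ∀ {Ψ P Q} → R Ψ P Q → R Ψ Q P
      extension : ∀ {Ψ P Q} → R Ψ P Q → ∀ Ψ′ → R (Ψ ⊗ Ψ′) P Q
      simulation : ∀ {Ψ P Q} → R Ψ P Q → ∀ α P′ → bn α # A.supp Ψ ++ n (pre Q) →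
                   Ψ ▷ pre P ─[ α ]→ pre P′ →
                   ∃ λ Q′ → Ψ ▷ pre Q ─[ α ]→ pre Q′ × R Ψ P′ Q′

  infix 4 _∼[_]_ _∼_ _∼ᶜ_
  _∼[_]_ : Agent → Assertion → Agent → Set (lsuc ℓ)
  P ∼[ Ψ ] Q = ∃ λ R → IsBisimulation R × R Ψ P Q

  _∼_ : Rel Agent (lsuc ℓ)
  P ∼ Q = P ∼[ 𝟏 ] Q

  record IsContextBisimulation (R : Agent → Agent → Set ℓ) : Set ℓ where
    field
      respects  : ∀ {P P′ Q Q′} → P ≡ₐ P′ → Q ≡ₐ Q′ → R P Q → R P′ Q′
      static    : ∀ {P Q} → R P Q → 𝓕 (pre P) ≃ᶠ 𝓕 (pre Q)
      symmetric : ∀ {P Q} → R P Q → R Q P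
      extension : ∀ {P Q} → R P Q → ∀ Ψ → R (⦅ Ψ ⦆∣ P) (⦅ Ψ ⦆∣ Q)
      simulation : ∀ {P Q} → R P Q → ∀ α P′ → bn α # n (pre Q) →
                   𝟏 ▷ pre P ─[ α ]→ pre P′ →
                   ∃ λ Q′ → 𝟏 ▷ pre Q ─[ α ]→ pre Q′ × R P′ Q′

  _∼ᶜ_ : Rel Agent (lsuc ℓ)
  P ∼ᶜ Q = ∃ λ R → IsContextBisimulation R × R P Q

{-# OPTIONS --safe #-}
module Submission where

-- A transition of ⦅Ψ₁⦆ ∣ … ∣ ⦅Ψₖ⦆ ∣ P in the environment 𝟏 is the same thing as
-- a transition of P in the environment Ψ₁ ⊗ … ⊗ Ψₖ, so contexts of assertions
-- play the part of the environment of a bisimulation.  Environments built in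
-- the two ways agree only up to ≃, and equivalent assertions may have different
-- supports.  The main point is therefore that the transitions of P under Ψ and
-- Ψ′ agree when Ψ ≃ Ψ′: binders occurring in a derivation are renamed away from
-- Ψ′, which is sound because the derivative of a transition contains no names
-- other than those of the agent and of the label.
--
-- Given a context bisimulation R, the bisimulation relates P and Q under Ψ if
-- R relates π·P and π·Q in some context with composition ≃ π·Ψ.  The
-- permutation π is needed because the bound names of a label need be fresh for
-- Ψ but not for the assertions in the context, and R need not be equivariant.
open import Defs
open import Level using (Level)
open import Function.Bundles using (_⇔_)
open import Data.Empty using (⊥-elim)
open import Data.List.Base using (List; []; _∷_; _++_; map; foldr; length; zip; concatMap)
open import Data.List.Membership.Propositional using (_∈_; _∉_)
open import Data.List.Membership.Propositional.Properties
  using (∈-++⁺ˡ; ∈-++⁺ʳ; ∈-++⁻; ∈-map⁺; ∈-map⁻; ∈-filter⁺; ∈-filter⁻)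
open import Data.List.Properties using (length-map; length-++; foldr-++; map-id; map-∘; map-++; map-cong)
import Data.List.Relation.Binary.Pointwise as Pointwise
open import Data.List.Relation.Binary.Pointwise.Base using (Pointwise; []; _∷_)
open import Data.List.Relation.Binary.Subset.Propositional using (_⊆_)
open import Data.List.Relation.Unary.All as All using (All; []; _∷_)
open import Data.List.Relation.Unary.AllPairs using ([]; _∷_)
open import Data.List.Relation.Unary.Any using (here; there)
open import Data.List.Relation.Unary.Unique.Propositional using (Unique)
import Data.List.Relation.Unary.Unique.Propositional.Properties as Unique
open import Data.Nat.Base as ℕ using (ℕ; zero; suc)
import Data.Nat.Properties as ℕ
open import Data.Product.Base using (_×_; _,_; ∃; ∃₂; proj₁; proj₂)
import Data.Product.Relation.Binary.Pointwise.NonDependent as Product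
open import Data.Sum.Base using (_⊎_; inj₁; inj₂; [_,_]′)
open import Data.Unit.Base using (⊤; tt)
open import Function.Base using (_∘_; id)
open import Function.Bundles using (Inverse; mk⇔; Equivalence)
open import Function.Definitions using (Injective)
import Function.Properties.Equivalence as Equivalence
open import Relation.Binary.PropositionalEquality
  using (_≡_; _≢_; refl; sym; trans; cong; cong₂; subst)
open import Relation.Nullary using (¬_; yes; no; ¬?; contradiction)

-- Moving a binder out of the way in a premise moves the conclusion of the rule too. To transport a
-- derivation along `π`, a rule or its premise is therefore transported along a permutation `ρ` that
-- differs from `π` on the binders alone, and the result is read back along `π`: outside the binders
-- of its label a residual has only names on which the two agree. For inputs this rests on (S1), by
-- which a received name is visible in the label, and (S1) in turn needs the pattern variables to
-- occur in the pattern. Two features of the concrete syntax shape the groundwork. Binding sequences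
-- may contain repetitions, so a renaming is a composite of swappings whose effect is computed name
-- by name and then lifted to all nominal sets. And fresh names are chosen through an enumeration
-- that swappings do not respect, so frames of renamed agents can be compared only through their
-- instances at sufficiently fresh binders.

module NameProperties (𝓝 : Names) where
  open Names 𝓝
  open Inverse enumeration using (to; strictlyInverseˡ)

  private variable
    a b c d x y : Name
    b̃ c̃ d̃ A B C : List Name

  -- Fresh names, permutations, and renaming of binding sequences

  fresh-∉ : ∀ A → fresh A ∉ A
  fresh-∉ A p = ℕ.<-irrefl refl (subst (ℕ._≤ bound A) (strictlyInverseˡ _) (bounded A p))
    where
    bound : List Name → ℕ
    bound = foldr (λ a m → to a ℕ.⊔ m) 0
    bounded : ∀ B {a} → a ∈ B → to a ℕ.≤ bound B
    bounded (b ∷ B) (here refl) = ℕ.m≤m⊔n _ _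
    bounded (b ∷ B) (there p)   = ℕ.≤-trans (bounded B p) (ℕ.m≤n⊔m (to b) _)

  freshes-# : ∀ n A → freshes n A # A
  freshes-# (suc n) A (here refl , q) = fresh-∉ A q
  freshes-# (suc n) A (there p , q)   = freshes-# n (fresh A ∷ A) (p , there q)

  length-freshes : ∀ n A → length (freshes n A) ≡ n
  length-freshes zero    A = refl
  length-freshes (suc n) A = cong suc (length-freshes n _)

  freshes-unique : ∀ n A → Unique (freshes n A)
  freshes-unique zero    A = []
  freshes-unique (suc n) A =
    All.tabulate (λ { p refl → freshes-# n _ (p , here refl) }) ∷ freshes-unique n _

  freshVariant : ∀ b̃ A → FreshVariant (freshes (length b̃) (b̃ ++ A)) b̃ A
  freshVariant b̃ A = record
    { distinct   = freshes-unique (length b̃) _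
    ; sameLength = length-freshes (length b̃) _
    ; avoids     = freshes-# (length b̃) _
    }

  variant-⊆ : B ⊆ A → FreshVariant c̃ b̃ A → FreshVariant c̃ b̃ B
  variant-⊆ {b̃ = b̃} B⊆A v = record
    { distinct = distinct ; sameLength = sameLength
    ; avoids = λ (p , q) → avoids (p , [ ∈-++⁺ˡ , (λ r → ∈-++⁺ʳ b̃ (B⊆A r)) ]′ (∈-++⁻ b̃ q)) }
    where open FreshVariant v

  avoids-old : FreshVariant c̃ b̃ A → x ∈ c̃ → x ∉ b̃
  avoids-old v p q = FreshVariant.avoids v (p , ∈-++⁺ˡ q)

  avoids-used : FreshVariant c̃ b̃ A → x ∈ c̃ → x ∉ A
  avoids-used {b̃ = b̃} v p q = FreshVariant.avoids v (p , ∈-++⁺ʳ b̃ q)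

  ∈-∖⁺ : x ∈ A → x ∉ B → x ∈ A ∖ B
  ∈-∖⁺ {B = B} = ∈-filter⁺ (λ a → ¬? (a ∈? B))

  ∈-∖⁻ : x ∈ A ∖ B → x ∈ A × x ∉ B
  ∈-∖⁻ {B = B} = ∈-filter⁻ (λ a → ¬? (a ∈? B))

  ∉-++ : x ∉ A → x ∉ B → x ∉ A ++ B
  ∉-++ {A = A} p q r = [ p , q ]′ (∈-++⁻ A r)

  swapName-left : ∀ a b → swapName a b a ≡ b
  swapName-left a b with a ≟ a
  ... | yes _ = refl
  ... | no a≢a = contradiction refl a≢a

  swapName-right : ∀ a b → swapName a b b ≡ a
  swapName-right a b with b ≟ a | b ≟ b
  ... | yes b≡a | _     = b≡a
  ... | no _    | yes _ = refl
  ... | no _    | no b≢b = contradiction refl b≢b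

  swapName-other : x ≢ a → x ≢ b → swapName a b x ≡ x
  swapName-other {x} {a} {b} x≢a x≢b with x ≟ a | x ≟ b
  ... | yes x≡a | _       = contradiction x≡a x≢a
  ... | no _    | yes x≡b = contradiction x≡b x≢b
  ... | no _    | no _    = refl

  swapName-cases : ∀ {p} (Q : Name → Name → Set p) a b →
                   Q a b → Q b a → (∀ {x} → x ≢ a → x ≢ b → Q x x) →
                   ∀ x → Q x (swapName a b x)
  swapName-cases Q a b left right other x with x ≟ a | x ≟ b
  ... | yes refl | _        = left
  ... | no _     | yes refl = right
  ... | no x≢a   | no x≢b   = other x≢a x≢b

  swapName-involutive : ∀ a b x → swapName a b (swapName a b x) ≡ x
  swapName-involutive a b = swapName-cases (λ x y → swapName a b y ≡ x) a b
    (swapName-right a b) (swapName-left a b) swapName-other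

  swapName-id : ∀ a x → swapName a a x ≡ x
  swapName-id a = swapName-cases (λ x y → y ≡ x) a a refl refl (λ _ _ → refl)

  swapName-injective : ∀ a b → Injective _≡_ _≡_ (swapName a b)
  swapName-injective a b {x} {y} e =
    trans (sym (swapName-involutive a b x)) (trans (cong (swapName a b) e) (swapName-involutive a b y))

  injective-swapName : ∀ {f : Name → Name} → Injective _≡_ _≡_ f → ∀ c d x →
                       f (swapName c d x) ≡ swapName (f c) (f d) (f x)
  injective-swapName {f} inj c d = swapName-cases (λ x y → f y ≡ swapName (f c) (f d) (f x)) c d
    (sym (swapName-left _ _)) (sym (swapName-right _ _))
    (λ x≢c x≢d → sym (swapName-other (x≢c ∘ inj) (x≢d ∘ inj)))

  Perm : Set
  Perm = List (Name × Name)

  infixr 30 _·_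
  _·_ : Perm → Name → Name
  π · x = foldr (λ (a , b) → swapName a b) x π

  inverse : Perm → Perm
  inverse []      = []
  inverse (p ∷ π) = inverse π ++ p ∷ []

  ·-++ : ∀ π σ x → (π ++ σ) · x ≡ π · σ · x
  ·-++ π σ x = foldr-++ _ x π σ

  ·-inverse : ∀ π x → inverse π · π · x ≡ x
  ·-inverse []            x = refl
  ·-inverse ((a , b) ∷ π) x = trans (·-++ (inverse π) _ _)
    (trans (cong (inverse π ·_) (swapName-involutive a b (π · x))) (·-inverse π x))

  ·-injective : ∀ π → Injective _≡_ _≡_ (π ·_)
  ·-injective π {x} {y} e =
    trans (sym (·-inverse π x)) (trans (cong (inverse π ·_) e) (·-inverse π y))

  inverse-· : ∀ π x → π · inverse π · x ≡ x
  inverse-· []            x = refl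
  inverse-· ((a , b) ∷ π) x = trans (cong (λ y → swapName a b (π · y)) (·-++ (inverse π) _ x))
    (trans (cong (swapName a b) (inverse-· π _)) (swapName-involutive a b x))

  names : Perm → List Name
  names = concatMap (λ (a , b) → a ∷ b ∷ [])

  ·-fresh : ∀ π {x} → x ∉ names π → π · x ≡ x
  ·-fresh []            _ = refl
  ·-fresh ((a , b) ∷ π) f = trans (cong (swapName a b) (·-fresh π (f ∘ there ∘ there)))
    (swapName-other (f ∘ here) (f ∘ there ∘ here))

  ∈-map-injective : ∀ {f : Name → Name} → Injective _≡_ _≡_ f → f x ∈ map f A → x ∈ A
  ∈-map-injective {A = A} {f} inj p with ∈-map⁻ f p
  ... | y , q , e = subst (_∈ A) (sym (inj e)) q

  -- zip c̃ b̃ renames b̃ to c̃ on names outside c̃.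
  rename-∉ : x ∉ c̃ → x ∉ b̃ → zip c̃ b̃ · x ≡ x
  rename-∉ {c̃ = []}               p q = refl
  rename-∉ {c̃ = c ∷ c̃} {b̃ = []}    p q = refl
  rename-∉ {c̃ = c ∷ c̃} {b̃ = b ∷ b̃} p q =
    trans (cong (swapName c b) (rename-∉ (p ∘ there) (q ∘ there)))
          (swapName-other (p ∘ here) (q ∘ here))

  private
    variant-tail : FreshVariant (c ∷ c̃) (b ∷ b̃) A → FreshVariant c̃ b̃ A
    variant-tail {b̃ = b̃} v with FreshVariant.distinct v
    ... | _ ∷ u = record
      { distinct = u ; sameLength = ℕ.suc-injective (FreshVariant.sameLength v)
      ; avoids = λ (p , q) → FreshVariant.avoids v (there p , there q) }

    swapName-skip : FreshVariant (c ∷ c̃) (b ∷ b̃) A → y ∈ c̃ → swapName c b y ≡ y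
    swapName-skip v y∈c̃ with FreshVariant.distinct v
    ... | c∉c̃ ∷ _ = swapName-other (λ e → All.lookup c∉c̃ y∈c̃ (sym e))
                                  (λ e → avoids-old v (there y∈c̃) (here e))

  -- The swapping for the last occurrence of `x` in `b̃` is the first to touch it and yields a name
  -- of `c̃`; the remaining ones leave that name alone, since `c̃` is distinct and avoids `b̃`. With
  -- repetitions the innermost binder wins.
  rename-∈ : FreshVariant c̃ b̃ A → x ∉ c̃ → x ∈ b̃ → zip c̃ b̃ · x ∈ c̃
  rename-∈ {[]} {b ∷ b̃} v x∉c̃ x∈b̃ with FreshVariant.sameLength v
  ... | ()
  rename-∈ {c ∷ c̃} {b ∷ b̃} {A} {x} v x∉c̃ x∈b̃ with x ∈? b̃ | x∈b̃
  ... | yes p | _         = let q = rename-∈ (variant-tail v) (x∉c̃ ∘ there) p in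
                            there (subst (_∈ c̃) (sym (swapName-skip v q)) q)
  ... | no p  | here refl = here (trans (cong (swapName c b) (rename-∉ (x∉c̃ ∘ there) p)) (swapName-right c b))
  ... | no p  | there q   = contradiction q p

  rename-image : FreshVariant c̃ b̃ A → x ∉ c̃ → zip c̃ b̃ · x ∈ c̃ ⊎ zip c̃ b̃ · x ≡ x
  rename-image {b̃ = b̃} {x = x} v x∉ with x ∈? b̃
  ... | yes p = inj₁ (rename-∈ v x∉ p)
  ... | no p  = inj₂ (rename-∉ x∉ p)

  -- Alpha-equivalence seen on names: a bound name goes on both sides to the entry of `d̃` at its
  -- last occurrence in `b̃`, a position that the injections `f` and `g` preserve; any other name is
  -- left alone by both renamings, and there `f` and `g` agree.
  rename-agree : ∀ {f g : Name → Name} → Injective _≡_ _≡_ f → Injective _≡_ _≡_ g →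
                 FreshVariant d̃ (map f b̃) A → FreshVariant d̃ (map g b̃) B →
                 f x ∉ d̃ → g x ∉ d̃ → (x ∉ b̃ → f x ≡ g x) →
                 zip d̃ (map f b̃) · f x ≡ zip d̃ (map g b̃) · g x
  rename-agree {d̃ = []}               injf injg vf vg fx gx eq with FreshVariant.sameLength vf
  rename-agree {d̃ = []} {b̃ = []}      injf injg vf vg fx gx eq | _ = eq (λ ())
  rename-agree {d̃ = d ∷ d̃} {b̃ = []}   injf injg vf vg fx gx eq = eq (λ ())
  rename-agree {d̃ = d ∷ d̃} {b̃ = b ∷ b̃} {x = x} {f} {g} injf injg vf vg fx gx eq with x ∈? b̃
  ... | yes p =
    trans (swapName-skip vf (rename-∈ (variant-tail vf) (fx ∘ there) (∈-map⁺ f p)))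
    (trans (rename-agree injf injg (variant-tail vf) (variant-tail vg) (fx ∘ there) (gx ∘ there)
             (contradiction p))
    (sym (swapName-skip vg (rename-∈ (variant-tail vg) (gx ∘ there) (∈-map⁺ g p)))))
  ... | no p = trans (cong (swapName d (f b)) (rename-∉ (fx ∘ there) (p ∘ ∈-map-injective injf)))
    (trans rest
    (sym (cong (swapName d (g b)) (rename-∉ (gx ∘ there) (p ∘ ∈-map-injective injg)))))
    where
    rest : swapName d (f b) (f x) ≡ swapName d (g b) (g x)
    rest with x ≟ b
    ... | yes refl = trans (swapName-right d (f x)) (sym (swapName-right d (g x)))
    ... | no x≢b   = trans (swapName-other (fx ∘ here) (x≢b ∘ injf))
      (trans (eq λ { (here e) → x≢b e ; (there q) → p q })
      (sym (swapName-other (gx ∘ here) (x≢b ∘ injg))))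

  -- A bound name passes through the entry of `c̃` at its last occurrence to the entry of `d̃` at
  -- the same position. This makes the fresh instances of a frame independent of the variant from
  -- which they are taken.
  rename-rename : FreshVariant d̃ c̃ A → FreshVariant c̃ b̃ B → FreshVariant d̃ b̃ C →
                  x ∉ c̃ → x ∉ d̃ →
                  zip d̃ c̃ · zip c̃ b̃ · x ≡ zip d̃ b̃ · x
  rename-rename {d̃ = []} v w u p q with FreshVariant.sameLength v
  rename-rename {d̃ = []} {c̃ = []} v w u p q | _ = refl
  rename-rename {d̃ = d ∷ d̃} {c̃ = []} v w u p q with FreshVariant.sameLength v
  ... | ()
  rename-rename {d̃ = d ∷ d̃} {c̃ = c ∷ c̃} {b̃ = []} v w u p q with FreshVariant.sameLength w
  ... | ()
  rename-rename {d̃ = d ∷ d̃} {c̃ = c ∷ c̃} {b̃ = b ∷ b̃} {x = x} v w u p q with x ∈? b̃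
  ... | yes r =
    trans (cong (zip (d ∷ d̃) (c ∷ c̃) ·_) (swapName-skip w y∈c̃))
    (trans (swapName-skip v (rename-∈ (variant-tail v) (λ s → avoids-old v (there s) (there y∈c̃)) y∈c̃))
    (trans (rename-rename (variant-tail v) (variant-tail w) (variant-tail u) (p ∘ there) (q ∘ there))
    (sym (swapName-skip u (rename-∈ (variant-tail u) (q ∘ there) r)))))
    where y∈c̃ = rename-∈ (variant-tail w) (p ∘ there) r
  ... | no r with x ≟ b
  ...   | yes refl =
    trans (cong (zip (d ∷ d̃) (c ∷ c̃) ·_) (trans (cong (swapName c b) (rename-∉ (p ∘ there) r)) (swapName-right c b)))
    (trans (cong (swapName d c) (rename-∉ (λ s → avoids-old v (there s) (here refl)) (c∉c̃ (FreshVariant.distinct w))))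
    (trans (swapName-right d c)
    (sym (trans (cong (swapName d b) (rename-∉ (q ∘ there) r)) (swapName-right d b)))))
    where
    c∉c̃ : Unique (c ∷ c̃) → c ∉ c̃
    c∉c̃ (ne ∷ _) s = All.lookup ne s refl
  ...   | no x≢b =
    trans (cong (zip (d ∷ d̃) (c ∷ c̃) ·_) (rename-∉ p x∉))
    (trans (rename-∉ q p) (sym (rename-∉ q x∉)))
    where
    x∉ : x ∉ b ∷ b̃
    x∉ (here e)  = x≢b e
    x∉ (there s) = r s

  rename-onto : Unique b̃ → FreshVariant c̃ b̃ A → c ∈ c̃ → ∃ λ x → x ∈ b̃ × zip c̃ b̃ · x ≡ c
  rename-onto {[]}    {c ∷ c̃} u v p with FreshVariant.sameLength v
  ... | ()
  rename-onto {b ∷ b̃} {c ∷ c̃} (b∉b̃ ∷ u) v (here refl) = b , here refl ,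
    trans (cong (swapName c b) (rename-∉ (λ s → avoids-old v (there s) (here refl))
                                         (λ s → All.lookup b∉b̃ s refl)))
          (swapName-right c b)
  rename-onto {b ∷ b̃} {c ∷ c̃} (b∉b̃ ∷ u) v (there p) with rename-onto u (variant-tail v) p
  ... | x , q , refl = x , there q , swapName-skip v p

  -- If `b` occurred again later in the sequence, no name outside `c̃` would reach the entry of `c̃`
  -- at the earlier occurrence. Distinct binders can thus be recovered from a variant of them.
  rename-unique : FreshVariant c̃ b̃ A → (∀ {c} → c ∈ c̃ → ∃ λ x → x ∉ c̃ × zip c̃ b̃ · x ≡ c) → Unique b̃
  rename-unique {b̃ = []} v onto = []
  rename-unique {[]} {b ∷ b̃} v onto with FreshVariant.sameLength v
  ... | ()
  rename-unique {c ∷ c̃} {b ∷ b̃} v onto =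
    All.tabulate (λ { p refl → head∉ p }) ∷ rename-unique (variant-tail v) tail-onto
    where
    c∉c̃ : c ∉ c̃
    c∉c̃ s with FreshVariant.distinct v
    ... | ne ∷ _ = All.lookup ne s refl
    tail-eq : ∀ {x} → x ∉ c ∷ c̃ → x ∈ b̃ → zip (c ∷ c̃) (b ∷ b̃) · x ≡ zip c̃ b̃ · x
    tail-eq x∉ p = swapName-skip v (rename-∈ (variant-tail v) (x∉ ∘ there) p)
    head∉ : b ∉ b̃
    head∉ b∈b̃ with onto (here refl)
    ... | x , x∉ , e with x ∈? b̃
    ...   | yes p = c∉c̃ (subst (_∈ c̃) (trans (sym (tail-eq x∉ p)) e) (rename-∈ (variant-tail v) (x∉ ∘ there) p))
    ...   | no p  = x∉ (here (trans (sym (rename-∉ x∉ λ { (here refl) → p b∈b̃ ; (there s) → p s })) e))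
    tail-onto : ∀ {c′} → c′ ∈ c̃ → ∃ λ x → x ∉ c̃ × zip c̃ b̃ · x ≡ c′
    tail-onto {c′} c′∈ with onto (there c′∈)
    ... | x , x∉ , e with x ∈? b̃
    ...   | yes p = x , x∉ ∘ there , trans (sym (tail-eq x∉ p)) e
    ...   | no p with x ≟ b
    ...     | yes refl = contradiction
            (subst (_∈ c̃) (trans (sym e) (trans (cong (swapName c b) (rename-∉ (x∉ ∘ there) p))
                                                (swapName-right c b))) c′∈) c∉c̃
    ...     | no x≢b  = contradiction
            (there (subst (_∈ c̃) (trans (sym e) (rename-∉ x∉ λ { (here q) → x≢b q ; (there s) → p s })) c′∈)) x∉

  -- With `b̃` distinct the swappings are pairwise disjoint, so the renaming is its own inverse.
  rename-inverse : Unique b̃ → FreshVariant c̃ b̃ A → x ∈ c̃ → zip c̃ b̃ · x ∈ b̃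
  rename-inverse {[]}    {c ∷ c̃} u v p with FreshVariant.sameLength v
  ... | ()
  rename-inverse {b ∷ b̃} {c ∷ c̃} (b∉b̃ ∷ u) v (here refl) = here
    (trans (cong (swapName c b) (rename-∉ c∉c̃ (λ s → avoids-old v (here refl) (there s)))) (swapName-left c b))
    where
    c∉c̃ : c ∉ c̃
    c∉c̃ s with FreshVariant.distinct v
    ... | ne ∷ _ = All.lookup ne s refl
  rename-inverse {b ∷ b̃} {c ∷ c̃} (b∉b̃ ∷ u) v (there p) = there
    (let q = rename-inverse u (variant-tail v) p in
     subst (_∈ b̃) (sym (swapName-other (λ e → avoids-old v (here refl) (there (subst (_∈ b̃) e q)))
                                       (λ e → All.lookup b∉b̃ q (sym e)))) q)

  zip-map : ∀ (f : Name → Name) → Injective _≡_ _≡_ f → ∀ c̃ b̃ x →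
            f (zip c̃ b̃ · x) ≡ zip (map f c̃) (map f b̃) · f x
  zip-map f inj []      b̃       x = refl
  zip-map f inj (c ∷ c̃) []      x = refl
  zip-map f inj (c ∷ c̃) (b ∷ b̃) x = trans (injective-swapName inj c b _)
    (cong (swapName (f c) (f b)) (zip-map f inj c̃ b̃ x))

-- Supports and permutation actions in nominal sets

module NominalProperties {𝓝 : Names} {ℓ : Level} (𝐗 : NominalSet 𝓝 ℓ) where
  open Names 𝓝
  open NameProperties 𝓝
  open NominalSet 𝐗 renaming (refl to ≈-refl; sym to ≈-sym; trans to ≈-trans; reflexive to ≈-reflexive)

  act : Perm → Carrier → Carrier
  act π X = foldr (λ (a , b) → swap a b) X π

  swaps≡act : ∀ c̃ b̃ X → swaps swap c̃ b̃ X ≡ act (zip c̃ b̃) X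
  swaps≡act []      b̃       X = refl
  swaps≡act (c ∷ c̃) []      X = refl
  swaps≡act (c ∷ c̃) (b ∷ b̃) X = cong (swap c b) (swaps≡act c̃ b̃ X)

  act-++ : ∀ π σ X → act (π ++ σ) X ≡ act π (act σ X)
  act-++ π σ X = foldr-++ _ X π σ

  act-cong : ∀ π {X Y} → X ≈ Y → act π X ≈ act π Y
  act-cong []      e = e
  act-cong (_ ∷ π) e = swap-cong (act-cong π e)

  inverse-act : ∀ π X → act (inverse π) (act π X) ≈ X
  inverse-act []            X = ≈-refl
  inverse-act ((a , b) ∷ π) X = ≈-trans (≈-reflexive (act-++ (inverse π) _ _))
    (≈-trans (act-cong (inverse π) swap-involutive) (inverse-act π X))

  act-inverse : ∀ π X → act π (act (inverse π) X) ≈ X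
  act-inverse []            X = ≈-refl
  act-inverse ((a , b) ∷ π) X = ≈-trans (swap-cong (≈-trans (act-cong π (≈-reflexive (act-++ (inverse π) _ _)))
    (act-inverse π _))) swap-involutive

  act-injective : ∀ π {X Y} → act π X ≈ act π Y → X ≈ Y
  act-injective π {X} {Y} e =
    ≈-trans (≈-sym (inverse-act π X)) (≈-trans (act-cong (inverse π) e) (inverse-act π Y))

  -- If `x` were in the support, swapping it with a `z` fresh for both `A` and `X` would affect `X`.
  -- The upper bounds on supports of composite elements come from this test.
  supp-least : ∀ A {x X} → (∀ z → z ∉ A → swap x z X ≈ X) → x ∉ supp X
  supp-least A {x} {X} fixed x∈ =
    supp-affected x∈ (λ p → fresh-∉ (A ++ supp X) (∈-++⁺ʳ A p)) (fixed _ (λ p → fresh-∉ (A ++ supp X) (∈-++⁺ˡ p)))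

  supp-cong : ∀ {X Y x} → X ≈ Y → x ∈ supp X → x ∈ supp Y
  supp-cong {X} {Y} {x} e x∈ with x ∈? supp Y
  ... | yes p = p
  ... | no x∉ = contradiction x∈ (supp-least (supp Y) λ z z∉ →
    ≈-trans (swap-cong e) (≈-trans (supp-supports x∉ z∉) (≈-sym e)))

  -- Conjugation by `(a b)`: if the image of `x` were outside the support, swapping it with almost
  -- any `z` would fix the swapped element, hence swapping `x` with `z` would fix `X`.
  supp-swap : ∀ a b {X x} → x ∈ supp X → swapName a b x ∈ supp (swap a b X)
  supp-swap a b {X} {x} x∈ with swapName a b x ∈? supp (swap a b X)
  ... | yes p = p
  ... | no y∉ = contradiction x∈ (supp-least (a ∷ b ∷ supp (swap a b X)) λ z z∉ →
    ≈-trans (≈-reflexive (cong₂ (λ u v → swap u v X) (sym (swapName-involutive a b x))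
                                (sym (swapName-other (z∉ ∘ here) (z∉ ∘ there ∘ here)))))
    (≈-trans (≈-sym (≈-trans swap-swap (swap-cong swap-involutive)))
    (≈-trans (swap-cong (supp-supports y∉ (z∉ ∘ there ∘ there))) swap-involutive)))

  supp-act : ∀ π {X x} → x ∈ supp X → π · x ∈ supp (act π X)
  supp-act []            x∈ = x∈
  supp-act ((a , b) ∷ π) x∈ = supp-swap a b (supp-act π x∈)

  supp-act⁻ : ∀ π {X x} → π · x ∈ supp (act π X) → x ∈ supp X
  supp-act⁻ π {X} {x} p = supp-cong (inverse-act π X)
    (subst (_∈ _) (·-inverse π x) (supp-act (inverse π) p))

  act-swap : ∀ π c d X → act π (swap c d X) ≈ swap (π · c) (π · d) (act π X)
  act-swap []            c d X = ≈-refl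
  act-swap ((a , b) ∷ π) c d X = ≈-trans (swap-cong (act-swap π c d X)) swap-swap

  private
    act-fresh : ∀ π {X} → names π # supp X → act π X ≈ X
    act-fresh []            _ = ≈-refl
    act-fresh ((a , b) ∷ π) f =
      ≈-trans (swap-cong (act-fresh π (λ (p , q) → f (there (there p) , q))))
              (supp-supports (λ q → f (here refl , q)) (λ q → f (there (here refl) , q)))

    act-commutes : ∀ π c̃ b̃ X → (∀ {c} → c ∈ c̃ → π · c ≡ c) → (∀ {b} → b ∈ b̃ → π · b ≡ b) →
                   act π (act (zip c̃ b̃) X) ≈ act (zip c̃ b̃) (act π X)
    act-commutes π []      b̃       X f g = ≈-refl
    act-commutes π (c ∷ c̃) []      X f g = ≈-refl
    act-commutes π (c ∷ c̃) (b ∷ b̃) X f g = ≈-trans (act-swap π c b _)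
      (≈-trans (≈-reflexive (cong₂ (λ u v → swap u v _) (f (here refl)) (g (here refl))))
      (swap-cong (act-commutes π c̃ b̃ X (f ∘ there) (g ∘ there))))

  -- Conjugating by a renaming of supp X to names not occurring in π turns X
  -- into an element that every swapping of π fixes.
  act-fixed : ∀ π {X} → (∀ {x} → x ∈ supp X → π · x ≡ x) → act π X ≈ X
  act-fixed π {X} f = act-injective σ
    (≈-trans (≈-sym (act-commutes π d̃ s̃ X (λ p → ·-fresh π (avoids-used v p)) f))
             (act-fresh π λ (p , q) → avoids-used v (image q) p))
    where
    s̃ d̃ : List Name
    s̃ = supp X
    d̃ = freshes (length s̃) (s̃ ++ names π)
    v : FreshVariant d̃ s̃ (names π)
    v = freshVariant s̃ (names π)
    σ : Perm
    σ = zip d̃ s̃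
    image : ∀ {y} → y ∈ supp (act σ X) → y ∈ d̃
    image {y} q = subst (_∈ d̃) (inverse-· σ y) (rename-∈ v (λ r → avoids-old v r x∈) x∈)
      where
      x∈ : inverse σ · y ∈ s̃
      x∈ = supp-act⁻ σ (subst (_∈ _) (sym (inverse-· σ y)) q)

  -- `inverse σ` after `π` fixes every name of the support, hence the element. This is the bridge
  -- from computations on names to equations in an arbitrary nominal set.
  act-agree : ∀ π σ {X} → (∀ {x} → x ∈ supp X → π · x ≡ σ · x) → act π X ≈ act σ X
  act-agree π σ {X} f = act-injective (inverse σ)
    (≈-trans (≈-reflexive (sym (act-++ (inverse σ) π X)))
    (≈-trans (act-fixed (inverse σ ++ π) λ {x} p → trans (·-++ (inverse σ) π x)
                (trans (cong (inverse σ ·_) (f p)) (·-inverse σ x)))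
    (≈-sym (inverse-act σ X))))

  act-zip-fresh : ∀ {c̃ b̃ X} → c̃ # supp X → b̃ # supp X → act (zip c̃ b̃) X ≈ X
  act-zip-fresh {c̃} {b̃} c̃# b̃# = act-fixed (zip c̃ b̃) λ p → rename-∉ (λ q → c̃# (q , p)) (λ q → b̃# (q , p))

  swaps-agree : ∀ c̃ b̃ π d̃ ẽ σ {X} →
    (∀ {x} → x ∈ supp X → zip c̃ b̃ · π · x ≡ zip d̃ ẽ · σ · x) →
    swaps swap c̃ b̃ (act π X) ≈ swaps swap d̃ ẽ (act σ X)
  swaps-agree c̃ b̃ π d̃ ẽ σ {X} e
    rewrite swaps≡act c̃ b̃ (act π X) | swaps≡act d̃ ẽ (act σ X)
          | sym (act-++ (zip c̃ b̃) π X) | sym (act-++ (zip d̃ ẽ) σ X)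
    = act-agree (zip c̃ b̃ ++ π) (zip d̃ ẽ ++ σ) λ {x} p →
        trans (·-++ (zip c̃ b̃) π x) (trans (e p) (sym (·-++ (zip d̃ ẽ) σ x)))

  act-swaps : ∀ π c̃ b̃ X → swaps swap (map (π ·_) c̃) (map (π ·_) b̃) (act π X) ≈ act π (swaps swap c̃ b̃ X)
  act-swaps π c̃ b̃ X
    rewrite swaps≡act (map (π ·_) c̃) (map (π ·_) b̃) (act π X) | swaps≡act c̃ b̃ X
          | sym (act-++ (zip (map (π ·_) c̃) (map (π ·_) b̃)) π X) | sym (act-++ π (zip c̃ b̃) X)
    = act-agree (σ ++ π) (π ++ zip c̃ b̃) λ {x} _ →
        trans (·-++ σ π x) (trans (sym (zip-map (π ·_) (·-injective π) c̃ b̃ x)) (sym (·-++ π (zip c̃ b̃) x)))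
    where
    σ : Perm
    σ = zip (map (π ·_) c̃) (map (π ·_) b̃)

-- Supports of substitution instances

module SubstitutionProperties {𝓝 : Names} {ℓ : Level} {𝐓 𝐗 : NominalSet 𝓝 ℓ} (S : Substitution 𝐓 𝐗) where
  open Names 𝓝
  open NameProperties 𝓝
  open Substitution S
  private
    module T = NominalSet 𝐓
    module X where
      open NominalSet 𝐗 public
      open NominalProperties 𝐗 public

  private
    map-other : ∀ {x z} ã → x ∉ ã → z ∉ ã → map (swapName x z) ã ≡ ã
    map-other []      _  _  = refl
    map-other (a ∷ ã) x∉ z∉ = cong₂ _∷_
      (swapName-other (x∉ ∘ here ∘ sym) (z∉ ∘ here ∘ sym)) (map-other ã (x∉ ∘ there) (z∉ ∘ there))

    map-supports : ∀ {x z} T̃ → x ∉ concatMap T.supp T̃ → z ∉ concatMap T.supp T̃ →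
                   Pointwise T._≈_ (map (T.swap x z) T̃) T̃
    map-supports []      _  _  = []
    map-supports (M ∷ T̃) x∉ z∉ = T.supp-supports (x∉ ∘ ∈-++⁺ˡ) (z∉ ∘ ∈-++⁺ˡ) ∷
      map-supports T̃ (x∉ ∘ ∈-++⁺ʳ (T.supp M)) (z∉ ∘ ∈-++⁺ʳ (T.supp M))

    supp-[]-weak : ∀ {X ã T̃ x} → Unique ã → length ã ≡ length T̃ →
                   x ∈ X.supp (X [ ã := T̃ ]) → x ∉ X.supp X → x ∉ ã → x ∈ concatMap T.supp T̃
    supp-[]-weak {X} {ã} {T̃} {x} u l x∈ x∉X x∉ã with x ∈? concatMap T.supp T̃
    ... | yes p = p
    ... | no x∉T̃ = contradiction x∈ (X.supp-least (X.supp X ++ ã ++ concatMap T.supp T̃) λ z z∉ →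
      X.trans (subst-equivariant u l)
        (subst (λ b̃ → X.swap x z X [ b̃ := map (T.swap x z) T̃ ] X.≈ X [ ã := T̃ ])
          (sym (map-other ã x∉ã (z∉ ∘ ∈-++⁺ʳ (X.supp X) ∘ ∈-++⁺ˡ)))
          (subst-cong u (trans l (sym (length-map _ T̃))) (X.supp-supports x∉X (z∉ ∘ ∈-++⁺ˡ))
            (map-supports T̃ x∉T̃ (z∉ ∘ ∈-++⁺ʳ (X.supp X) ∘ ∈-++⁺ʳ ã)))))

  -- (S1) bounds this support from below. Equivariance bounds it from above for a name outside `ã`;
  -- for a name of `ã`, (S2) first replaces `ã` by fresh names, after which that name is neither
  -- substituted for nor free in the renamed `X`.
  supp-[] : ∀ {X ã T̃ x} → Unique ã → length ã ≡ length T̃ →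
            x ∈ X.supp (X [ ã := T̃ ]) → (x ∈ X.supp X × x ∉ ã) ⊎ x ∈ concatMap T.supp T̃
  supp-[] {X} {ã} {T̃} {x} u l x∈ with x ∈? concatMap T.supp T̃
  ... | yes p = inj₂ p
  ... | no x∉T̃ with x ∈? ã
  ...   | no x∉ã with x ∈? X.supp X
  ...     | yes p = inj₁ (p , x∉ã)
  ...     | no x∉X = inj₂ (supp-[]-weak u l x∈ x∉X x∉ã)
  supp-[] {X} {ã} {T̃} {x} u l x∈ | no x∉T̃ | yes x∈ã =
    inj₂ (supp-[]-weak (FreshVariant.distinct v) (trans (FreshVariant.sameLength v) l)
      (X.supp-cong (subst-alpha u l v) x∈)
      (λ p → renamed (subst (λ Y → x ∈ X.supp Y) (X.swaps≡act (freshes (length ã) (ã ++ X.supp X)) ã X) p))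
      (λ p → avoids-old v p x∈ã))
    where
    v : FreshVariant (freshes (length ã) (ã ++ X.supp X)) ã (X.supp X)
    v = freshVariant ã (X.supp X)
    σ : Perm
    σ = zip (freshes (length ã) (ã ++ X.supp X)) ã
    renamed : x ∉ X.supp (X.act σ X)
    renamed p = go (inverse σ · x) (inverse-· σ x) (X.supp-act⁻ σ (subst (_∈ X.supp (X.act σ X)) (sym (inverse-· σ x)) p))
      where
      go : ∀ y → σ · y ≡ x → y ∉ X.supp X
      go y refl y∈ with y ∈? ã
      ... | yes q = avoids-old v (rename-∈ v (λ r → avoids-used v r y∈) q) x∈ã
      ... | no q  = q (subst (_∈ ã) (rename-∉ (λ r → avoids-used v r y∈) q) x∈ã)

  act-[] : ∀ π {X ã T̃} → Unique ã → length ã ≡ length T̃ →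
           X.act π (X [ ã := T̃ ]) X.≈ X.act π X [ map (π ·_) ã := map (NominalProperties.act 𝐓 π) T̃ ]
  act-[] [] {X} {ã} {T̃} u l rewrite map-id ã | map-id T̃ = X.refl
  act-[] ((a , b) ∷ π) {X} {ã} {T̃} u l
    rewrite map-∘ {g = swapName a b} {f = π ·_} ã | map-∘ {g = T.swap a b} {f = NominalProperties.act 𝐓 π} T̃
    = X.trans (X.swap-cong (act-[] π u l))
        (subst-equivariant (Unique.map⁺ (·-injective π) u) (trans (length-map _ ã) (trans l (sym (length-map _ T̃)))))

-- Lists of free names under renaming

module Equivariance (𝓝 : Names) where
  open Names 𝓝
  open NameProperties 𝓝

  -- Membership rather than an equation with `map f A`, as supports are lists determined only up to
  -- order and repetition. `to` carries occurrences forward, `from` carries freshness forward.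
  record Equi (f : Name → Name) (A A′ : List Name) : Set where
    constructor equi
    field
      to   : ∀ {x} → x ∈ A → f x ∈ A′
      from : ∀ {x} → f x ∈ A′ → x ∈ A
  open Equi public

  private variable
    f g : Name → Name
    A A′ B B′ b̃ c̃ : List Name

  equi-[] : Equi f [] []
  equi-[] = equi (λ ()) (λ ())

  equi-++ : Equi f A A′ → Equi f B B′ → Equi f (A ++ B) (A′ ++ B′)
  equi-++ {A = A} {A′ = A′} p q = equi
    (λ r → [ ∈-++⁺ˡ ∘ to p , ∈-++⁺ʳ A′ ∘ to q ]′ (∈-++⁻ A r))
    (λ r → [ ∈-++⁺ˡ ∘ from p , ∈-++⁺ʳ A ∘ from q ]′ (∈-++⁻ A′ r))

  equi-∖ : Injective _≡_ _≡_ f → Equi f A A′ → Equi f (A ∖ B) (A′ ∖ map f B)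
  equi-∖ {f = f} inj p = equi
    (λ r → let x∈ , x∉ = ∈-∖⁻ r in ∈-∖⁺ (to p x∈) (x∉ ∘ ∈-map-injective inj))
    (λ r → let x∈ , x∉ = ∈-∖⁻ r in ∈-∖⁺ (from p x∈) (x∉ ∘ ∈-map⁺ f))

  equi-∘ : Equi f A A′ → Equi g A′ B → Equi (g ∘ f) A B
  equi-∘ p q = equi (to q ∘ to p) (from p ∘ from q)

  equi-map : Injective _≡_ _≡_ f → Equi f A (map f A)
  equi-map {f = f} inj = equi (∈-map⁺ f) (∈-map-injective inj)

  -- Free names survive alpha-conversion: on them the renaming is the identity, and the bound ones
  -- land in `c̃`, which is removed again.
  rename-∖ : FreshVariant c̃ b̃ A → Equi (zip c̃ b̃ ·_) A A′ → Equi id (A ∖ b̃) (A′ ∖ c̃)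
  rename-∖ {c̃} {b̃} {A} {A′} v p = equi fwd (λ q → bwd (∈-∖⁻ q))
    where
    fwd : ∀ {x} → x ∈ A ∖ b̃ → x ∈ A′ ∖ c̃
    fwd q with ∈-∖⁻ q
    ... | x∈ , x∉ = ∈-∖⁺ (subst (_∈ A′) (rename-∉ x∉c̃ x∉) (to p x∈)) x∉c̃
      where x∉c̃ = λ r → avoids-used v r x∈
    go : ∀ {y} x → zip c̃ b̃ · x ≡ y → y ∈ A′ → y ∉ c̃ → y ∈ A ∖ b̃
    go x refl y∈ y∉ = subst (_∈ A ∖ b̃) (sym (rename-∉ x∉c̃ x∉b̃)) (∈-∖⁺ x∈ x∉b̃)
      where
      x∈ = from p y∈
      x∉c̃ = λ r → avoids-used v r x∈
      x∉b̃ = λ r → y∉ (rename-∈ v x∉c̃ r)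
    bwd : ∀ {y} → y ∈ A′ × y ∉ c̃ → y ∈ A ∖ b̃
    bwd {y} (y∈ , y∉) = go (inverse (zip c̃ b̃) · y) (inverse-· (zip c̃ b̃) y) y∈ y∉

  -- Meeting point of two alpha-conversions, in the form that `rename-agree` expects.
  common : ∀ (f g : Name → Name) (b̃ A B : List Name) → List Name
  common f g b̃ A B = freshes (length b̃) ((map f b̃ ++ A) ++ map g b̃ ++ B)

  common-left : ∀ f g b̃ A B → FreshVariant (common f g b̃ A B) (map f b̃) A
  common-left f g b̃ A B = record
    { distinct = freshes-unique (length b̃) _
    ; sameLength = trans (length-freshes (length b̃) _) (sym (length-map f b̃))
    ; avoids = λ (p , q) → freshes-# (length b̃) _ (p , ∈-++⁺ˡ q) }

  common-right : ∀ f g b̃ A B → FreshVariant (common f g b̃ A B) (map g b̃) B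
  common-right f g b̃ A B = record
    { distinct = freshes-unique (length b̃) _
    ; sameLength = trans (length-freshes (length b̃) _) (sym (length-map g b̃))
    ; avoids = λ (p , q) → freshes-# (length b̃) _ (p , ∈-++⁺ʳ (map f b̃ ++ A) q) }

  map-variant : Injective _≡_ _≡_ f → Equi f A A′ → FreshVariant c̃ b̃ A →
                FreshVariant (map f c̃) (map f b̃) A′
  map-variant {f = f} {c̃ = c̃} {b̃ = b̃} inj p v = record
    { distinct = Unique.map⁺ inj distinct
    ; sameLength = trans (length-map f c̃) (trans sameLength (sym (length-map f b̃)))
    ; avoids = λ (q , r) → let x , x∈ , e = ∈-map⁻ f q in
        avoids (x∈ , from (equi-++ (equi-map inj) p) (subst (_∈ _) e r)) }
    where open FreshVariant v

-- Preagents up to alpha-equivalence as a nominal set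

module PreagentProperties {𝓝 : Names} {ℓ : Level} (𝒫 : PsiCalculus 𝓝 ℓ) where
  open Names 𝓝
  open NameProperties 𝓝
  open Equivariance 𝓝
  open PsiCalculus 𝒫
  open Psi 𝒫 renaming (cong to cong-≈; sym to symα; trans to transα)

  module Tₙ = NominalProperties 𝐓
  module Cₙ = NominalProperties 𝐂
  module Aₙ = NominalProperties 𝐀

  private
    -- The laws of `𝐏` are proved from facts about this action, so it has to precede `Pₙ.act`, with
    -- which it coincides by definition.
    act : Perm → Preagent → Preagent
    act π P = foldr (λ (a , b) → swap a b) P π

  actBranches : Perm → List (Condition × Preagent) → List (Condition × Preagent)
  actBranches π []            = []
  actBranches π ((φ , P) ∷ B) = (Cₙ.act π φ , act π P) ∷ actBranches π B

  act-output : ∀ π {M N P} → act π (output M N P) ≡ output (Tₙ.act π M) (Tₙ.act π N) (act π P)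
  act-output []            = refl
  act-output ((a , b) ∷ π) = cong (swap a b) (act-output π)

  act-input : ∀ π {M x̃ N P} →
              act π (input M x̃ N P) ≡ input (Tₙ.act π M) (map (π ·_) x̃) (Tₙ.act π N) (act π P)
  act-input []            {x̃ = x̃} = cong (λ z̃ → input _ z̃ _ _) (sym (map-id x̃))
  act-input ((a , b) ∷ π) {x̃ = x̃} = trans (cong (swap a b) (act-input π))
    (cong (λ z̃ → input _ z̃ _ _) (sym (map-∘ {g = swapName a b} {f = π ·_} x̃)))

  act-case : ∀ π {B} → act π (case B) ≡ case (actBranches π B)
  act-case []            {B} = cong case (sym (none B))
    where
    none : ∀ B → actBranches [] B ≡ B
    none []            = refl
    none ((φ , P) ∷ B) = cong (_ ∷_) (none B)
  act-case ((a , b) ∷ π) {B} = trans (cong (swap a b) (act-case π)) (cong case (one B))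
    where
    one : ∀ B → swapBranches a b (actBranches π B) ≡ actBranches ((a , b) ∷ π) B
    one []            = refl
    one ((φ , P) ∷ B) = cong (_ ∷_) (one B)

  act-ν : ∀ π {c P} → act π (ν c P) ≡ ν (π · c) (act π P)
  act-ν []            = refl
  act-ν ((a , b) ∷ π) = cong (swap a b) (act-ν π)

  act-∣ : ∀ π {P Q} → act π (P ∣ Q) ≡ (act π P ∣ act π Q)
  act-∣ []            = refl
  act-∣ ((a , b) ∷ π) = cong (swap a b) (act-∣ π)

  act-! : ∀ π {P} → act π (! P) ≡ ! act π P
  act-! []            = refl
  act-! ((a , b) ∷ π) = cong (swap a b) (act-! π)

  act-𝟎 : ∀ π → act π 𝟎 ≡ 𝟎
  act-𝟎 []            = refl
  act-𝟎 ((a , b) ∷ π) = cong (swap a b) (act-𝟎 π)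

  act-⦅⦆ : ∀ π {Ψ} → act π ⦅ Ψ ⦆ ≡ ⦅ Aₙ.act π Ψ ⦆
  act-⦅⦆ []            = refl
  act-⦅⦆ ((a , b) ∷ π) = cong (swap a b) (act-⦅⦆ π)

  supp-equiᵀ : ∀ π {M} → Equi (π ·_) (T.supp M) (T.supp (Tₙ.act π M))
  supp-equiᵀ π = equi (Tₙ.supp-act π) (Tₙ.supp-act⁻ π)

  supp-equiᶜ : ∀ π {φ} → Equi (π ·_) (C.supp φ) (C.supp (Cₙ.act π φ))
  supp-equiᶜ π = equi (Cₙ.supp-act π) (Cₙ.supp-act⁻ π)

  supp-equiᴬ : ∀ π {Ψ} → Equi (π ·_) (A.supp Ψ) (A.supp (Aₙ.act π Ψ))
  supp-equiᴬ π = equi (Aₙ.supp-act π) (Aₙ.supp-act⁻ π)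

  mutual
    n-swap : ∀ a b P → Equi (swapName a b) (n P) (n (swap a b P))
    n-swap a b 𝟎              = equi-[]
    n-swap a b (output M N P) = equi-++ (supp-equiᵀ ((a , b) ∷ [])) (equi-++ (supp-equiᵀ ((a , b) ∷ [])) (n-swap a b P))
    n-swap a b (input M x̃ N P) = equi-++ (supp-equiᵀ ((a , b) ∷ []))
      (equi-∖ (swapName-injective a b) (equi-++ (supp-equiᵀ ((a , b) ∷ [])) (n-swap a b P)))
    n-swap a b (case B)       = n-swapBranches a b B
    n-swap a b (ν c P)        = equi-∖ (swapName-injective a b) (n-swap a b P)
    n-swap a b (P ∣ Q)        = equi-++ (n-swap a b P) (n-swap a b Q)
    n-swap a b (! P)          = n-swap a b P
    n-swap a b ⦅ Ψ ⦆          = supp-equiᴬ ((a , b) ∷ [])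

    n-swapBranches : ∀ a b B → Equi (swapName a b) (nBranches B) (nBranches (swapBranches a b B))
    n-swapBranches a b []            = equi-[]
    n-swapBranches a b ((φ , P) ∷ B) =
      equi-++ (supp-equiᶜ ((a , b) ∷ [])) (equi-++ (n-swap a b P) (n-swapBranches a b B))

  n-act : ∀ π P → Equi (π ·_) (n P) (n (act π P))
  n-act []            P = equi id id
  n-act ((a , b) ∷ π) P = equi-∘ (n-act π P) (n-swap a b (act π P))

  private
    agree-++ : ∀ π σ π′ σ′ {x} → π · π′ · x ≡ σ · σ′ · x → (π ++ π′) · x ≡ (σ ++ σ′) · x
    agree-++ π σ π′ σ′ {x} e = trans (·-++ π π′ x) (trans e (sym (·-++ σ σ′ x)))

    swaps≡actᵖ : ∀ c̃ b̃ P → swaps swap c̃ b̃ P ≡ act (zip c̃ b̃) P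
    swaps≡actᵖ []      b̃       X = refl
    swaps≡actᵖ (c ∷ c̃) []      X = refl
    swaps≡actᵖ (c ∷ c̃) (b ∷ b̃) X = cong (swap c b) (swaps≡actᵖ c̃ b̃ X)

    actᵖ-++ : ∀ π σ P → act (π ++ σ) P ≡ act π (act σ P)
    actᵖ-++ π σ P = foldr-++ _ P π σ

    ≡⇒≡α : ∀ {P Q} → P ≡ Q → P ≡α Q
    ≡⇒≡α refl = refl

  mutual
    -- Induction needs two arbitrary permutations, because under a binder both
    -- sides are renamed to a common fresh name.
    act-agreeᵖ : ∀ P π σ → (∀ {x} → x ∈ n P → π · x ≡ σ · x) → act π P ≡α act σ P
    act-agreeᵖ 𝟎 π σ e rewrite act-𝟎 π | act-𝟎 σ = refl
    act-agreeᵖ (output M N P) π σ e rewrite act-output π {M} {N} {P} | act-output σ {M} {N} {P} =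
      output (Tₙ.act-agree π σ (e ∘ ∈-++⁺ˡ)) (Tₙ.act-agree π σ (e ∘ ∈-++⁺ʳ (T.supp M) ∘ ∈-++⁺ˡ))
             (act-agreeᵖ P π σ (e ∘ ∈-++⁺ʳ (T.supp M) ∘ ∈-++⁺ʳ (T.supp N)))
    act-agreeᵖ (input M x̃ N P) π σ e rewrite act-input π {M} {x̃} {N} {P} | act-input σ {M} {x̃} {N} {P} =
      transα (alpha-input vπ)
      (transα (input (Tₙ.act-agree π σ (e ∘ ∈-++⁺ˡ))
                    (Tₙ.swaps-agree z̃ (map (π ·_) x̃) π z̃ (map (σ ·_) x̃) σ (renamed ∘ ∈-++⁺ˡ)) derivative)
      (symα (alpha-input vσ)))
      where
      Aπ Aσ z̃ : List Name
      Aπ = T.supp (Tₙ.act π N) ++ n (act π P)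
      Aσ = T.supp (Tₙ.act σ N) ++ n (act σ P)
      z̃  = common (π ·_) (σ ·_) x̃ Aπ Aσ
      vπ = common-left (π ·_) (σ ·_) x̃ Aπ Aσ
      vσ = common-right (π ·_) (σ ·_) x̃ Aπ Aσ
      renamed : ∀ {x} → x ∈ T.supp N ++ n P →
                zip z̃ (map (π ·_) x̃) · π · x ≡ zip z̃ (map (σ ·_) x̃) · σ · x
      renamed x∈ = rename-agree (·-injective π) (·-injective σ) vπ vσ
        (λ r → avoids-used vπ r (to (equi-++ (supp-equiᵀ π) (n-act π P)) x∈))
        (λ r → avoids-used vσ r (to (equi-++ (supp-equiᵀ σ) (n-act σ P)) x∈))
        (λ x∉ → e (∈-++⁺ʳ (T.supp M) (∈-∖⁺ x∈ x∉)))
      derivative : swaps swap z̃ (map (π ·_) x̃) (act π P) ≡α swaps swap z̃ (map (σ ·_) x̃) (act σ P)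
      derivative
        rewrite swaps≡actᵖ z̃ (map (π ·_) x̃) (act π P) | swaps≡actᵖ z̃ (map (σ ·_) x̃) (act σ P)
              | sym (actᵖ-++ (zip z̃ (map (π ·_) x̃)) π P) | sym (actᵖ-++ (zip z̃ (map (σ ·_) x̃)) σ P)
        = act-agreeᵖ P (zip z̃ (map (π ·_) x̃) ++ π) (zip z̃ (map (σ ·_) x̃) ++ σ)
            λ x∈ → agree-++ (zip z̃ (map (π ·_) x̃)) (zip z̃ (map (σ ·_) x̃)) π σ
            (renamed (∈-++⁺ʳ (T.supp N) x∈))
    act-agreeᵖ (case B) π σ e rewrite act-case π {B} | act-case σ {B} = case (act-agreeBranches B π σ e)
    act-agreeᵖ (ν a P) π σ e rewrite act-ν π {a} {P} | act-ν σ {a} {P} =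
      transα (alpha-ν (avoids-used vπ (here refl)))
      (transα (ν (act-agreeᵖ P ((d , π · a) ∷ π) ((d , σ · a) ∷ σ) λ x∈ →
                  rename-agree (·-injective π) (·-injective σ) vπ vσ
                    (λ r → avoids-used vπ r (to (n-act π P) x∈))
                    (λ r → avoids-used vσ r (to (n-act σ P) x∈))
                    (λ x∉ → e (∈-∖⁺ x∈ x∉))))
      (symα (alpha-ν (avoids-used vσ (here refl)))))
      where
      vπ = common-left (π ·_) (σ ·_) (a ∷ []) (n (act π P)) (n (act σ P))
      vσ = common-right (π ·_) (σ ·_) (a ∷ []) (n (act π P)) (n (act σ P))
      d : Name
      d = fresh ((map (π ·_) (a ∷ []) ++ n (act π P)) ++ map (σ ·_) (a ∷ []) ++ n (act σ P))
    act-agreeᵖ (P ∣ Q) π σ e rewrite act-∣ π {P} {Q} | act-∣ σ {P} {Q} =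
      act-agreeᵖ P π σ (e ∘ ∈-++⁺ˡ) ∣ act-agreeᵖ Q π σ (e ∘ ∈-++⁺ʳ (n P))
    act-agreeᵖ (! P) π σ e rewrite act-! π {P} | act-! σ {P} = ! act-agreeᵖ P π σ e
    act-agreeᵖ ⦅ Ψ ⦆ π σ e rewrite act-⦅⦆ π {Ψ} | act-⦅⦆ σ {Ψ} = ⦅ Aₙ.act-agree π σ e ⦆

    act-agreeBranches : ∀ B π σ → (∀ {x} → x ∈ nBranches B → π · x ≡ σ · x) →
      Pointwise (Product.Pointwise C._≈_ _≡α_) (actBranches π B) (actBranches σ B)
    act-agreeBranches [] π σ e = []
    act-agreeBranches ((φ , P) ∷ B) π σ e =
      (Cₙ.act-agree π σ (e ∘ ∈-++⁺ˡ) , act-agreeᵖ P π σ (e ∘ ∈-++⁺ʳ (C.supp φ) ∘ ∈-++⁺ˡ)) ∷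
      act-agreeBranches B π σ (e ∘ ∈-++⁺ʳ (C.supp φ) ∘ ∈-++⁺ʳ (n P))

  swap-swapsᵖ : ∀ a b c̃ b̃ P → swaps swap (map (swapName a b) c̃) (map (swapName a b) b̃) (swap a b P)
                              ≡α swap a b (swaps swap c̃ b̃ P)
  swap-swapsᵖ a b c̃ b̃ P
    rewrite swaps≡actᵖ (map (swapName a b) c̃) (map (swapName a b) b̃) (swap a b P) | swaps≡actᵖ c̃ b̃ P
    = transα (≡⇒≡α (sym (actᵖ-++ σ ((a , b) ∷ []) P)))
        (act-agreeᵖ P (σ ++ (a , b) ∷ []) ((a , b) ∷ zip c̃ b̃)
          (λ {x} _ → trans (·-++ σ ((a , b) ∷ []) x) (sym (zip-map (swapName a b) (swapName-injective a b) c̃ b̃ x))))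
    where σ = zip (map (swapName a b) c̃) (map (swapName a b) b̃)

  private
    swapᵀ-equi : ∀ a b {M} → Equi (swapName a b) (T.supp M) (T.supp (T.swap a b M))
    swapᵀ-equi a b = supp-equiᵀ ((a , b) ∷ [])

  mutual
    swap-≡α : ∀ a b {P Q} → P ≡α Q → swap a b P ≡α swap a b Q
    swap-≡α a b refl = refl
    swap-≡α a b (symα e) = symα (swap-≡α a b e)
    swap-≡α a b (transα e f) = transα (swap-≡α a b e) (swap-≡α a b f)
    swap-≡α a b (alpha-input {M} {x̃} {z̃} {N} {P} v) =
      transα (alpha-input (map-variant (swapName-injective a b) (equi-++ (swapᵀ-equi a b) (n-swap a b P)) v))
            (input T.refl (Tₙ.act-swaps ((a , b) ∷ []) z̃ x̃ N) (swap-swapsᵖ a b z̃ x̃ P))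
    swap-≡α a b (alpha-ν {c} {d} {P} d∉) =
      transα (alpha-ν (λ p → d∉ (from (n-swap a b P) p)))
            (ν (swap-swapsᵖ a b (d ∷ []) (c ∷ []) P))
    swap-≡α a b (output e f g) = output (T.swap-cong e) (T.swap-cong f) (swap-≡α a b g)
    swap-≡α a b (input e f g)  = input (T.swap-cong e) (T.swap-cong f) (swap-≡α a b g)
    swap-≡α a b (case e)       = case (swap-≡αBranches a b e)
    swap-≡α a b (ν e)          = ν (swap-≡α a b e)
    swap-≡α a b (e ∣ f)        = swap-≡α a b e ∣ swap-≡α a b f
    swap-≡α a b (! e)          = ! swap-≡α a b e
    swap-≡α a b ⦅ e ⦆          = ⦅ A.swap-cong e ⦆

    swap-≡αBranches : ∀ a b {B B′} → Pointwise (Product.Pointwise C._≈_ _≡α_) B B′ →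
      Pointwise (Product.Pointwise C._≈_ _≡α_) (swapBranches a b B) (swapBranches a b B′)
    swap-≡αBranches a b []            = []
    swap-≡αBranches a b ((e , f) ∷ g) = (C.swap-cong e , swap-≡α a b f) ∷ swap-≡αBranches a b g

  private
    equi-id-refl : ∀ {A} → Equi id A A
    equi-id-refl = equi id id

    equi-id-sym : ∀ {A B} → Equi id A B → Equi id B A
    equi-id-sym e = equi (from e) (to e)

    supp-≈ᵀ : ∀ {M N} → M T.≈ N → Equi id (T.supp M) (T.supp N)
    supp-≈ᵀ e = equi (Tₙ.supp-cong e) (Tₙ.supp-cong (T.sym e))

    equi-id-∖ : ∀ {A A′ B} → Equi id A A′ → Equi id (A ∖ B) (A′ ∖ B)
    equi-id-∖ p = equi
      (λ r → let x∈ , x∉ = ∈-∖⁻ r in ∈-∖⁺ (to p x∈) x∉)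
      (λ r → let x∈ , x∉ = ∈-∖⁻ r in ∈-∖⁺ (from p x∈) x∉)

  swaps-equiᵀ : ∀ c̃ b̃ M → Equi (zip c̃ b̃ ·_) (T.supp M) (T.supp (swaps T.swap c̃ b̃ M))
  swaps-equiᵀ c̃ b̃ M rewrite Tₙ.swaps≡act c̃ b̃ M = supp-equiᵀ (zip c̃ b̃)

  swaps-equiᵖ : ∀ c̃ b̃ P → Equi (zip c̃ b̃ ·_) (n P) (n (swaps swap c̃ b̃ P))
  swaps-equiᵖ c̃ b̃ P rewrite swaps≡actᵖ c̃ b̃ P = n-act (zip c̃ b̃) P

  mutual
    n-≡α : ∀ {P Q} → P ≡α Q → Equi id (n P) (n Q)
    n-≡α refl        = equi-id-refl
    n-≡α (symα e)     = equi-id-sym (n-≡α e)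
    n-≡α (transα e f) = equi-∘ (n-≡α e) (n-≡α f)
    n-≡α (alpha-input {M} {x̃} {z̃} {N} {P} v) = equi-++ {A = T.supp M} equi-id-refl
      (rename-∖ v (equi-++ (swaps-equiᵀ z̃ x̃ N) (swaps-equiᵖ z̃ x̃ P)))
    n-≡α (alpha-ν {a} {b} {P} b∉) with b ≟ a
    -- `alpha-ν` admits `b` equal to `a`, a renaming that no `FreshVariant` describes.
    ... | yes refl = equi-id-∖ (equi
      (λ {x} p → subst (_∈ n (swap a a P)) (swapName-id a x) (to (n-swap a a P) p))
      (λ {x} p → from (n-swap a a P) (subst (_∈ n (swap a a P)) (sym (swapName-id a x)) p)))
    ... | no b≢a = rename-∖ (record { distinct = [] ∷ [] ; sameLength = refl
      ; avoids = λ { (here refl , here e) → b≢a e ; (here refl , there p) → b∉ p } }) (n-swap b a P)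
    n-≡α (output e f g) = equi-++ (supp-≈ᵀ e) (equi-++ (supp-≈ᵀ f) (n-≡α g))
    n-≡α (input e f g)  = equi-++ (supp-≈ᵀ e) (equi-id-∖ (equi-++ (supp-≈ᵀ f) (n-≡α g)))
    n-≡α (case e)       = n-≡αBranches e
    n-≡α (ν e)          = equi-id-∖ (n-≡α e)
    n-≡α (e ∣ f)        = equi-++ (n-≡α e) (n-≡α f)
    n-≡α (! e)          = n-≡α e
    n-≡α ⦅ e ⦆          = equi (Aₙ.supp-cong e) (Aₙ.supp-cong (A.sym e))

    n-≡αBranches : ∀ {B B′} → Pointwise (Product.Pointwise C._≈_ _≡α_) B B′ → Equi id (nBranches B) (nBranches B′)
    n-≡αBranches []            = equi-[]
    n-≡αBranches ((e , f) ∷ g) = equi-++ (equi (Cₙ.supp-cong e) (Cₙ.supp-cong (C.sym e)))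
      (equi-++ (n-≡α f) (n-≡αBranches g))

  -- The swapping equations compare permutations that agree on names (for `supp-supports`, on the
  -- free names), so `act-agreeᵖ` settles them. `supp-affected` holds because alpha-equivalence
  -- preserves free names.
  𝐏 : NominalSet 𝓝 ℓ
  𝐏 = record
    { setoid = record { Carrier = Preagent ; _≈_ = _≡α_
                      ; isEquivalence = record { refl = refl ; sym = symα ; trans = transα } }
    ; swap = swap
    ; swap-cong = λ {a} {b} → swap-≡α a b
    ; swap-id = λ {a} {P} → act-agreeᵖ P ((a , a) ∷ []) [] (λ {x} _ → swapName-id a x)
    ; swap-involutive = λ {a} {b} {P} →
        act-agreeᵖ P ((a , b) ∷ (a , b) ∷ []) [] (λ {x} _ → swapName-involutive a b x)
    ; swap-swap = λ {a} {b} {c} {d} {P} →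
        act-agreeᵖ P ((a , b) ∷ (c , d) ∷ []) ((swapName a b c , swapName a b d) ∷ (a , b) ∷ [])
          (λ {x} _ → injective-swapName (swapName-injective a b) c d x)
    ; supp = n
    ; supp-supports = λ {a} {b} {P} a∉ b∉ → act-agreeᵖ P ((a , b) ∷ []) []
        (λ p → swapName-other (λ { refl → a∉ p }) (λ { refl → b∉ p }))
    ; supp-affected = λ {a} {b} {P} a∈ b∉ e → b∉ (to (n-≡α e)
        (subst (_∈ n (swap a b P)) (swapName-left a b) (to (n-swap a b P) a∈)))
    }

  module Pₙ = NominalProperties 𝐏

-- Frames, compared at fresh binders, and frames of contexts

module FrameProperties {𝓝 : Names} {ℓ : Level} (𝒫 : PsiCalculus 𝓝 ℓ) where
  open Names 𝓝
  open NameProperties 𝓝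
  open Equivariance 𝓝
  open PsiCalculus 𝒫
  open Psi 𝒫 renaming (cong to cong-≈; sym to symα; trans to transα)
  open PreagentProperties 𝒫

  ≃-refl : ∀ {Ψ} → Ψ ≃ Ψ
  ≃-refl φ = Equivalence.refl

  ≃-sym : ∀ {Ψ Φ} → Ψ ≃ Φ → Φ ≃ Ψ
  ≃-sym e φ = Equivalence.sym (e φ)

  ≃-trans : ∀ {Ψ Φ Θ} → Ψ ≃ Φ → Φ ≃ Θ → Ψ ≃ Θ
  ≃-trans e f φ = Equivalence.trans (e φ) (f φ)

  ≈⇒≃ : ∀ {Ψ Φ} → Ψ A.≈ Φ → Ψ ≃ Φ
  ≈⇒≃ e φ = mk⇔ (⊢-resp e C.refl) (⊢-resp (A.sym e) C.refl)

  ⊗-≃ : ∀ {Ψ Ψ′ Φ Φ′} → Ψ ≃ Ψ′ → Φ ≃ Φ′ → Ψ ⊗ Φ ≃ Ψ′ ⊗ Φ′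
  ⊗-≃ e f = ≃-trans (⊗-compositional e)
    (≃-trans ⊗-commutative (≃-trans (⊗-compositional f) ⊗-commutative))

  ⊗-identityˡ : ∀ {Ψ} → 𝟏 ⊗ Ψ ≃ Ψ
  ⊗-identityˡ = ≃-trans ⊗-commutative ⊗-identity

  act-⊗ : ∀ π {Ψ Φ} → Aₙ.act π (Ψ ⊗ Φ) A.≈ (Aₙ.act π Ψ ⊗ Aₙ.act π Φ)
  act-⊗ []      = A.refl
  act-⊗ (_ ∷ π) = A.trans (A.swap-cong (act-⊗ π)) ⊗-equivariant

  act-𝟏 : ∀ π → Aₙ.act π 𝟏 A.≈ 𝟏
  act-𝟏 []      = A.refl
  act-𝟏 (_ ∷ π) = A.trans (A.swap-cong (act-𝟏 π)) 𝟏-equivariant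

  act-⊢ : ∀ π {Ψ φ} → Ψ ⊢ φ → Aₙ.act π Ψ ⊢ Cₙ.act π φ
  act-⊢ []      p = p
  act-⊢ (_ ∷ π) p = ⊢-equivariant (act-⊢ π p)

  act-↔̇ : ∀ π {M N} → Cₙ.act π (M ↔̇ N) C.≈ (Tₙ.act π M ↔̇ Tₙ.act π N)
  act-↔̇ []      = C.refl
  act-↔̇ (_ ∷ π) = C.trans (C.swap-cong (act-↔̇ π)) ↔̇-equivariant

  ⊢-reflects : ∀ π {Ψ φ} → Aₙ.act π Ψ ⊢ Cₙ.act π φ → Ψ ⊢ φ
  ⊢-reflects π p = ⊢-resp (Aₙ.inverse-act π _) (Cₙ.inverse-act π _) (act-⊢ (inverse π) p)

  act-≃ : ∀ π {Ψ Φ} → Ψ ≃ Φ → Aₙ.act π Ψ ≃ Aₙ.act π Φ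
  act-≃ π e φ = mk⇔ (go e) (go (≃-sym e))
    where
    go : ∀ {Ψ Φ} → Ψ ≃ Φ → Aₙ.act π Ψ ⊢ φ → Aₙ.act π Φ ⊢ φ
    go e p = ⊢-resp A.refl (Cₙ.act-inverse π φ) (act-⊢ π (Equivalence.to (e _)
      (⊢-reflects π (⊢-resp A.refl (C.sym (Cₙ.act-inverse π φ)) p))))

  record Fresh (k : ℕ) (A d̃ : List Name) : Set where
    constructor mkFresh
    field
      distinct : Unique d̃
      size     : length d̃ ≡ k
      avoids   : d̃ # A

  -- Frames are compared through their instances at all sequences d̃ of binders
  -- that avoid some finite set.
  Eventually : ∀ {p} → ℕ → (List Name → Set p) → Set p
  Eventually k Q = ∃ λ A → ∀ {d̃} → Fresh k A d̃ → Q d̃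

  private variable
    p q r : Level
    k l : ℕ

  weaken : ∀ {A B d̃} → B ⊆ A → Fresh k A d̃ → Fresh k B d̃
  weaken s (mkFresh u e a) = mkFresh u e λ (x∈ , y∈) → a (x∈ , s y∈)

  everywhere : {Q : List Name → Set p} → (∀ d̃ → length d̃ ≡ k → Q d̃) → Eventually k Q
  everywhere f = [] , λ {d̃} v → f d̃ (Fresh.size v)

  eventually₂ : {Q : List Name → Set p} {R : List Name → Set q} {S : List Name → Set r} →
                (∀ {d̃} → Q d̃ → R d̃ → S d̃) → Eventually k Q → Eventually k R → Eventually k S
  eventually₂ f (A , g) (B , h) = A ++ B , λ v →
    f (g (weaken ∈-++⁺ˡ v)) (h (weaken (∈-++⁺ʳ A) v))

  eventually₁ : {Q : List Name → Set p} {R : List Name → Set q} →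
                (∀ {d̃} → Q d̃ → R d̃) → Eventually k Q → Eventually k R
  eventually₁ f (A , g) = A , f ∘ g

  split : ∀ k {d̃ A} → Fresh (k ℕ.+ l) A d̃ →
          ∃₂ λ d̃₁ d̃₂ → d̃ ≡ d̃₁ ++ d̃₂ × Fresh k A d̃₁ × Fresh l A d̃₂ × d̃₁ # d̃₂
  split zero    {d̃} v = [] , d̃ , refl , mkFresh [] refl (λ ()) , v , λ ()
  split (suc k) {d ∷ d̃} (mkFresh (d∉ ∷ u) e a) with split k (mkFresh u (ℕ.suc-injective e) (λ (x , y) → a (there x , y)))
  ... | d̃₁ , d̃₂ , refl , mkFresh u₁ e₁ a₁ , v₂ , dis =
    d ∷ d̃₁ , d̃₂ , refl ,
    mkFresh (All.tabulate (λ { q refl → All.lookup d∉ (∈-++⁺ˡ q) refl }) ∷ u₁) (cong suc e₁)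
      (λ { (here refl , y) → a (here refl , y) ; (there x , y) → a₁ (x , y) }) ,
    v₂ , λ { (here refl , y) → All.lookup d∉ (∈-++⁺ʳ d̃₁ y) refl ; (there x , y) → dis (x , y) }

  size : Frame → ℕ
  size (⟨ν b̃ ⟩ Ψ) = length b̃

  inst : Frame → List Name → Assertion
  inst (⟨ν b̃ ⟩ Ψ) d̃ = swaps A.swap d̃ b̃ Ψ

  infix 4 _≋_
  -- Characterises `≡ᶠ` by equations between assertions. That relation has no rule for composing
  -- frames, whereas such equations compose by congruence and can be transported along permutations.
  record _≋_ (F G : Frame) : Set ℓ where
    constructor mk≋
    field
      sameSize  : size F ≡ size G
      instances : Eventually (size F) (λ d̃ → inst F d̃ A.≈ inst G d̃)

  ≋-sym : ∀ {F G} → F ≋ G → G ≋ F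
  ≋-sym {F} {G} (mk≋ e i) = mk≋ (sym e)
    (subst (λ k → Eventually k (λ d̃ → inst G d̃ A.≈ inst F d̃)) e (eventually₁ A.sym i))

  ≋-trans : ∀ {F G H} → F ≋ G → G ≋ H → F ≋ H
  ≋-trans (mk≋ e i) (mk≋ f j) = mk≋ (trans e f)
    (eventually₂ A.trans i (subst (λ k → Eventually k _) (sym e) j))

  private
    toVariant : ∀ {b̃ A B d̃} → length b̃ ≡ k → b̃ ++ A ⊆ B → Fresh k B d̃ → FreshVariant d̃ b̃ A
    toVariant e s (mkFresh u f a) = record
      { distinct = u ; sameLength = trans f (sym e) ; avoids = λ (x , y) → a (x , s y) }

  swaps-swaps : ∀ {d̃ c̃ b̃ A B Ψ} → FreshVariant d̃ c̃ A → FreshVariant c̃ b̃ (A.supp Ψ) →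
                FreshVariant d̃ b̃ B → d̃ # A.supp Ψ →
                swaps A.swap d̃ c̃ (swaps A.swap c̃ b̃ Ψ) A.≈ swaps A.swap d̃ b̃ Ψ
  swaps-swaps {d̃} {c̃} {b̃} {A} {B} {Ψ} v w u d̃#
    rewrite Aₙ.swaps≡act c̃ b̃ Ψ | Aₙ.swaps≡act d̃ c̃ (Aₙ.act (zip c̃ b̃) Ψ) | Aₙ.swaps≡act d̃ b̃ Ψ
    = A.trans (A.reflexive (sym (Aₙ.act-++ (zip d̃ c̃) (zip c̃ b̃) Ψ)))
      (Aₙ.act-agree (zip d̃ c̃ ++ zip c̃ b̃) (zip d̃ b̃) λ {x} x∈ →
        trans (·-++ (zip d̃ c̃) (zip c̃ b̃) x)
          (rename-rename v w u
            (λ q → avoids-used w q x∈) (λ q → d̃# (q , x∈))))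

  swaps-cong : ∀ d̃ b̃ {Ψ Φ} → Ψ A.≈ Φ → swaps A.swap d̃ b̃ Ψ A.≈ swaps A.swap d̃ b̃ Φ
  swaps-cong d̃ b̃ {Ψ} {Φ} e rewrite Aₙ.swaps≡act d̃ b̃ Ψ | Aₙ.swaps≡act d̃ b̃ Φ = Aₙ.act-cong (zip d̃ b̃) e

  ≡ᶠ⇒≋ : ∀ {F G} → F ≡ᶠ G → F ≋ G
  ≡ᶠ⇒≋ (cong-≈ {b̃} e) = mk≋ refl (everywhere λ d̃ _ → swaps-cong d̃ b̃ e)
  ≡ᶠ⇒≋ (alpha {b̃} {c̃} {Ψ} w) = mk≋ (sym (FreshVariant.sameLength w))
    ((c̃ ++ []) ++ (b̃ ++ []) ++ A.supp Ψ , λ v → A.sym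
      (swaps-swaps (toVariant {A = []} (FreshVariant.sameLength w) ∈-++⁺ˡ v) w
        (toVariant {A = []} refl (∈-++⁺ʳ (c̃ ++ []) ∘ ∈-++⁺ˡ) v)
        (λ (x , y) → Fresh.avoids v (x , ∈-++⁺ʳ (c̃ ++ []) (∈-++⁺ʳ (b̃ ++ []) y)))))
  ≡ᶠ⇒≋ (symα e)     = ≋-sym (≡ᶠ⇒≋ e)
  ≡ᶠ⇒≋ (transα e f) = ≋-trans (≡ᶠ⇒≋ e) (≡ᶠ⇒≋ f)

  fresh-list : ∀ k A → Fresh k A (freshes k A)
  fresh-list k A = mkFresh (freshes-unique k A) (length-freshes k A) (freshes-# k A)

  fresh-instance : ∀ F → Eventually (size F) (λ d̃ → F ≡ᶠ ⟨ν d̃ ⟩ inst F d̃)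
  fresh-instance (⟨ν b̃ ⟩ Ψ) = b̃ ++ A.supp Ψ , λ v → alpha (toVariant refl id v)

  witness : ∀ {Q : List Name → Set p} → Eventually k Q → ∀ B → ∃ λ d̃ → d̃ # B × Q d̃
  witness {k = k} (A , f) B = freshes k (A ++ B) ,
    (λ (x , y) → freshes-# k (A ++ B) (x , ∈-++⁺ʳ A y)) , f (weaken ∈-++⁺ˡ (fresh-list k (A ++ B)))

  -- One fresh `d̃` suffices: each frame is an alpha-variant of its own instance at `d̃`, and these
  -- instances are equal.
  ≋⇒≡ᶠ : ∀ {F G} → F ≋ G → F ≡ᶠ G
  ≋⇒≡ᶠ {F} {G} (mk≋ e i) with witness (eventually₂ _,_ i (eventually₂ _,_ (fresh-instance F)
                                (subst (λ k → Eventually k _) (sym e) (fresh-instance G)))) []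
  ... | d̃ , _ , eq , f , g = transα f (transα (cong-≈ eq) (symα g))

  -- Swapping the binders of the witness with `d̃` leaves `φ` alone, as both sequences avoid its
  -- support, so equivariance moves the entailment to `d̃`. Entailment by some suitable variant thus
  -- becomes entailment by almost all instances.
  ⊢ᶠ⇒ : ∀ {F φ} → F ⊢ᶠ φ → Eventually (size F) (λ d̃ → inst F d̃ ⊢ φ)
  ⊢ᶠ⇒ {F} {φ} (b̃ , Ψ , e , b̃# , p) with ≡ᶠ⇒≋ e
  ... | mk≋ s i = eventually₂ (λ eq q → ⊢-resp (A.sym eq) C.refl q) i
    (C.supp φ , λ {d̃} v → ⊢-resp (A.reflexive (sym (Aₙ.swaps≡act d̃ b̃ Ψ)))
        (Cₙ.act-zip-fresh (Fresh.avoids v) b̃#) (act-⊢ (zip d̃ b̃) p))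

  ⇒⊢ᶠ : ∀ {F φ} → Eventually (size F) (λ d̃ → inst F d̃ ⊢ φ) → F ⊢ᶠ φ
  ⇒⊢ᶠ {F} {φ} i with witness (eventually₂ _,_ i (fresh-instance F)) (C.supp φ)
  ... | d̃ , d̃# , p , e = d̃ , inst F d̃ , e , d̃# , p

  zip-++ : ∀ {d̃₁ c̃₁ : List Name} → length d̃₁ ≡ length c̃₁ → ∀ d̃₂ c̃₂ →
           zip (d̃₁ ++ d̃₂) (c̃₁ ++ c̃₂) ≡ zip d̃₁ c̃₁ ++ zip d̃₂ c̃₂
  zip-++ {[]}     {[]}     e d̃₂ c̃₂ = refl
  zip-++ {d ∷ d̃₁} {c ∷ c̃₁} e d̃₂ c̃₂ = cong (_ ∷_) (zip-++ (ℕ.suc-injective e) d̃₂ c̃₂)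

  size-⊗ : ∀ F G → size (F ⊗ᶠ G) ≡ size F ℕ.+ size G
  size-⊗ (⟨ν b̃₁ ⟩ Ψ₁) (⟨ν b̃₂ ⟩ Ψ₂) = trans (length-++ (freshes (length b̃₁) used))
    (cong₂ ℕ._+_ (length-freshes (length b̃₁) used) (length-freshes (length b̃₂) (freshes (length b̃₁) used ++ used)))
    where used = b̃₁ ++ A.supp Ψ₁ ++ b̃₂ ++ A.supp Ψ₂

  -- `⊗ᶠ` has already renamed the two sequences to its own `c̃₁` and `c̃₂`. Renaming these further
  -- to `d̃₁` and `d̃₂` collapses to a single renaming per component, since neither component
  -- mentions the binders of the other.
  inst-⊗ : ∀ F G → ∃ λ B → ∀ {d̃₁ d̃₂} → Fresh (size F) B d̃₁ → Fresh (size G) B d̃₂ → d̃₁ # d̃₂ →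
           inst (F ⊗ᶠ G) (d̃₁ ++ d̃₂) A.≈ (inst F d̃₁ ⊗ inst G d̃₂)
  inst-⊗ (⟨ν b̃₁ ⟩ Ψ₁) (⟨ν b̃₂ ⟩ Ψ₂) = used ++ c̃₁ ++ c̃₂ , λ {d̃₁} {d̃₂} → proof {d̃₁} {d̃₂}
    where
    used c̃₁ c̃₂ : List Name
    used = b̃₁ ++ A.supp Ψ₁ ++ b̃₂ ++ A.supp Ψ₂
    c̃₁   = freshes (length b̃₁) used
    c̃₂   = freshes (length b̃₂) (c̃₁ ++ used)
    from₁ : b̃₁ ++ A.supp Ψ₁ ⊆ used
    from₁ q = [ ∈-++⁺ˡ , ∈-++⁺ʳ b̃₁ ∘ ∈-++⁺ˡ ]′ (∈-++⁻ b̃₁ q)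
    from₂ : b̃₂ ++ A.supp Ψ₂ ⊆ used
    from₂ = ∈-++⁺ʳ b̃₁ ∘ ∈-++⁺ʳ (A.supp Ψ₁)
    w₁ : FreshVariant c̃₁ b̃₁ (A.supp Ψ₁)
    w₁ = toVariant refl from₁ (fresh-list (length b̃₁) used)
    w₂ : FreshVariant c̃₂ b̃₂ (A.supp Ψ₂)
    w₂ = toVariant refl (∈-++⁺ʳ c̃₁ ∘ from₂) (fresh-list (length b̃₂) (c̃₁ ++ used))
    c̃₂#c̃₁ : c̃₂ # c̃₁
    c̃₂#c̃₁ (x , y) = freshes-# (length b̃₂) (c̃₁ ++ used) (x , ∈-++⁺ˡ y)
    proof : ∀ {d̃₁ d̃₂} → Fresh (length b̃₁) (used ++ c̃₁ ++ c̃₂) d̃₁ →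
            Fresh (length b̃₂) (used ++ c̃₁ ++ c̃₂) d̃₂ → d̃₁ # d̃₂ →
            inst ((⟨ν b̃₁ ⟩ Ψ₁) ⊗ᶠ (⟨ν b̃₂ ⟩ Ψ₂)) (d̃₁ ++ d̃₂) A.≈ (swaps A.swap d̃₁ b̃₁ Ψ₁ ⊗ swaps A.swap d̃₂ b̃₂ Ψ₂)
    proof {d̃₁} {d̃₂} f₁ f₂ dis
      rewrite Aₙ.swaps≡act c̃₁ b̃₁ Ψ₁ | Aₙ.swaps≡act c̃₂ b̃₂ Ψ₂
            | Aₙ.swaps≡act d̃₁ b̃₁ Ψ₁ | Aₙ.swaps≡act d̃₂ b̃₂ Ψ₂
            | Aₙ.swaps≡act (d̃₁ ++ d̃₂) (c̃₁ ++ c̃₂) (Aₙ.act (zip c̃₁ b̃₁) Ψ₁ ⊗ Aₙ.act (zip c̃₂ b̃₂) Ψ₂)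
      = A.trans (act-⊗ (zip (d̃₁ ++ d̃₂) (c̃₁ ++ c̃₂))) (⊗-cong
          -- The swappings between `c̃₂` and `d̃₂` act first and miss this component; then its own
          -- two renamings collapse.
          (collapse c̃₁ b̃₁ d̃₁ Ψ₁ λ {x} x∈ → trans
            (cong (zip d̃₁ c̃₁ ·_) (untouched w₁ (x∉c̃₁ x∈)
              (λ y∈ → (λ z → dis′ c̃₁-used z y∈ f₂) , λ z → c̃₂#c̃₁ (z , y∈))
              ((λ z → dis′ supp₁-used z x∈ f₂) ,
               λ z → freshes-# (length b̃₂) (c̃₁ ++ used) (z , ∈-++⁺ʳ c̃₁ (from₁ (∈-++⁺ʳ b̃₁ x∈))))))
            (rename-rename (toVariant {A = []} (length-freshes (length b̃₁) used) (nil c̃₁-used) f₁) w₁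
              (toVariant {A = []} refl (nil (∈-++⁺ˡ ∘ from₁ ∘ ∈-++⁺ˡ)) f₁) (x∉c̃₁ x∈) (λ z → dis′ supp₁-used z x∈ f₁)))
          -- Here the two renamings collapse first, and the outcome is missed by the swappings
          -- between `c̃₁` and `d̃₁`.
          (collapse c̃₂ b̃₂ d̃₂ Ψ₂ λ {x} x∈ → trans
            (cong (zip d̃₁ c̃₁ ·_) (rename-rename
              (toVariant {A = []} (length-freshes (length b̃₂) (c̃₁ ++ used)) (nil c̃₂-used) f₂) w₂
              (toVariant {A = []} refl (nil (∈-++⁺ˡ ∘ from₂ ∘ ∈-++⁺ˡ)) f₂) (x∉c̃₂ x∈) (λ z → dis′ supp₂-used z x∈ f₂)))
            (untouched (toVariant {A = []} refl (nil (∈-++⁺ˡ ∘ from₂ ∘ ∈-++⁺ˡ)) f₂) (λ z → dis′ supp₂-used z x∈ f₂)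
              (λ y∈ → (λ z → dis (z , y∈)) , λ z → dis′ c̃₁-used y∈ z f₂)
              ((λ z → dis′ supp₂-used z x∈ f₁) , λ z → freshes-# (length b̃₁) used (z , from₂ (∈-++⁺ʳ b̃₂ x∈))))))
      where
      ρ : Perm
      ρ = zip (d̃₁ ++ d̃₂) (c̃₁ ++ c̃₂)
      nil : ∀ {A B : List Name} → A ⊆ B → A ++ [] ⊆ B
      nil {A} s q with ∈-++⁻ A q
      ... | inj₁ r = s r
      c̃₁-used : c̃₁ ⊆ used ++ c̃₁ ++ c̃₂
      c̃₁-used = ∈-++⁺ʳ used ∘ ∈-++⁺ˡ
      c̃₂-used : c̃₂ ⊆ used ++ c̃₁ ++ c̃₂
      c̃₂-used = ∈-++⁺ʳ used ∘ ∈-++⁺ʳ c̃₁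
      supp₁-used : A.supp Ψ₁ ⊆ used ++ c̃₁ ++ c̃₂
      supp₁-used = ∈-++⁺ˡ ∘ from₁ ∘ ∈-++⁺ʳ b̃₁
      supp₂-used : A.supp Ψ₂ ⊆ used ++ c̃₁ ++ c̃₂
      supp₂-used = ∈-++⁺ˡ ∘ from₂ ∘ ∈-++⁺ʳ b̃₂
      dis′ : ∀ {k C x d̃} {E : Set} → C ⊆ used ++ c̃₁ ++ c̃₂ → x ∈ d̃ → x ∈ C →
             Fresh k (used ++ c̃₁ ++ c̃₂) d̃ → E
      dis′ s x∈ y∈ f = ⊥-elim (Fresh.avoids f (x∈ , s y∈))
      x∉c̃₁ : ∀ {x} → x ∈ A.supp Ψ₁ → x ∉ c̃₁
      x∉c̃₁ x∈ z = avoids-used w₁ z x∈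
      x∉c̃₂ : ∀ {x} → x ∈ A.supp Ψ₂ → x ∉ c̃₂
      x∉c̃₂ x∈ z = avoids-used w₂ z x∈
      untouched : ∀ {e b̃ c̃ d̃ x A} → FreshVariant e b̃ A → x ∉ e →
        (∀ {y} → y ∈ e → y ∉ d̃ × y ∉ c̃) → x ∉ d̃ × x ∉ c̃ → zip d̃ c̃ · zip e b̃ · x ≡ zip e b̃ · x
      untouched v x∉ inside (o₁ , o₂) with rename-image v x∉
      ... | inj₁ y∈ = let i₁ , i₂ = inside y∈ in rename-∉ i₁ i₂
      ... | inj₂ eq rewrite eq = rename-∉ o₁ o₂
      collapse : ∀ c̃ b̃ d̃ Ψ → (∀ {x} → x ∈ A.supp Ψ → zip d̃₁ c̃₁ · zip d̃₂ c̃₂ · zip c̃ b̃ · x ≡ zip d̃ b̃ · x) →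
        Aₙ.act ρ (Aₙ.act (zip c̃ b̃) Ψ) A.≈ Aₙ.act (zip d̃ b̃) Ψ
      collapse c̃ b̃ d̃ Ψ eq = A.trans (A.reflexive (sym (Aₙ.act-++ ρ (zip c̃ b̃) Ψ)))
        (Aₙ.act-agree (ρ ++ zip c̃ b̃) (zip d̃ b̃) λ {x} x∈ → trans (·-++ ρ (zip c̃ b̃) x)
          (trans (cong (_· zip c̃ b̃ · x) 
                         (zip-++ {d̃₁} {c̃₁} (trans (Fresh.size f₁) (sym (length-freshes (length b̃₁) used))) d̃₂ c̃₂))
          (trans (·-++ (zip d̃₁ c̃₁) (zip d̃₂ c̃₂) (zip c̃ b̃ · x)) (eq x∈))))

  actᶠ : Perm → Frame → Frame
  actᶠ π (⟨ν b̃ ⟩ Ψ) = ⟨ν map (π ·_) b̃ ⟩ Aₙ.act π Ψ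

  -- F′ is π · F, up to the choice of binders.
  infix 4 _≋_▷_
  record _≋_▷_ (F′ : Frame) (π : Perm) (F : Frame) : Set ℓ where
    constructor mk≋▷
    field
      sameSize  : size F′ ≡ size F
      instances : Eventually (size F) (λ d̃ → inst F′ d̃ A.≈ Aₙ.act π (inst F d̃))

  map-fresh : ∀ π d̃ → d̃ # names π → map (π ·_) d̃ ≡ d̃
  map-fresh π []      f = refl
  map-fresh π (d ∷ d̃) f = cong₂ _∷_ (·-fresh π (λ p → f (here refl , p)))
    (map-fresh π d̃ (λ (x , y) → f (there x , y)))

  actᶠ-▷ : ∀ π F → actᶠ π F ≋ π ▷ F
  actᶠ-▷ π (⟨ν b̃ ⟩ Ψ) = mk≋▷ (length-map (π ·_) b̃) (names π , λ {d̃} v → proof d̃ (Fresh.avoids v))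
    where
    proof : ∀ d̃ → d̃ # names π →
            swaps A.swap d̃ (map (π ·_) b̃) (Aₙ.act π Ψ) A.≈ Aₙ.act π (swaps A.swap d̃ b̃ Ψ)
    proof d̃ d̃# rewrite Aₙ.swaps≡act d̃ (map (π ·_) b̃) (Aₙ.act π Ψ) | Aₙ.swaps≡act d̃ b̃ Ψ =
      A.trans (A.reflexive (sym (Aₙ.act-++ σ π Ψ)))
      (A.trans (Aₙ.act-agree (σ ++ π) (π ++ zip d̃ b̃) λ {x} _ → trans (·-++ σ π x)
                 (trans (cong (λ c̃ → zip c̃ (map (π ·_) b̃) · π · x) (sym (map-fresh π d̃ d̃#)))
                 (trans (sym (zip-map (π ·_) (·-injective π) d̃ b̃ x)) (sym (·-++ π (zip d̃ b̃) x)))))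
      (A.reflexive (Aₙ.act-++ π (zip d̃ b̃) Ψ)))
      where
      σ : Perm
      σ = zip d̃ (map (π ·_) b̃)

  assertionFrame-▷ : ∀ {π Ψ Ψ′} → Ψ′ A.≈ Aₙ.act π Ψ → assertionFrame Ψ′ ≋ π ▷ assertionFrame Ψ
  assertionFrame-▷ e = mk≋▷ refl (everywhere λ { [] _ → e ; (_ ∷ _) () })

  ⊗ᶠ-▷ : ∀ {π F F′ G G′} → F′ ≋ π ▷ F → G′ ≋ π ▷ G → F′ ⊗ᶠ G′ ≋ π ▷ F ⊗ᶠ G
  ⊗ᶠ-▷ {π} {F} {F′} {G} {G′} (mk≋▷ e (A , i)) (mk≋▷ e′ (A′ , i′)) with inst-⊗ F G | inst-⊗ F′ G′
  ... | B , j | B′ , j′ = mk≋▷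
    (trans (size-⊗ F′ G′) (trans (cong₂ ℕ._+_ e e′) (sym (size-⊗ F G))))
    (subst (λ k → Eventually k (λ d̃ → inst (F′ ⊗ᶠ G′) d̃ A.≈ Aₙ.act π (inst (F ⊗ᶠ G) d̃)))
      (sym (size-⊗ F G)) ((A ++ A′) ++ B ++ B′ , proof))
    where
    proof : ∀ {d̃} → Fresh (size F ℕ.+ size G) ((A ++ A′) ++ B ++ B′) d̃ →
            inst (F′ ⊗ᶠ G′) d̃ A.≈ Aₙ.act π (inst (F ⊗ᶠ G) d̃)
    proof v with split (size F) v
    ... | d̃₁ , d̃₂ , refl , v₁ , v₂ , dis =
      A.trans (j′ (subst (λ k → Fresh k B′ d̃₁) (sym e) (weaken (∈-++⁺ʳ (A ++ A′) ∘ ∈-++⁺ʳ B) v₁))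
                  (subst (λ k → Fresh k B′ d̃₂) (sym e′) (weaken (∈-++⁺ʳ (A ++ A′) ∘ ∈-++⁺ʳ B) v₂)) dis)
      (A.trans (⊗-cong (i (weaken (∈-++⁺ˡ ∘ ∈-++⁺ˡ) v₁)) (i′ (weaken (∈-++⁺ˡ ∘ ∈-++⁺ʳ A) v₂)))
      (A.trans (A.sym (act-⊗ π))
      (Aₙ.act-cong π (A.sym (j (weaken (∈-++⁺ʳ (A ++ A′) ∘ ∈-++⁺ˡ) v₁) (weaken (∈-++⁺ʳ (A ++ A′) ∘ ∈-++⁺ˡ) v₂) dis)))))

  size-ν : ∀ b F → size (νᶠ b F) ≡ suc (size F)
  size-ν b (⟨ν b̃ ⟩ Ψ) = refl

  inst-ν : ∀ b F d d̃ → inst (νᶠ b F) (d ∷ d̃) ≡ A.swap d b (inst F d̃)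
  inst-ν b (⟨ν b̃ ⟩ Ψ) d d̃ = refl

  νᶠ-▷ : ∀ {π F F′} b → F′ ≋ π ▷ F → νᶠ (π · b) F′ ≋ π ▷ νᶠ b F
  νᶠ-▷ {π} {F} {F′} b (mk≋▷ e (A , i)) = mk≋▷
    (trans (size-ν (π · b) F′) (trans (cong suc e) (sym (size-ν b F))))
    (subst (λ k → Eventually k (λ d̃ → inst (νᶠ (π · b) F′) d̃ A.≈ Aₙ.act π (inst (νᶠ b F) d̃)))
      (sym (size-ν b F)) (A ++ names π , λ {d̃} → proof d̃))
    where
    proof : ∀ d̃ → Fresh (suc (size F)) (A ++ names π) d̃ →
            inst (νᶠ (π · b) F′) d̃ A.≈ Aₙ.act π (inst (νᶠ b F) d̃)
    proof (d ∷ d̃) (mkFresh (_ ∷ u) f a) rewrite inst-ν (π · b) F′ d d̃ | inst-ν b F d d̃ =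
      A.trans (A.swap-cong (i (mkFresh u (ℕ.suc-injective f) (λ (x , y) → a (there x , ∈-++⁺ˡ y)))))
      -- `d` is chosen outside the names of `π`, hence `π` fixes it.
      (A.trans (A.reflexive (cong (λ c → A.swap c (π · b) (Aₙ.act π (inst F d̃)))
                                  (sym (·-fresh π (λ y → a (here refl , ∈-++⁺ʳ A y))))))
      (A.sym (Aₙ.act-swap π d b (inst F d̃))))

  -- An equation would fail at `P ∣ Q`, where `⊗ᶠ` picks binders through the enumeration of names,
  -- which permutations do not respect.
  𝓕-▷ : ∀ π P → 𝓕 (Pₙ.act π P) ≋ π ▷ 𝓕 P
  𝓕-▷ π 𝟎 rewrite act-𝟎 π = assertionFrame-▷ {π} (A.sym (act-𝟏 π))
  𝓕-▷ π (output M N P) rewrite act-output π {M} {N} {P} = assertionFrame-▷ {π} (A.sym (act-𝟏 π))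
  𝓕-▷ π (input M x̃ N P) rewrite act-input π {M} {x̃} {N} {P} = assertionFrame-▷ {π} (A.sym (act-𝟏 π))
  𝓕-▷ π (case B) rewrite act-case π {B} = assertionFrame-▷ {π} (A.sym (act-𝟏 π))
  𝓕-▷ π (ν b P) rewrite act-ν π {b} {P} = νᶠ-▷ b (𝓕-▷ π P)
  𝓕-▷ π (P ∣ Q) rewrite act-∣ π {P} {Q} = ⊗ᶠ-▷ (𝓕-▷ π P) (𝓕-▷ π Q)
  𝓕-▷ π (! P) rewrite act-! π {P} = assertionFrame-▷ {π} (A.sym (act-𝟏 π))
  𝓕-▷ π ⦅ Ψ ⦆ rewrite act-⦅⦆ π {Ψ} = assertionFrame-▷ {π} A.refl

  𝓕-act : ∀ π P {F} → 𝓕 P ≡ᶠ F → 𝓕 (Pₙ.act π P) ≡ᶠ actᶠ π F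
  𝓕-act π P {F} e with 𝓕-▷ π P | ≡ᶠ⇒≋ e | actᶠ-▷ π F
  ... | mk≋▷ s i | mk≋ s′ i′ | mk≋▷ s″ i″ = ≋⇒≡ᶠ (mk≋ (trans s (trans s′ (sym s″)))
    (subst (λ k → Eventually k (λ d̃ → inst (𝓕 (Pₙ.act π P)) d̃ A.≈ inst (actᶠ π F) d̃)) (sym s)
      (eventually₂ A.trans i (eventually₂ (λ x y → A.trans (Aₙ.act-cong π x) (A.sym y)) i′
        (subst (λ k → Eventually k (λ d̃ → inst (actᶠ π F) d̃ A.≈ Aₙ.act π (inst F d̃))) (sym s′) i″)))))

  ▷-⊢ᶠ : ∀ {π F F′} → F′ ≋ π ▷ F → ∀ φ → F ⊢ᶠ φ ⇔ F′ ⊢ᶠ Cₙ.act π φ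
  ▷-⊢ᶠ {π} {F} {F′} (mk≋▷ s i) φ = mk⇔
    (λ p → ⇒⊢ᶠ {F′} (subst (λ k → Eventually k (λ d̃ → inst F′ d̃ ⊢ Cₙ.act π φ)) (sym s)
      (eventually₂ (λ e q → ⊢-resp (A.sym e) C.refl (act-⊢ π q)) i (⊢ᶠ⇒ p))))
    (λ p → ⇒⊢ᶠ {F} (eventually₂ (λ e q → ⊢-reflects π (⊢-resp e C.refl q)) i
      (subst (λ k → Eventually k (λ d̃ → inst F′ d̃ ⊢ Cₙ.act π φ)) s (⊢ᶠ⇒ {F′} p))))

  ≃-instances : ∀ F G → size F ≡ size G → Eventually (size F) (λ d̃ → inst F d̃ ≃ inst G d̃) → F ≃ᶠ G
  ≃-instances F G s i φ = mk⇔
    (λ p → ⇒⊢ᶠ {G} (subst (λ k → Eventually k (λ d̃ → inst G d̃ ⊢ φ)) s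
      (eventually₂ (λ e → Equivalence.to (e φ)) i (⊢ᶠ⇒ p))))
    (λ p → ⇒⊢ᶠ {F} (eventually₂ (λ e → Equivalence.from (e φ)) i
      (subst (λ k → Eventually k (λ d̃ → inst G d̃ ⊢ φ)) (sym s) (⊢ᶠ⇒ {G} p))))

  size-assertion⊗ : ∀ Ψ F → size (assertionFrame Ψ ⊗ᶠ F) ≡ size F
  size-assertion⊗ Ψ F = size-⊗ (assertionFrame Ψ) F

  inst-assertion⊗ : ∀ Ψ F → Eventually (size F) (λ d̃ → inst (assertionFrame Ψ ⊗ᶠ F) d̃ A.≈ (Ψ ⊗ inst F d̃))
  inst-assertion⊗ Ψ F with inst-⊗ (assertionFrame Ψ) F
  ... | B , j = B , λ v → j (mkFresh [] refl (λ ())) v (λ ())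

  ctx : List Assertion → Preagent → Preagent
  ctx []       P = P
  ctx (Ψ ∷ Ψs) P = ⦅ Ψ ⦆ ∣ ctx Ψs P

  ∏ : List Assertion → Assertion
  ∏ []       = 𝟏
  ∏ (Ψ ∷ Ψs) = Ψ ⊗ ∏ Ψs

  size-ctx : ∀ Ψs P → size (𝓕 (ctx Ψs P)) ≡ size (𝓕 P)
  size-ctx []       P = refl
  size-ctx (Ψ ∷ Ψs) P = trans (size-assertion⊗ Ψ (𝓕 (ctx Ψs P))) (size-ctx Ψs P)

  inst-ctx : ∀ Ψs P → Eventually (size (𝓕 P)) (λ d̃ → inst (𝓕 (ctx Ψs P)) d̃ ≃ ∏ Ψs ⊗ inst (𝓕 P) d̃)
  inst-ctx []       P = everywhere λ d̃ _ → ≃-sym ⊗-identityˡ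
  inst-ctx (Ψ ∷ Ψs) P = eventually₂
    (λ e f → ≃-trans (≈⇒≃ e) (≃-trans (⊗-≃ ≃-refl f) (≃-sym ⊗-associative)))
    (subst (λ k → Eventually k (λ d̃ → inst (𝓕 (ctx (Ψ ∷ Ψs) P)) d̃ A.≈ (Ψ ⊗ inst (𝓕 (ctx Ψs P)) d̃)))
      (size-ctx Ψs P) (inst-assertion⊗ Ψ (𝓕 (ctx Ψs P))))
    (inst-ctx Ψs P)

  -- Assertion frames bind nothing, so a context multiplies every instance of `𝓕 P` by its
  -- assertions. Clause (1) of a context bisimulation, read inside a context, thereby becomes clause
  -- (1) of a bisimulation.
  ctx-static : ∀ {Ψ} Ψs P → Ψ ≃ ∏ Ψs → 𝓕 (ctx Ψs P) ≃ᶠ assertionFrame Ψ ⊗ᶠ 𝓕 P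
  ctx-static {Ψ} Ψs P e = ≃-instances (𝓕 (ctx Ψs P)) (assertionFrame Ψ ⊗ᶠ 𝓕 P)
    (trans (size-ctx Ψs P) (sym (size-assertion⊗ Ψ (𝓕 P))))
    (subst (λ k → Eventually k (λ d̃ → inst (𝓕 (ctx Ψs P)) d̃ ≃ inst (assertionFrame Ψ ⊗ᶠ 𝓕 P) d̃)) (sym (size-ctx Ψs P))
      (eventually₂ (λ f g → ≃-trans f (≃-trans (⊗-≃ (≃-sym e) ≃-refl) (≃-sym (≈⇒≃ g))))
        (inst-ctx Ψs P) (inst-assertion⊗ Ψ (𝓕 P))))

-- Well-formedness and substitution under renaming

module AgentProperties {𝓝 : Names} {ℓ : Level} (𝒫 : PsiCalculus 𝓝 ℓ) where
  open Names 𝓝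
  open NameProperties 𝓝
  open Equivariance 𝓝
  open PsiCalculus 𝒫
  open Psi 𝒫 renaming (cong to cong-≈; sym to symα; trans to transα)
  open PreagentProperties 𝒫

  private
    module Tₛ = Substitution substᵀ
    module Cₛ = Substitution substᶜ
    module Aₛ = Substitution substᴬ

  mutual
    guarded-swap : ∀ {a b P} → Guarded P → Guarded (swap a b P)
    guarded-swap 𝟎        = 𝟎
    guarded-swap output   = output
    guarded-swap input    = input
    guarded-swap (case g) = case (guarded-swapBranches g)
    guarded-swap (ν g)    = ν (guarded-swap g)
    guarded-swap (g ∣ h)  = guarded-swap g ∣ guarded-swap h
    guarded-swap (! g)    = ! guarded-swap g

    guarded-swapBranches : ∀ {a b B} → All (λ φP → Guarded (proj₂ φP)) B →
                           All (λ φP → Guarded (proj₂ φP)) (swapBranches a b B)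
    guarded-swapBranches []      = []
    guarded-swapBranches (g ∷ G) = guarded-swap g ∷ guarded-swapBranches G

  mutual
    guarded-swap⁻ : ∀ {a b} P → Guarded (swap a b P) → Guarded P
    guarded-swap⁻ 𝟎               𝟎        = 𝟎
    guarded-swap⁻ (output M N P)  output   = output
    guarded-swap⁻ (input M x̃ N P) input    = input
    guarded-swap⁻ (case B)        (case g) = case (guarded-swapBranches⁻ B g)
    guarded-swap⁻ (ν a P)         (ν g)    = ν (guarded-swap⁻ P g)
    guarded-swap⁻ (P ∣ Q)         (g ∣ h)  = guarded-swap⁻ P g ∣ guarded-swap⁻ Q h
    guarded-swap⁻ (! P)           (! g)    = ! guarded-swap⁻ P g

    guarded-swapBranches⁻ : ∀ {a b} B → All (λ φP → Guarded (proj₂ φP)) (swapBranches a b B) →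
                            All (λ φP → Guarded (proj₂ φP)) B
    guarded-swapBranches⁻ []            []      = []
    guarded-swapBranches⁻ ((φ , P) ∷ B) (g ∷ G) = guarded-swap⁻ P g ∷ guarded-swapBranches⁻ B G

  mutual
    guarded-≡α : ∀ {P Q} → P ≡α Q → (Guarded P → Guarded Q) × (Guarded Q → Guarded P)
    guarded-≡α refl              = id , id
    guarded-≡α (symα e)          = let f , g = guarded-≡α e in g , f
    guarded-≡α (transα e e′)     = let f , g = guarded-≡α e ; f′ , g′ = guarded-≡α e′ in f′ ∘ f , g ∘ g′
    guarded-≡α (alpha-input v)   = (λ { input → input }) , (λ { input → input })
    guarded-≡α (alpha-ν {P = P} _) = (λ { (ν g) → ν (guarded-swap g) }) , (λ { (ν g) → ν (guarded-swap⁻ P g) })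
    guarded-≡α (output _ _ _)    = (λ { output → output }) , (λ { output → output })
    guarded-≡α (input _ _ _)     = (λ { input → input }) , (λ { input → input })
    guarded-≡α (case e)          = let f , g = guarded-≡αBranches e in
      (λ { (case h) → case (f h) }) , (λ { (case h) → case (g h) })
    guarded-≡α (ν e)             = let f , g = guarded-≡α e in (λ { (ν h) → ν (f h) }) , (λ { (ν h) → ν (g h) })
    guarded-≡α (e ∣ e′)          = let f , g = guarded-≡α e ; f′ , g′ = guarded-≡α e′ in
      (λ { (h ∣ k) → f h ∣ f′ k }) , (λ { (h ∣ k) → g h ∣ g′ k })
    guarded-≡α (! e)             = let f , g = guarded-≡α e in (λ { (! h) → ! f h }) , (λ { (! h) → ! g h })
    guarded-≡α ⦅ e ⦆             = (λ ()) , (λ ())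

    guarded-≡αBranches : ∀ {B B′} → Pointwise (Product.Pointwise C._≈_ _≡α_) B B′ →
      (All (λ φP → Guarded (proj₂ φP)) B → All (λ φP → Guarded (proj₂ φP)) B′) ×
      (All (λ φP → Guarded (proj₂ φP)) B′ → All (λ φP → Guarded (proj₂ φP)) B)
    guarded-≡αBranches []            = id , id
    guarded-≡αBranches ((_ , e) ∷ E) = let f , g = guarded-≡α e ; f′ , g′ = guarded-≡αBranches E in
      (λ { (h ∷ H) → f h ∷ f′ H }) , (λ { (h ∷ H) → g h ∷ g′ H })

  WellFormedBranches : List (Condition × Preagent) → Set ℓ
  WellFormedBranches = All (λ φP → WellFormed (proj₂ φP) × Guarded (proj₂ φP))

  mutual
    wf-swap : ∀ {a b P} → WellFormed P → WellFormed (swap a b P)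
    wf-swap 𝟎 = 𝟎
    wf-swap (output w) = output (wf-swap w)
    wf-swap {a} {b} (input u s w) = input (Unique.map⁺ (swapName-injective a b) u)
      (λ p → let x , x∈ , e = ∈-map⁻ (swapName a b) p in subst (_∈ _) (sym e) (Tₙ.supp-swap a b (s x∈))) (wf-swap w)
    wf-swap (case W) = case (wf-swapBranches W)
    wf-swap (ν w) = ν (wf-swap w)
    wf-swap (w ∣ w′) = wf-swap w ∣ wf-swap w′
    wf-swap ((! w) g) = (! wf-swap w) (guarded-swap g)
    wf-swap ⦅ Ψ ⦆ = ⦅ _ ⦆

    wf-swapBranches : ∀ {a b B} → WellFormedBranches B → WellFormedBranches (swapBranches a b B)
    wf-swapBranches []            = []
    wf-swapBranches ((w , g) ∷ W) = (wf-swap w , guarded-swap g) ∷ wf-swapBranches W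

  mutual
    wf-swap⁻ : ∀ {a b} P → WellFormed (swap a b P) → WellFormed P
    wf-swap⁻ 𝟎 𝟎 = 𝟎
    wf-swap⁻ (output M N P) (output w) = output (wf-swap⁻ P w)
    wf-swap⁻ {a} {b} (input M x̃ N P) (input u s w) = input (Unique.map⁻ u)
      (λ p → Tₙ.supp-act⁻ ((a , b) ∷ []) (s (∈-map⁺ (swapName a b) p))) (wf-swap⁻ P w)
    wf-swap⁻ (case B) (case W) = case (wf-swapBranches⁻ B W)
    wf-swap⁻ (ν a P) (ν w) = ν (wf-swap⁻ P w)
    wf-swap⁻ (P ∣ Q) (w ∣ w′) = wf-swap⁻ P w ∣ wf-swap⁻ Q w′
    wf-swap⁻ (! P) ((! w) g) = (! wf-swap⁻ P w) (guarded-swap⁻ P g)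
    wf-swap⁻ ⦅ Ψ ⦆ ⦅ _ ⦆ = ⦅ Ψ ⦆

    wf-swapBranches⁻ : ∀ {a b} B → WellFormedBranches (swapBranches a b B) → WellFormedBranches B
    wf-swapBranches⁻ []            []            = []
    wf-swapBranches⁻ ((φ , P) ∷ B) ((w , g) ∷ W) = (wf-swap⁻ P w , guarded-swap⁻ P g) ∷ wf-swapBranches⁻ B W

  wf-swaps : ∀ c̃ b̃ {P} → WellFormed P → WellFormed (swaps swap c̃ b̃ P)
  wf-swaps []      b̃       w = w
  wf-swaps (c ∷ c̃) []      w = w
  wf-swaps (c ∷ c̃) (b ∷ b̃) w = wf-swap (wf-swaps c̃ b̃ w)

  wf-swaps⁻ : ∀ c̃ b̃ {P} → WellFormed (swaps swap c̃ b̃ P) → WellFormed P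
  wf-swaps⁻ []      b̃       w = w
  wf-swaps⁻ (c ∷ c̃) []      w = w
  wf-swaps⁻ (c ∷ c̃) (b ∷ b̃) w = wf-swaps⁻ c̃ b̃ (wf-swap⁻ _ w)

  wf-act : ∀ π {P} → WellFormed P → WellFormed (Pₙ.act π P)
  wf-act []      w = w
  wf-act (_ ∷ π) w = wf-swap (wf-act π w)

  binders-rename : ∀ {c̃ b̃ A N} → FreshVariant c̃ b̃ A → T.supp N ⊆ A → Unique b̃ → b̃ ⊆ T.supp N →
                   c̃ ⊆ T.supp (swaps T.swap c̃ b̃ N)
  binders-rename {c̃} {b̃} {A} {N} v s u b̃⊆ c∈ with rename-onto u v c∈
  ... | x , x∈ , refl = to (swaps-equiᵀ c̃ b̃ N) (b̃⊆ x∈)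

  -- Alpha-conversion may start from any sequence, also one with repetitions or with names not in
  -- `N`, so both properties have to be recovered from the variant. The preimage of each name of
  -- `c̃` lies in `N`, hence outside `c̃`, and `rename-unique` applies.
  binders-rename⁻ : ∀ {c̃ b̃ A N} → FreshVariant c̃ b̃ A → T.supp N ⊆ A →
                    c̃ ⊆ T.supp (swaps T.swap c̃ b̃ N) → Unique b̃ × b̃ ⊆ T.supp N
  binders-rename⁻ {c̃} {b̃} {A} {N} v s c̃⊆ =
    rename-unique v (λ {c} c∈ → let x∈ = preimage c (c̃⊆ c∈) in
      inverse σ · c , (λ q → avoids-used v q (s x∈)) , inverse-· σ c) ,
    λ {b} b∈ → from (swaps-equiᵀ c̃ b̃ N) (c̃⊆ (rename-∈ v (λ q → avoids-old v q b∈) b∈))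
    where
    σ : Perm
    σ = zip c̃ b̃
    preimage : ∀ c → c ∈ T.supp (swaps T.swap c̃ b̃ N) → inverse σ · c ∈ T.supp N
    preimage c p = from (swaps-equiᵀ c̃ b̃ N) (subst (_∈ _) (sym (inverse-· σ c)) p)

  mutual
    wf-≡α : ∀ {P Q} → P ≡α Q → (WellFormed P → WellFormed Q) × (WellFormed Q → WellFormed P)
    wf-≡α refl              = id , id
    wf-≡α (symα e)          = let f , g = wf-≡α e in g , f
    wf-≡α (transα e e′)     = let f , g = wf-≡α e ; f′ , g′ = wf-≡α e′ in f′ ∘ f , g ∘ g′
    wf-≡α (alpha-input {x̃ = x̃} {z̃} {N} v) =
      (λ { (input u s w) → input (FreshVariant.distinct v) (binders-rename {N = N} v ∈-++⁺ˡ u s) (wf-swaps z̃ x̃ w) }) ,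
      (λ { (input u s w) → let u′ , s′ = binders-rename⁻ {N = N} v ∈-++⁺ˡ s in input u′ s′ (wf-swaps⁻ z̃ x̃ w) })
    wf-≡α (alpha-ν {P = P} _) = (λ { (ν w) → ν (wf-swap w) }) , (λ { (ν w) → ν (wf-swap⁻ P w) })
    wf-≡α (output _ _ e)    = let f , g = wf-≡α e in (λ { (output w) → output (f w) }) , (λ { (output w) → output (g w) })
    wf-≡α (input _ e′ e)    = let f , g = wf-≡α e in
      (λ { (input u s w) → input u (Tₙ.supp-cong e′ ∘ s) (f w) }) ,
      (λ { (input u s w) → input u (Tₙ.supp-cong (T.sym e′) ∘ s) (g w) })
    wf-≡α (case e)          = let f , g = wf-≡αBranches e in (λ { (case h) → case (f h) }) , (λ { (case h) → case (g h) })
    wf-≡α (ν e)             = let f , g = wf-≡α e in (λ { (ν h) → ν (f h) }) , (λ { (ν h) → ν (g h) })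
    wf-≡α (e ∣ e′)          = let f , g = wf-≡α e ; f′ , g′ = wf-≡α e′ in
      (λ { (h ∣ k) → f h ∣ f′ k }) , (λ { (h ∣ k) → g h ∣ g′ k })
    wf-≡α (! e)             = let f , g = wf-≡α e ; f′ , g′ = guarded-≡α e in
      (λ { ((! h) k) → (! f h) (f′ k) }) , (λ { ((! h) k) → (! g h) (g′ k) })
    wf-≡α ⦅ e ⦆             = (λ _ → ⦅ _ ⦆) , (λ _ → ⦅ _ ⦆)

    wf-≡αBranches : ∀ {B B′} → Pointwise (Product.Pointwise C._≈_ _≡α_) B B′ →
      (WellFormedBranches B → WellFormedBranches B′) × (WellFormedBranches B′ → WellFormedBranches B)
    wf-≡αBranches []            = id , id
    wf-≡αBranches ((_ , e) ∷ E) = let f , g = wf-≡α e ; i , j = guarded-≡α e ; f′ , g′ = wf-≡αBranches E in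
      (λ { ((h , k) ∷ H) → (f h , i k) ∷ f′ H }) , (λ { ((h , k) ∷ H) → (g h , j k) ∷ g′ H })

  private
    combine₂ : ∀ {A A′ B B′ ỹ L : List Name} {x} → (x ∈ A′ → (x ∈ A × x ∉ ỹ) ⊎ x ∈ L) →
               (x ∈ B′ → (x ∈ B × x ∉ ỹ) ⊎ x ∈ L) → x ∈ A′ ++ B′ → (x ∈ A ++ B × x ∉ ỹ) ⊎ x ∈ L
    combine₂ {A} {A′} f g x∈ with ∈-++⁻ A′ x∈
    ... | inj₁ p = [ (λ (i , j) → inj₁ (∈-++⁺ˡ i , j)) , inj₂ ]′ (f p)
    ... | inj₂ p = [ (λ (i , j) → inj₁ (∈-++⁺ʳ A i , j)) , inj₂ ]′ (g p)

  mutual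
    n-[]≔ : ∀ {P P′ ỹ L̃ x} → Unique ỹ → length ỹ ≡ length L̃ → P [ ỹ := L̃ ]≔ P′ → x ∈ n P′ →
            (x ∈ n P × x ∉ ỹ) ⊎ x ∈ concatMap T.supp L̃
    n-[]≔ u l (output {M = M} {N} {P} s) x∈ = combine₂ (SubstitutionProperties.supp-[] substᵀ u l)
      (combine₂ (SubstitutionProperties.supp-[] substᵀ u l) (n-[]≔ u l s)) x∈
    n-[]≔ u l (input {M = M} {x̃} {N} {P} x̃# s) x∈ = combine₂ (SubstitutionProperties.supp-[] substᵀ u l)
      (λ p → let q , r = ∈-∖⁻ p in
        [ (λ (i , j) → inj₁ (∈-∖⁺ i r , j)) , inj₂ ]′
          (combine₂ (SubstitutionProperties.supp-[] substᵀ u l) (n-[]≔ u l s) q)) x∈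
    n-[]≔ u l (case s) x∈ = n-[]≔Branches u l s x∈
    n-[]≔ u l (ν a∉ s) x∈ = let q , r = ∈-∖⁻ x∈ in
      [ (λ (i , j) → inj₁ (∈-∖⁺ i r , j)) , inj₂ ]′ (n-[]≔ u l s q)
    n-[]≔ u l (s ∣ s′) x∈ = combine₂ (n-[]≔ u l s) (n-[]≔ u l s′) x∈
    n-[]≔ u l (! s) x∈ = n-[]≔ u l s x∈
    n-[]≔ u l ⦅ Ψ ⦆ x∈ = SubstitutionProperties.supp-[] substᴬ u l x∈

    n-[]≔Branches : ∀ {B B′ ỹ L̃ x} → Unique ỹ → length ỹ ≡ length L̃ →
      Pointwise (Product.Pointwise (λ φ φ′ → φ Cₛ.[ ỹ := L̃ ] ≡ φ′) (λ P P′ → P [ ỹ := L̃ ]≔ P′)) B B′ →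
      x ∈ nBranches B′ → (x ∈ nBranches B × x ∉ ỹ) ⊎ x ∈ concatMap T.supp L̃
    n-[]≔Branches u l ((refl , s) ∷ S) x∈ = combine₂ (SubstitutionProperties.supp-[] substᶜ u l)
      (combine₂ (n-[]≔ u l s) (n-[]≔Branches u l S)) x∈

  concatMap-equi : ∀ a b L̃ → Equi (swapName a b) (concatMap T.supp L̃) (concatMap T.supp (map (T.swap a b) L̃))
  concatMap-equi a b []      = equi-[]
  concatMap-equi a b (M ∷ L̃) = equi-++ (supp-equiᵀ ((a , b) ∷ [])) (concatMap-equi a b L̃)

  equi-# : ∀ {f A A′ B} → Equi f A A′ → B # A → map f B # A′
  equi-# {f} e d (p , q) with ∈-map⁻ f p
  ... | x , x∈ , refl = d (x∈ , from e q)

  mutual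
    -- The result is found only up to alpha-equivalence: the graph fixes its terms up to `≡`, but
    -- substitution is equivariant only up to `≈`.
    swap-[]≔ : ∀ a b {P P′ ỹ L̃} → Unique ỹ → length ỹ ≡ length L̃ → P [ ỹ := L̃ ]≔ P′ →
      ∃ λ P″ → swap a b P [ map (swapName a b) ỹ := map (T.swap a b) L̃ ]≔ P″ × P″ ≡α swap a b P′
    swap-[]≔ a b u l 𝟎 = 𝟎 , 𝟎 , refl
    swap-[]≔ a b u l (output s) with swap-[]≔ a b u l s
    ... | P″ , s′ , e = _ , output s′ , symα (output (Tₛ.subst-equivariant u l) (Tₛ.subst-equivariant u l) (symα e))
    swap-[]≔ a b {ỹ = ỹ} {L̃} u l (input {x̃ = x̃} x̃# s) with swap-[]≔ a b u l s
    ... | P″ , s′ , e = _ ,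
      input (equi-# (equi-++ (equi-map (swapName-injective a b)) (concatMap-equi a b L̃)) x̃#) s′ ,
      symα (input (Tₛ.subst-equivariant u l) (Tₛ.subst-equivariant u l) (symα e))
    swap-[]≔ a b u l (case s) with swap-[]≔Branches a b u l s
    ... | B″ , s′ , e = case B″ , case s′ , case e
    swap-[]≔ a b {ỹ = ỹ} {L̃} u l (ν {a = c} c∉ s) with swap-[]≔ a b u l s
    ... | P″ , s′ , e = ν (swapName a b c) P″ ,
      ν (c∉ ∘ from (equi-++ (equi-map (swapName-injective a b)) (concatMap-equi a b L̃))) s′ , ν e
    swap-[]≔ a b u l (s ∣ t) with swap-[]≔ a b u l s | swap-[]≔ a b u l t
    ... | P″ , s′ , e | Q″ , t′ , f = (P″ ∣ Q″) , (s′ ∣ t′) , (e ∣ f)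
    swap-[]≔ a b u l (! s) with swap-[]≔ a b u l s
    ... | P″ , s′ , e = (! P″) , (! s′) , (! e)
    swap-[]≔ a b u l ⦅ Ψ ⦆ = _ , ⦅ A.swap a b Ψ ⦆ , ⦅ A.sym (Aₛ.subst-equivariant u l) ⦆

    swap-[]≔Branches : ∀ a b {B B′ ỹ L̃} → Unique ỹ → length ỹ ≡ length L̃ →
      Pointwise (Product.Pointwise (λ φ φ′ → φ Cₛ.[ ỹ := L̃ ] ≡ φ′) (λ P P′ → P [ ỹ := L̃ ]≔ P′)) B B′ →
      ∃ λ B″ → Pointwise (Product.Pointwise (λ φ φ′ → φ Cₛ.[ map (swapName a b) ỹ := map (T.swap a b) L̃ ] ≡ φ′)
                          (λ P P′ → P [ map (swapName a b) ỹ := map (T.swap a b) L̃ ]≔ P′)) (swapBranches a b B) B″ ×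
               Pointwise (Product.Pointwise C._≈_ _≡α_) B″ (swapBranches a b B′)
    swap-[]≔Branches a b u l [] = [] , [] , []
    swap-[]≔Branches a b u l ((refl , s) ∷ S) with swap-[]≔ a b u l s | swap-[]≔Branches a b u l S
    ... | P″ , s′ , e | B″ , S′ , E = _ , (refl , s′) ∷ S′ , (C.sym (Cₛ.subst-equivariant u l) , e) ∷ E

  act-[]≔ : ∀ π {P P′ ỹ L̃} → Unique ỹ → length ỹ ≡ length L̃ → P [ ỹ := L̃ ]≔ P′ →
    ∃ λ P″ → Pₙ.act π P [ map (π ·_) ỹ := map (Tₙ.act π) L̃ ]≔ P″ × P″ ≡α Pₙ.act π P′
  act-[]≔ [] {P′ = P′} {ỹ} {L̃} u l s rewrite map-id ỹ | map-id L̃ = P′ , s , refl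
  act-[]≔ ((a , b) ∷ π) {ỹ = ỹ} {L̃} u l s
    rewrite map-∘ {g = swapName a b} {f = π ·_} ỹ | map-∘ {g = T.swap a b} {f = Tₙ.act π} L̃
    with act-[]≔ π u l s
  ... | P₁ , s₁ , e₁ with swap-[]≔ a b (Unique.map⁺ (·-injective π) u)
                            (trans (length-map _ ỹ) (trans l (sym (length-map _ L̃)))) s₁
  ...   | P₂ , s₂ , e₂ = P₂ , s₂ , transα e₂ (swap-≡α a b e₁)

-- Labels and the free names of residuals

module TransitionProperties {𝓝 : Names} {ℓ : Level} (𝒫 : PsiCalculus 𝓝 ℓ) where
  open Names 𝓝
  open NameProperties 𝓝
  open Equivariance 𝓝
  open PsiCalculus 𝒫
  open Psi 𝒫 renaming (cong to cong-≈; sym to symα; trans to transα)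
  open PreagentProperties 𝒫
  open FrameProperties 𝒫
  open AgentProperties 𝒫

  actᵃ : Perm → Action → Action
  actᵃ π (out M ã N) = out (Tₙ.act π M) (map (π ·_) ã) (Tₙ.act π N)
  actᵃ π (inp M N)   = inp (Tₙ.act π M) (Tₙ.act π N)
  actᵃ π τ           = τ

  bn-act : ∀ π α → bn (actᵃ π α) ≡ map (π ·_) (bn α)
  bn-act π (out M ã N) = refl
  bn-act π (inp M N)   = refl
  bn-act π τ           = refl

  nᵃ-act : ∀ π α → Equi (π ·_) (nᵃ α) (nᵃ (actᵃ π α))
  nᵃ-act π (out M ã N) = equi-++ (supp-equiᵀ π) (supp-equiᵀ π)
  nᵃ-act π (inp M N)   = equi-++ (supp-equiᵀ π) (supp-equiᵀ π)
  nᵃ-act π τ           = equi-[]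

  ≡α⇒≡ʳ : ∀ {P Q} α → P ≡α Q → (α , P) ≡ʳ (α , Q)
  ≡α⇒≡ʳ (out M ã N) e = out T.refl T.refl e
  ≡α⇒≡ʳ (inp M N)   e = inp T.refl T.refl e
  ≡α⇒≡ʳ τ           e = τ e

  actʳ : Perm → Action × Preagent → Action × Preagent
  actʳ π (α , P) = actᵃ π α , Pₙ.act π P

  act-≡ʳ : ∀ π {ρ ρ′} → ρ ≡ʳ ρ′ → actʳ π ρ ≡ʳ actʳ π ρ′
  act-≡ʳ π (out e f g) = out (Tₙ.act-cong π e) (Tₙ.act-cong π f) (Pₙ.act-cong π g)
  act-≡ʳ π (inp e f g) = inp (Tₙ.act-cong π e) (Tₙ.act-cong π f) (Pₙ.act-cong π g)
  act-≡ʳ π (τ e)       = τ (Pₙ.act-cong π e)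
  act-≡ʳ π (alpha {M} {ã} {c̃} {N} {P} v) = transα
    (alpha (map-variant (·-injective π) (equi-++ (supp-equiᵀ π) (n-act π P)) v))
    (out T.refl (Tₙ.act-swaps π c̃ ã N) (Pₙ.act-swaps π c̃ ã P))
  act-≡ʳ π (symα e)     = symα (act-≡ʳ π e)
  act-≡ʳ π (transα e f) = transα (act-≡ʳ π e) (act-≡ʳ π f)

  -- Distinctness is what converting a label back to its original binders will require. Containment
  -- in the object is carried along because distinctness is recovered from it when `alpha` is read
  -- from right to left.
  Labelled : Action → Set
  Labelled (out _ ã N) = Unique ã × ã ⊆ T.supp N
  Labelled _           = ⊤

  labelled-≡ʳ : ∀ {ρ ρ′} → ρ ≡ʳ ρ′ →
    (Labelled (proj₁ ρ) → Labelled (proj₁ ρ′)) × (Labelled (proj₁ ρ′) → Labelled (proj₁ ρ))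
  labelled-≡ʳ (out _ e _) =
    (λ (u , s) → u , λ p → Tₙ.supp-cong e (s p)) , (λ (u , s) → u , λ p → Tₙ.supp-cong (T.sym e) (s p))
  labelled-≡ʳ (inp _ _ _) = id , id
  labelled-≡ʳ (τ _)       = id , id
  labelled-≡ʳ (alpha {N = N} v) =
    (λ (u , s) → FreshVariant.distinct v , λ p → binders-rename {N = N} v ∈-++⁺ˡ u s p) ,
    (λ (u , s) → let u′ , s′ = binders-rename⁻ {N = N} v ∈-++⁺ˡ s in u′ , λ p → s′ p)
  labelled-≡ʳ (symα e)     = let f , g = labelled-≡ʳ e in g , f
  labelled-≡ʳ (transα e f) = let g , h = labelled-≡ʳ e ; i , j = labelled-≡ʳ f in i ∘ g , h ∘ j

  insert-unique : ∀ (ã₁ : List Name) {ã₂ b} → Unique (ã₁ ++ ã₂) → b ∉ ã₁ ++ ã₂ → Unique (ã₁ ++ b ∷ ã₂)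
  insert-unique []       u b∉ = All.tabulate (λ { p refl → b∉ p }) ∷ u
  insert-unique (a ∷ ã₁) {ã₂} {b} (a∉ ∷ u) b∉ =
    All.tabulate (λ { p refl → [ (λ q → All.lookup a∉ (∈-++⁺ˡ q) refl)
      , (λ { (here refl) → b∉ (here refl) ; (there q) → All.lookup a∉ (∈-++⁺ʳ ã₁ q) refl }) ]′ (∈-++⁻ ã₁ p) }) ∷
    insert-unique ã₁ u (b∉ ∘ there)

  ∈-insert⁻ : ∀ (ã₁ : List Name) {ã₂ b x} → x ∈ ã₁ ++ b ∷ ã₂ → x ≡ b ⊎ x ∈ ã₁ ++ ã₂
  ∈-insert⁻ ã₁ p with ∈-++⁻ ã₁ p
  ... | inj₁ q         = inj₂ (∈-++⁺ˡ q)
  ... | inj₂ (here e)  = inj₁ e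
  ... | inj₂ (there q) = inj₂ (∈-++⁺ʳ ã₁ q)

  labelled : ∀ {Ψ P α P′} → Ψ ▷ P ─[ α ]→ P′ → Labelled α
  labelled (alpha _ _ d r) = proj₁ (labelled-≡ʳ r) (labelled d)
  labelled (input _ _ _)   = tt
  labelled (output _)      = [] , λ ()
  labelled (case d _ _)    = labelled d
  labelled (comˡ _ _ _ _ _ _ _ _) = tt
  labelled (comʳ _ _ _ _ _ _ _ _) = tt
  labelled (parˡ _ _ d _)  = labelled d
  labelled (parʳ _ _ d _)  = labelled d
  labelled (scope d _)     = labelled d
  labelled (open′ {ã₁ = ã₁} {ã₂} {N} d b∉ b∈) = let u , s = labelled d in
    insert-unique ã₁ u (λ p → b∉ ([ ∈-++⁺ˡ , ∈-++⁺ʳ ã₁ ∘ ∈-++⁺ˡ ]′ (∈-++⁻ ã₁ p))) ,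
    λ p → [ (λ { refl → b∈ }) , (λ q → s q) ]′ (∈-insert⁻ ã₁ p)
  labelled (rep d)         = labelled d

  -- The names that a transition of an agent with names A may leave free.
  Confined : List Name → Action × Preagent → Set
  Confined A (out M ã N , P) = (T.supp N ++ n P) ∖ ã ⊆ A
  Confined A (inp M N , P)   = n P ⊆ A ++ T.supp N
  Confined A (τ , P)         = n P ⊆ A

  confined-≡ʳ : ∀ {A ρ ρ′} → ρ ≡ʳ ρ′ → (Confined A ρ → Confined A ρ′) × (Confined A ρ′ → Confined A ρ)
  confined-≡ʳ {A} (out {ã = ã} {N} {N′} {P} {P′} _ e f) = (λ c p → c (from eq p)) , (λ c p → c (to eq p))
    where
    eq : Equi id ((T.supp N ++ n P) ∖ ã) ((T.supp N′ ++ n P′) ∖ ã)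
    eq = equi
      (λ r → let x∈ , x∉ = ∈-∖⁻ r in ∈-∖⁺ (to (equi-++ (equi (Tₙ.supp-cong e) (Tₙ.supp-cong (T.sym e))) (n-≡α f)) x∈) x∉)
      (λ r → let x∈ , x∉ = ∈-∖⁻ r in ∈-∖⁺ (from (equi-++ (equi (Tₙ.supp-cong e) (Tₙ.supp-cong (T.sym e))) (n-≡α f)) x∈) x∉)
  confined-≡ʳ {A} (inp {N = N} {N′} _ e f) =
    (λ c p → [ ∈-++⁺ˡ , ∈-++⁺ʳ A ∘ Tₙ.supp-cong e ]′ (∈-++⁻ A (c (from (n-≡α f) p)))) ,
    (λ c p → [ ∈-++⁺ˡ , ∈-++⁺ʳ A ∘ Tₙ.supp-cong (T.sym e) ]′ (∈-++⁻ A (c (to (n-≡α f) p))))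
  confined-≡ʳ (τ f) = (λ c p → c (from (n-≡α f) p)) , (λ c p → c (to (n-≡α f) p))
  confined-≡ʳ (alpha {ã = ã} {c̃} {N} {P} v) = (λ c p → c (from eq p)) , (λ c p → c (to eq p))
    where eq = rename-∖ v (equi-++ (swaps-equiᵀ c̃ ã N) (swaps-equiᵖ c̃ ã P))
  confined-≡ʳ (symα e)     = let f , g = confined-≡ʳ e in g , f
  confined-≡ʳ (transα e f) = let g , h = confined-≡ʳ e ; i , j = confined-≡ʳ f in i ∘ g , h ∘ j

  confined-⊆ : ∀ {A B} α {P} → A ⊆ B → Confined A (α , P) → Confined B (α , P)
  confined-⊆ (out M ã N) s c p = s (c p)
  confined-⊆ {A} (inp M N) s c p = [ ∈-++⁺ˡ ∘ s , ∈-++⁺ʳ _ ]′ (∈-++⁻ A (c p))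
  confined-⊆ τ           s c p = s (c p)

  confined-∪ : ∀ {A P Q} α → Confined A (α , P) → (∀ {x} → x ∈ n Q → x ∈ n P ⊎ x ∈ A) → Confined A (α , Q)
  confined-∪ {P = P} (out M ã N) c s p with ∈-∖⁻ p
  ... | x∈ , x∉ with ∈-++⁻ (T.supp N) x∈
  ...   | inj₁ q = c (∈-∖⁺ (∈-++⁺ˡ q) x∉)
  ...   | inj₂ q = [ (λ r → c (∈-∖⁺ (∈-++⁺ʳ (T.supp N) r) x∉)) , id ]′ (s q)
  confined-∪ (inp M N) c s p = [ c , ∈-++⁺ˡ ]′ (s p)
  confined-∪ τ         c s p = [ c , id ]′ (s p)

  n-ν* : ∀ ã {P x} → x ∈ n (ν* ã P) → x ∈ n P × x ∉ ã
  n-ν* []      p = p , λ ()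
  n-ν* (a ∷ ã) p with ∈-∖⁻ p
  ... | q , x≢a with n-ν* ã q
  ...   | r , x∉ = r , λ { (here refl) → x≢a (here refl) ; (there s) → x∉ s }

  ∈-branch : ∀ {B φ P} → (φ , P) ∈ B → n P ⊆ nBranches B
  ∈-branch {B = (φ , P) ∷ B} (here refl) p = ∈-++⁺ʳ (C.supp φ) (∈-++⁺ˡ p)
  ∈-branch {B = (φ , P) ∷ B} (there q) p = ∈-++⁺ʳ (C.supp φ) (∈-++⁺ʳ (n P) (∈-branch q p))

  private
    confined-scope : ∀ {P b P′} α → Confined (n P) (α , P′) → b ∉ nᵃ α → Confined (n (ν b P)) (α , ν b P′)
    confined-scope {P} {b} (out M ã N) c b∉ p with ∈-∖⁻ p
    ... | x∈ , x∉ with ∈-++⁻ (T.supp N) x∈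
    ...   | inj₁ q = ∈-∖⁺ (c (∈-∖⁺ (∈-++⁺ˡ q) x∉)) λ { (here refl) → b∉ (∈-++⁺ʳ (T.supp M) q) }
    ...   | inj₂ q = let r , x≢b = ∈-∖⁻ q in ∈-∖⁺ (c (∈-∖⁺ (∈-++⁺ʳ (T.supp N) r) x∉)) x≢b
    confined-scope {P} (inp M N) c b∉ p = let r , x≢b = ∈-∖⁻ p in
      [ (λ q → ∈-++⁺ˡ (∈-∖⁺ q x≢b)) , ∈-++⁺ʳ _ ]′ (∈-++⁻ (n P) (c r))
    confined-scope τ c b∉ p = let r , x≢b = ∈-∖⁻ p in ∈-∖⁺ (c r) x≢b

    -- A name that the receiver obtains from the object is, by confinement of the sender, either
    -- free in the sender or among the extruded `ã`, which the restriction in the derivative binds.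
    communicated : ∀ {A B ã N P′ Q′ x} → (T.supp N ++ n P′) ∖ ã ⊆ A → n Q′ ⊆ B ++ T.supp N →
                   x ∉ ã → x ∈ n P′ ⊎ x ∈ n Q′ → x ∈ A ⊎ x ∈ B
    communicated {N = N} c c′ x∉ (inj₁ p) = inj₁ (c (∈-∖⁺ (∈-++⁺ʳ (T.supp N) p) x∉))
    communicated {B = B} c c′ x∉ (inj₂ p) = [ inj₂ , (λ q → inj₁ (c (∈-∖⁺ (∈-++⁺ˡ q) x∉))) ]′ (∈-++⁻ B (c′ p))

  -- The critical case is input: a name brought in by `L̃` occurs in the object of the label by
  -- (S1), which needs the pattern variables to occur in the pattern; hence the assumption of
  -- well-formedness, which is passed down to the subagents.
  confined : ∀ {Ψ P α P′} → WellFormed P → Ψ ▷ P ─[ α ]→ P′ → Confined (n P) (α , P′)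
  confined w (alpha {α = α} {α₀} {P′} {P₀′} _ e d r) = confined-⊆ α {P′} (from (n-≡α e))
    (proj₁ (confined-≡ʳ r) (confined (proj₁ (wf-≡α e) w) d))
  confined (input u s w) (input {M = M} {K} {ỹ} {N} {L̃} {P} _ l t) p with n-[]≔ u l t p
  ... | inj₁ (x∈ , x∉) = ∈-++⁺ˡ (∈-++⁺ʳ (T.supp M) (∈-∖⁺ (∈-++⁺ʳ (T.supp N) x∈) x∉))
  ... | inj₂ x∈        = ∈-++⁺ʳ (n (input M ỹ N P)) (Substitution.subst-supp substᵀ u l s x∈)
  confined (output w) (output {M = M} _) p = ∈-++⁺ʳ (T.supp M) (proj₁ (∈-∖⁻ p))
  confined (case W) (case {α = α} {P′} d i _) =
    confined-⊆ α {P′} (∈-branch i) (confined (proj₁ (All.lookup W i)) d)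
  confined (w ∣ w′) (comˡ {P = P} {Q} {ã = ã} {P′ = P′} {Q′} _ _ _ _ d d′ _ _) p =
    let q , x∉ = n-ν* ã p in
    [ ∈-++⁺ˡ , ∈-++⁺ʳ (n P) ]′ (communicated {P′ = P′} {Q′ = Q′} (confined w d) (confined w′ d′) x∉ (∈-++⁻ (n P′) q))
  confined (w ∣ w′) (comʳ {P = P} {Q} {ã = ã} {P′ = P′} {Q′} _ _ _ _ d d′ _ _) p =
    let q , x∉ = n-ν* ã p in
    [ ∈-++⁺ʳ (n P) , ∈-++⁺ˡ ]′ (communicated {P′ = Q′} {Q′ = P′} (confined w′ d′) (confined w d) x∉
      ([ inj₂ , inj₁ ]′ (∈-++⁻ (n P′) q)))
  confined (w ∣ w′) (parˡ {P = P} {Q} {α = α} {P′} _ _ d _) =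
    confined-∪ {P = P′} α (confined-⊆ α {P′} ∈-++⁺ˡ (confined w d))
      λ p → [ inj₁ , (λ q → inj₂ (∈-++⁺ʳ (n P) q)) ]′ (∈-++⁻ (n P′) p)
  confined (w ∣ w′) (parʳ {P = P} {Q} {α = α} {Q′} _ _ d _) =
    confined-∪ {P = Q′} α (confined-⊆ α {Q′} (∈-++⁺ʳ (n P)) (confined w′ d))
      λ p → [ (λ q → inj₂ (∈-++⁺ˡ q)) , inj₁ ]′ (∈-++⁻ (n P) p)
  confined (ν w) (scope {P = P} {b} {α} {P′} d b∉) = confined-scope {P} {b} {P′} α (confined w d) (b∉ ∘ ∈-++⁺ˡ)
  confined (ν w) (open′ {P = P} {b} {M} {ã₁} {ã₂} {N} {P′} d b∉ b∈) p with ∈-∖⁻ {A = T.supp N ++ n P′} {B = ã₁ ++ b ∷ ã₂} p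
  ... | x∈ , x∉ = ∈-∖⁺ (confined w d (∈-∖⁺ {B = ã₁ ++ ã₂} x∈ (λ q → x∉ ([ ∈-++⁺ˡ , ∈-++⁺ʳ ã₁ ∘ there ]′ (∈-++⁻ ã₁ q)))))
                       (λ { (here refl) → x∉ (∈-++⁺ʳ ã₁ (here refl)) })
  confined ((! w) g) (rep {P = P} {α} {P′} d) = confined-⊆ α {P′}
    (λ p → [ id , id ]′ (∈-++⁻ (n P) p)) (confined (w ∣ (! w) g) d)

  -- For an output the names of the object are left out: by `confined', they are
  -- names of the agent or bound.
  subjectNames : Action → List Name
  subjectNames (out M _ _) = T.supp M
  subjectNames (inp M N)   = T.supp M ++ T.supp N
  subjectNames τ           = []

  subjectNames-⊆ : ∀ α → subjectNames α ⊆ nᵃ α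
  subjectNames-⊆ (out M ã N) = ∈-++⁺ˡ
  subjectNames-⊆ (inp M N)   = id
  subjectNames-⊆ τ           = id

  -- On the bound names of an output `ρ` and `σ` may differ: both residuals are converted to the
  -- common binders `d̃`, after which only free names matter, and `Confined` places these in `A`.
  residual-agree : ∀ ρ σ {A} α {P} → (∀ {x} → x ∈ A → ρ · x ≡ σ · x) →
    (∀ {x} → x ∈ subjectNames α → ρ · x ≡ σ · x) → Confined A (α , P) → actʳ ρ (α , P) ≡ʳ actʳ σ (α , P)
  residual-agree ρ σ {A} (out M ã N) {P} f g c =
    transα (alpha vρ)
    (transα (out (Tₙ.act-agree ρ σ g)
                 (Tₙ.swaps-agree d̃ (map (ρ ·_) ã) ρ d̃ (map (σ ·_) ã) σ (renamed ∘ ∈-++⁺ˡ))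
                 (Pₙ.swaps-agree d̃ (map (ρ ·_) ã) ρ d̃ (map (σ ·_) ã) σ (renamed ∘ ∈-++⁺ʳ (T.supp N))))
    (symα (alpha vσ)))
    where
    Aρ Aσ d̃ : List Name
    Aρ = T.supp (Tₙ.act ρ N) ++ n (Pₙ.act ρ P)
    Aσ = T.supp (Tₙ.act σ N) ++ n (Pₙ.act σ P)
    d̃  = common (ρ ·_) (σ ·_) ã Aρ Aσ
    vρ = common-left (ρ ·_) (σ ·_) ã Aρ Aσ
    vσ = common-right (ρ ·_) (σ ·_) ã Aρ Aσ
    renamed : ∀ {x} → x ∈ T.supp N ++ n P →
              zip d̃ (map (ρ ·_) ã) · ρ · x ≡ zip d̃ (map (σ ·_) ã) · σ · x
    renamed x∈ = rename-agree (·-injective ρ) (·-injective σ) vρ vσ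
      (λ r → avoids-used vρ r (to (equi-++ (supp-equiᵀ ρ) (n-act ρ P)) x∈))
      (λ r → avoids-used vσ r (to (equi-++ (supp-equiᵀ σ) (n-act σ P)) x∈))
      (λ x∉ → f (c (∈-∖⁺ x∈ x∉)))
  residual-agree ρ σ {A} (inp M N) f g c = inp (Tₙ.act-agree ρ σ (g ∘ ∈-++⁺ˡ))
    (Tₙ.act-agree ρ σ (g ∘ ∈-++⁺ʳ (T.supp M)))
    (Pₙ.act-agree ρ σ (λ p → [ f , g ∘ ∈-++⁺ʳ (T.supp M) ]′ (∈-++⁻ A (c p))))
  residual-agree ρ σ τ f g c = τ (Pₙ.act-agree ρ σ (f ∘ c))

  -- Brings a transition derived along an auxiliary `ρ` back to the intended `σ`; the original
  -- derivation serves to confine the residual.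
  transition-agree : ∀ ρ σ {Ψ Ψ′ P α P′} → WellFormed P → Ψ ▷ P ─[ α ]→ P′ →
    (∀ {x} → x ∈ n P → ρ · x ≡ σ · x) → (∀ {x} → x ∈ subjectNames α → ρ · x ≡ σ · x) →
    Ψ′ ▷ Pₙ.act ρ P ─[ actᵃ ρ α ]→ Pₙ.act ρ P′ → Ψ′ ▷ Pₙ.act σ P ─[ actᵃ σ α ]→ Pₙ.act σ P′
  transition-agree ρ σ {α = α} w d f g d′ =
    alpha A.refl (symα (Pₙ.act-agree ρ σ f)) d′ (residual-agree ρ σ α f g (confined w d))

-- Transfer of transitions along permutations and equivalent environments

module TransferProperties {𝓝 : Names} {ℓ : Level} (𝒫 : PsiCalculus 𝓝 ℓ) where
  open Names 𝓝
  open NameProperties 𝓝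
  open Equivariance 𝓝
  open PsiCalculus 𝒫
  open Psi 𝒫 renaming (cong to cong-≈; sym to symα; trans to transα)
  open PreagentProperties 𝒫
  open FrameProperties 𝒫
  open AgentProperties 𝒫
  open TransitionProperties 𝒫

  -- ρ differs from π only in sending b̃ outside D.
  module Detach (π : Perm) (b̃ D : List Name) where
    abstract
      c̃ : List Name
      c̃ = freshes (length (map (π ·_) b̃)) (map (π ·_) b̃ ++ D)

      variant : FreshVariant c̃ (map (π ·_) b̃) D
      variant = freshVariant (map (π ·_) b̃) D

    ρ : Perm
    ρ = zip c̃ (map (π ·_) b̃) ++ π

    outside : ∀ {X X′} → Equi (π ·_) X X′ → X′ ⊆ D → b̃ # X → ∀ {x} → x ∈ X → ρ · x ≡ π · x
    outside e s b̃#X {x} x∈ = trans (·-++ (zip c̃ (map (π ·_) b̃)) π x) (rename-∉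
      (λ q → avoids-used variant q (s (to e x∈)))
      (λ q → b̃#X (∈-map-injective (·-injective π) q , x∈)))

    inside : ∀ {b} → b ∈ b̃ → ρ · b ∉ D
    inside {b} b∈ q = avoids-used variant
      (rename-∈ variant (λ r → avoids-old variant r (∈-map⁺ (π ·_) b∈)) (∈-map⁺ (π ·_) b∈))
      (subst (_∈ D) (·-++ (zip c̃ (map (π ·_) b̃)) π b) q)

  ∈-actBranches : ∀ π {B φ P} → (φ , P) ∈ B → (Cₙ.act π φ , Pₙ.act π P) ∈ actBranches π B
  ∈-actBranches π {_ ∷ _} (here refl) = here refl
  ∈-actBranches π {_ ∷ _} (there p)   = there (∈-actBranches π p)

  act-ν* : ∀ π ã {P} → Pₙ.act π (ν* ã P) ≡ ν* (map (π ·_) ã) (Pₙ.act π P)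
  act-ν* π []      = refl
  act-ν* π (a ∷ ã) {P} = trans (act-ν π {a} {ν* ã P}) (cong (ν (π · a)) (act-ν* π ã))

  #-sub : ∀ {A B C : List Name} → B ⊆ A → C # A → C # B
  #-sub s d (p , q) = d (p , s q)

  private
    act-≃-agree : ∀ π ρ {Ψ Ψ′} → Aₙ.act π Ψ ≃ Ψ′ → (∀ {x} → x ∈ A.supp Ψ → ρ · x ≡ π · x) → Aₙ.act ρ Ψ ≃ Ψ′
    act-≃-agree π ρ e f = ≃-trans (≈⇒≃ (Aₙ.act-agree ρ π f)) e

    act-⊗-≃ : ∀ ρ {Φ Ψ Ψ′} → Aₙ.act ρ Ψ ≃ Ψ′ → Aₙ.act ρ (Φ ⊗ Ψ) ≃ Aₙ.act ρ Φ ⊗ Ψ′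
    act-⊗-≃ ρ e = ≃-trans (≈⇒≃ (act-⊗ ρ)) (⊗-≃ ≃-refl e)

    act-⊢-↔̇ : ∀ π {Ψ Ψ′ M K} → Aₙ.act π Ψ ≃ Ψ′ → Ψ ⊢ M ↔̇ K → Ψ′ ⊢ Tₙ.act π M ↔̇ Tₙ.act π K
    act-⊢-↔̇ π e p = Equivalence.to (e _) (⊢-resp A.refl (act-↔̇ π) (act-⊢ π p))

    act-com-≃ : ∀ ρ {Ψ Ψ′ Φ Θ} → Aₙ.act ρ Ψ ≃ Ψ′ → Aₙ.act ρ (Ψ ⊗ Φ ⊗ Θ) ≃ Ψ′ ⊗ Aₙ.act ρ Φ ⊗ Aₙ.act ρ Θ
    act-com-≃ ρ e = ≃-trans (≈⇒≃ (act-⊗ ρ)) (⊗-≃ (≃-trans (≈⇒≃ (act-⊗ ρ)) (⊗-≃ e ≃-refl)) ≃-refl)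

    binders-fresh : ∀ (ρ : Perm) {A A′ R R′ b̃ : List Name} → b̃ # A ++ R → Equi (ρ ·_) R R′ →
                    (∀ {b} → b ∈ b̃ → ρ · b ∉ A′) → map (ρ ·_) b̃ # A′ ++ R′
    binders-fresh ρ {A} {A′} d e away (p , q) with ∈-map⁻ (ρ ·_) p
    ... | x , x∈ , refl = [ away x∈ , (λ r → d (x∈ , ∈-++⁺ʳ A (from e r))) ]′ (∈-++⁻ A′ q)

    com-equi : ∀ ρ {b̃ Q M P} → Equi (ρ ·_) (b̃ ++ n Q ++ T.supp M ++ n P)
                 (map (ρ ·_) b̃ ++ n (Pₙ.act ρ Q) ++ T.supp (Tₙ.act ρ M) ++ n (Pₙ.act ρ P))
    com-equi ρ {b̃} {Q} {M} {P} = equi-++ {A = b̃} (equi-map (·-injective ρ))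
      (equi-++ (n-act ρ Q) (equi-++ (supp-equiᵀ ρ {M}) (n-act ρ P)))

    -- The binders of Com avoid both agents, so the whole rule can be applied along `ρ` and only its
    -- conclusion compared with `π`. `M` may contain names of `b̃Q`, and `K` names of `b̃P`; these
    -- channels move along with `ρ`, and the label `τ` hides them.
    module DetachCom (π : Perm) {Ψ Ψ′ : Assertion} {P Q : Preagent} {b̃P b̃Q : List Name} {M K : Term}
                     (e : Aₙ.act π Ψ ≃ Ψ′)
                     (b̃P# : b̃P # A.supp Ψ ++ b̃Q ++ n Q ++ T.supp M ++ n P)
                     (b̃Q# : b̃Q # A.supp Ψ ++ b̃P ++ n P ++ T.supp K ++ n Q) where
      D : List Name
      D = A.supp (Aₙ.act π Ψ) ++ n (Pₙ.act π (P ∣ Q)) ++ A.supp Ψ′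

      open Detach π (b̃P ++ b̃Q) D public

      agree : ∀ {x} → x ∈ n (P ∣ Q) → ρ · x ≡ π · x
      agree = outside (n-act π (P ∣ Q)) (∈-++⁺ʳ (A.supp (Aₙ.act π Ψ)) ∘ ∈-++⁺ˡ) λ (p , q) → go (∈-++⁻ b̃P p) (∈-++⁻ (n P) q)
        where
        go : ∀ {x} → x ∈ b̃P ⊎ x ∈ b̃Q → ¬ (x ∈ n P ⊎ x ∈ n Q)
        go (inj₁ p) (inj₁ q) = b̃P# (p , ∈-++⁺ʳ (A.supp Ψ) (∈-++⁺ʳ b̃Q (∈-++⁺ʳ (n Q) (∈-++⁺ʳ (T.supp M) q))))
        go (inj₁ p) (inj₂ q) = b̃P# (p , ∈-++⁺ʳ (A.supp Ψ) (∈-++⁺ʳ b̃Q (∈-++⁺ˡ q)))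
        go (inj₂ p) (inj₁ q) = b̃Q# (p , ∈-++⁺ʳ (A.supp Ψ) (∈-++⁺ʳ b̃P (∈-++⁺ˡ q)))
        go (inj₂ p) (inj₂ q) = b̃Q# (p , ∈-++⁺ʳ (A.supp Ψ) (∈-++⁺ʳ b̃P (∈-++⁺ʳ (n P) (∈-++⁺ʳ (T.supp K) q))))

      env : Aₙ.act ρ Ψ ≃ Ψ′
      env = act-≃-agree π ρ e (outside (supp-equiᴬ π) ∈-++⁺ˡ λ (p , q) →
        [ (λ r → b̃P# (r , ∈-++⁺ˡ q)) , (λ r → b̃Q# (r , ∈-++⁺ˡ q)) ]′ (∈-++⁻ b̃P p))

      away : ∀ {b} → b ∈ b̃P ++ b̃Q → ρ · b ∉ A.supp Ψ′
      away b∈ q = inside b∈ (∈-++⁺ʳ (A.supp (Aₙ.act π Ψ)) (∈-++⁺ʳ (n (Pₙ.act π (P ∣ Q))) q))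

      fresh-P : map (ρ ·_) b̃P # A.supp Ψ′ ++ map (ρ ·_) b̃Q ++ n (Pₙ.act ρ Q) ++ T.supp (Tₙ.act ρ M) ++ n (Pₙ.act ρ P)
      fresh-P = binders-fresh ρ {A.supp Ψ} b̃P# (com-equi ρ {b̃Q} {Q} {M} {P}) (away ∘ ∈-++⁺ˡ)

      fresh-Q : map (ρ ·_) b̃Q # A.supp Ψ′ ++ map (ρ ·_) b̃P ++ n (Pₙ.act ρ P) ++ T.supp (Tₙ.act ρ K) ++ n (Pₙ.act ρ Q)
      fresh-Q = binders-fresh ρ {A.supp Ψ} b̃Q# (com-equi ρ {b̃P} {P} {K} {Q}) (away ∘ ∈-++⁺ʳ b̃P)

    -- X: the names that the label of ν b P is required to agree on
    module DetachBinder (π : Perm) {Ψ Ψ′ : Assertion} {P : Preagent} {b : Name} {X X′ : List Name}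
                        (e : Aₙ.act π Ψ ≃ Ψ′) (eX : Equi (π ·_) X X′)
                        (b∉Ψ : b ∉ A.supp Ψ) (b∉X : b ∉ X) where
      D : List Name
      D = n (Pₙ.act π (ν b P)) ++ X′ ++ A.supp (Aₙ.act π Ψ) ++ A.supp Ψ′

      open Detach π (b ∷ []) D public

      agreeᵖ : ∀ {x} → x ∈ n (ν b P) → ρ · x ≡ π · x
      agreeᵖ = outside (n-act π (ν b P)) ∈-++⁺ˡ
        λ { (here refl , q) → proj₂ (∈-∖⁻ {A = n P} {B = b ∷ []} q) (here refl) }

      agreeˣ : ∀ {x} → x ∈ X → ρ · x ≡ π · x
      agreeˣ = outside eX (∈-++⁺ʳ (n (Pₙ.act π (ν b P))) ∘ ∈-++⁺ˡ) λ { (here refl , q) → b∉X q }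

      env : Aₙ.act ρ Ψ ≃ Ψ′
      env = act-≃-agree π ρ e (outside (supp-equiᴬ π)
        (∈-++⁺ʳ (n (Pₙ.act π (ν b P))) ∘ ∈-++⁺ʳ X′ ∘ ∈-++⁺ˡ) λ { (here refl , q) → b∉Ψ q })

      away : ρ · b ∉ A.supp Ψ′
      away q = inside (here refl) (∈-++⁺ʳ (n (Pₙ.act π (ν b P))) (∈-++⁺ʳ X′ (∈-++⁺ʳ (A.supp (Aₙ.act π Ψ)) q)))

    -- Unlike in Com, the binders may meet the free names of the agent `Q` whose frame they come
    -- from, so `Q` itself stays with `π`. Only the premise is transported along `ρ` and then
    -- brought back. The frame of `π · Q` is displayed with the binders `c̃`, which turns its body
    -- into `ρ · Φ`; for this `D` includes the names of `π · Φ`.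
    module DetachPar (π : Perm) {Ψ Ψ′ : Assertion} {P Q : Preagent} {b̃ : List Name} {Φ : Assertion}
                     (α : Action) (e : Aₙ.act π Ψ ≃ Ψ′)
                     (f : 𝓕 Q ≡ᶠ ⟨ν b̃ ⟩ Φ) (b̃# : b̃ # A.supp Ψ ++ n P ++ nᵃ α) where
      D : List Name
      D = (A.supp Ψ′ ++ n (Pₙ.act π P) ++ nᵃ (actᵃ π α)) ++ A.supp (Aₙ.act π Ψ) ++ A.supp (Aₙ.act π Φ)

      open Detach π b̃ D public

      agreeᵖ : ∀ {x} → x ∈ n P → ρ · x ≡ π · x
      agreeᵖ = outside (n-act π P) (∈-++⁺ˡ ∘ ∈-++⁺ʳ (A.supp Ψ′) ∘ ∈-++⁺ˡ) (#-sub (∈-++⁺ʳ (A.supp Ψ) ∘ ∈-++⁺ˡ) b̃#)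

      agreeᵃ : ∀ {x} → x ∈ subjectNames α → ρ · x ≡ π · x
      agreeᵃ x∈ = outside (nᵃ-act π α) (∈-++⁺ˡ ∘ ∈-++⁺ʳ (A.supp Ψ′) ∘ ∈-++⁺ʳ (n (Pₙ.act π P)))
        (#-sub (∈-++⁺ʳ (A.supp Ψ) ∘ ∈-++⁺ʳ (n P)) b̃#) (subjectNames-⊆ α x∈)

      env : Aₙ.act ρ (Φ ⊗ Ψ) ≃ Aₙ.act ρ Φ ⊗ Ψ′
      env = act-⊗-≃ ρ (act-≃-agree π ρ e (outside (supp-equiᴬ π)
        (∈-++⁺ʳ (A.supp Ψ′ ++ n (Pₙ.act π P) ++ nᵃ (actᵃ π α)) ∘ ∈-++⁺ˡ) (#-sub ∈-++⁺ˡ b̃#)))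

      frame : 𝓕 (Pₙ.act π Q) ≡ᶠ ⟨ν c̃ ⟩ Aₙ.act ρ Φ
      frame = transα (𝓕-act π Q f) (transα
        (alpha (variant-⊆ (∈-++⁺ʳ (A.supp Ψ′ ++ n (Pₙ.act π P) ++ nᵃ (actᵃ π α)) ∘ ∈-++⁺ʳ (A.supp (Aₙ.act π Ψ))) variant))
        (cong-≈ (A.reflexive (trans (Aₙ.swaps≡act c̃ (map (π ·_) b̃) (Aₙ.act π Φ))
                                    (sym (Aₙ.act-++ (zip c̃ (map (π ·_) b̃)) π Φ))))))

      fresh-c̃ : c̃ # A.supp Ψ′ ++ n (Pₙ.act π P) ++ nᵃ (actᵃ π α)
      fresh-c̃ (p , q) = avoids-used variant p (∈-++⁺ˡ q)

    bn-# : ∀ π α P → bn α # n P → bn (actᵃ π α) # n (Pₙ.act π P)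
    bn-# π α P d rewrite bn-act π α = equi-# (n-act π P) d

  -- Transitions are equivariant and depend only on what the environment
  -- entails.  As Ψ′ may have more names than π · Ψ, the binders involved in the
  -- derivation must be renamed, hence the induction for all π.
  transfer : ∀ {Ψ P α P′} → WellFormed P → Ψ ▷ P ─[ α ]→ P′ → ∀ π {Ψ′} → Aₙ.act π Ψ ≃ Ψ′ →
             Ψ′ ▷ Pₙ.act π P ─[ actᵃ π α ]→ Pₙ.act π P′
  transfer w (alpha eΨ eP d r) π e = alpha A.refl (Pₙ.act-cong π eP)
    (transfer (proj₁ (wf-≡α eP) w) d π (≃-trans (≈⇒≃ (Aₙ.act-cong π (A.sym eΨ))) e)) (act-≡ʳ π r)
  transfer (input u s w) (input {M = M} {K} {ỹ} {N} {L̃} {P} m l t) π e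
    rewrite act-input π {M} {ỹ} {N} {P} with act-[]≔ π u l t
  ... | P″ , t′ , f = alpha A.refl refl
    (input (act-⊢-↔̇ π e m) (trans (length-map (π ·_) ỹ) (trans l (sym (length-map (Tₙ.act π) L̃)))) t′)
    (inp T.refl (T.sym (SubstitutionProperties.act-[] substᵀ π u l)) f)
  transfer (output w) (output {M = M} {K} {N} {P} m) π e rewrite act-output π {M} {N} {P} =
    output (act-⊢-↔̇ π e m)
  transfer (case W) (case {B = B} d i p) π e rewrite act-case π {B} =
    case (transfer (proj₁ (All.lookup W i)) d π e) (∈-actBranches π i) (Equivalence.to (e _) (act-⊢ π p))
  transfer w@(wP ∣ wQ) d@(comˡ {P = P} {Q} {M = M} {K} {ã} {_} {P′} {Q′} fP fQ b̃P# b̃Q# dP dQ m ã#) π {Ψ′} e =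
    transition-agree ρ π w d agree (λ ()) moved
    where
    open DetachCom π {P = P} {Q = Q} {M = M} {K = K} e b̃P# b̃Q#
    moved : Ψ′ ▷ Pₙ.act ρ (P ∣ Q) ─[ τ ]→ Pₙ.act ρ (ν* ã (P′ ∣ Q′))
    moved rewrite act-ν* ρ ã {P′ ∣ Q′} | act-∣ ρ {P} {Q} | act-∣ ρ {P′} {Q′} =
      comˡ (𝓕-act ρ P fP) (𝓕-act ρ Q fQ) fresh-P fresh-Q
        (transfer wP dP ρ (act-⊗-≃ ρ env)) (transfer wQ dQ ρ (act-⊗-≃ ρ env))
        (act-⊢-↔̇ ρ (act-com-≃ ρ env) m) (equi-# (n-act ρ Q) ã#)
  transfer w@(wP ∣ wQ) d@(comʳ {P = P} {Q} {M = M} {K} {ã} {_} {P′} {Q′} fP fQ b̃P# b̃Q# dP dQ m ã#) π {Ψ′} e =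
    transition-agree ρ π w d agree (λ ()) moved
    where
    open DetachCom π {P = P} {Q = Q} {M = M} {K = K} e b̃P# b̃Q#
    moved : Ψ′ ▷ Pₙ.act ρ (P ∣ Q) ─[ τ ]→ Pₙ.act ρ (ν* ã (P′ ∣ Q′))
    moved rewrite act-ν* ρ ã {P′ ∣ Q′} | act-∣ ρ {P} {Q} | act-∣ ρ {P′} {Q′} =
      comʳ (𝓕-act ρ P fP) (𝓕-act ρ Q fQ) fresh-P fresh-Q
        (transfer wP dP ρ (act-⊗-≃ ρ env)) (transfer wQ dQ ρ (act-⊗-≃ ρ env))
        (act-⊢-↔̇ ρ (act-com-≃ ρ env) m) (equi-# (n-act ρ P) ã#)
  transfer (wP ∣ wQ) (parˡ {P = P} {Q} {α = α} {P′} f b̃# d bn#) π e rewrite act-∣ π {P} {Q} | act-∣ π {P′} {Q} =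
    parˡ frame fresh-c̃ (transition-agree ρ π wP d agreeᵖ agreeᵃ (transfer wP d ρ env)) (bn-# π α Q bn#)
    where open DetachPar π {P = P} {Q = Q} α e f b̃#
  transfer (wP ∣ wQ) (parʳ {P = P} {Q} {α = α} {Q′} f b̃# d bn#) π e rewrite act-∣ π {P} {Q} | act-∣ π {P} {Q′} =
    parʳ frame fresh-c̃ (transition-agree ρ π wQ d agreeᵖ agreeᵃ (transfer wQ d ρ env)) (bn-# π α P bn#)
    where open DetachPar π {P = Q} {Q = P} α e f b̃#
  transfer w@(ν wP) d@(scope {Ψ} {P} {b} {α} {P′} dP b∉) π {Ψ′} e =
    transition-agree ρ π w d agreeᵖ (agreeˣ ∘ subjectNames-⊆ α) moved
    where
    open DetachBinder π {P = P} e (nᵃ-act π α) (b∉ ∘ ∈-++⁺ʳ (nᵃ α)) (b∉ ∘ ∈-++⁺ˡ)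
    moved : Ψ′ ▷ Pₙ.act ρ (ν b P) ─[ actᵃ ρ α ]→ Pₙ.act ρ (ν b P′)
    moved rewrite act-ν ρ {b} {P} | act-ν ρ {b} {P′} = scope (transfer wP dP ρ env)
      (∉-++ {A = nᵃ (actᵃ ρ α)} (λ q → b∉ (∈-++⁺ˡ (from (nᵃ-act ρ α) q))) away)
  transfer w@(ν wP) d@(open′ {Ψ} {P} {b} {M} {ã₁} {ã₂} {N} {P′} dP b∉ b∈) π {Ψ′} e =
    transition-agree ρ π w d agreeᵖ agreeˣ moved
    where
    b∉M : b ∉ T.supp M
    b∉M = b∉ ∘ ∈-++⁺ʳ ã₁ ∘ ∈-++⁺ʳ ã₂ ∘ ∈-++⁺ʳ (A.supp Ψ)
    open DetachBinder π {P = P} e (supp-equiᵀ π {M}) (b∉ ∘ ∈-++⁺ʳ ã₁ ∘ ∈-++⁺ʳ ã₂ ∘ ∈-++⁺ˡ) b∉M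
    premise : Ψ′ ▷ Pₙ.act ρ P ─[ out (Tₙ.act ρ M) (map (ρ ·_) ã₁ ++ map (ρ ·_) ã₂) (Tₙ.act ρ N) ]→ Pₙ.act ρ P′
    premise = subst (λ ã → Ψ′ ▷ Pₙ.act ρ P ─[ out (Tₙ.act ρ M) ã (Tₙ.act ρ N) ]→ Pₙ.act ρ P′)
      (map-++ (ρ ·_) ã₁ ã₂) (transfer wP dP ρ env)
    moved : Ψ′ ▷ Pₙ.act ρ (ν b P) ─[ out (Tₙ.act ρ M) (map (ρ ·_) (ã₁ ++ b ∷ ã₂)) (Tₙ.act ρ N) ]→ Pₙ.act ρ P′
    moved rewrite act-ν ρ {b} {P} | map-++ (ρ ·_) ã₁ (b ∷ ã₂) = open′ premise
      (∉-++ {A = map (ρ ·_) ã₁} (λ q → b∉ (∈-++⁺ˡ (∈-map-injective (·-injective ρ) q)))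
      (∉-++ {A = map (ρ ·_) ã₂} (λ q → b∉ (∈-++⁺ʳ ã₁ (∈-++⁺ˡ (∈-map-injective (·-injective ρ) q))))
      (∉-++ {A = A.supp Ψ′} away (b∉M ∘ Tₙ.supp-act⁻ ρ))))
      (Tₙ.supp-act ρ b∈)
  transfer w@((! wP) g) (rep {P = P} {α} {P′} d) π {Ψ′} e with transfer (wP ∣ w) d π e
  ... | d′ rewrite act-∣ π {P} {Q = ! P} | act-! π {P} = rep d′

  actᵃ-id : ∀ α → actᵃ [] α ≡ α
  actᵃ-id (out M ã N) = cong (λ c̃ → out M c̃ N) (map-id ã)
  actᵃ-id (inp M N)   = refl
  actᵃ-id τ           = refl

  transfer-≃ : ∀ {Ψ Ψ′ P α P′} → WellFormed P → Ψ ≃ Ψ′ → Ψ ▷ P ─[ α ]→ P′ → Ψ′ ▷ P ─[ α ]→ P′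
  transfer-≃ {Ψ′ = Ψ′} {P} {α} {P′} w e d =
    subst (λ β → Ψ′ ▷ P ─[ β ]→ P′) (actᵃ-id α) (transfer w d [] e)

-- Transitions of agents inside contexts of assertions

module ContextProperties {𝓝 : Names} {ℓ : Level} (𝒫 : PsiCalculus 𝓝 ℓ) where
  open Names 𝓝
  open NameProperties 𝓝
  open Equivariance 𝓝
  open PsiCalculus 𝒫
  open Psi 𝒫 renaming (cong to cong-≈; sym to symα; trans to transα)
  open PreagentProperties 𝒫
  open FrameProperties 𝒫
  open AgentProperties 𝒫
  open TransitionProperties 𝒫
  open TransferProperties 𝒫

  -- Alpha-equivalence to `⦅ Φ ⦆`, recast as a predicate on shape. An induction over `≡α` can carry
  -- a predicate through symmetry and transitivity, where the intermediate preagents are arbitrary.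
  data IsAssertion (Φ : Assertion) : Preagent → Set ℓ where
    ⦅_⦆ : ∀ {Φ′} → Φ A.≈ Φ′ → IsAssertion Φ ⦅ Φ′ ⦆

  isAssertion-≡α : ∀ {Φ P Q} → P ≡α Q → (IsAssertion Φ P → IsAssertion Φ Q) × (IsAssertion Φ Q → IsAssertion Φ P)
  isAssertion-≡α refl            = id , id
  isAssertion-≡α (symα e)        = let f , g = isAssertion-≡α e in g , f
  isAssertion-≡α (transα e e′)   = let f , g = isAssertion-≡α e ; f′ , g′ = isAssertion-≡α e′ in f′ ∘ f , g ∘ g′
  isAssertion-≡α (alpha-input _) = (λ ()) , (λ ())
  isAssertion-≡α (alpha-ν _)     = (λ ()) , (λ ())
  isAssertion-≡α (output _ _ _)  = (λ ()) , (λ ())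
  isAssertion-≡α (input _ _ _)   = (λ ()) , (λ ())
  isAssertion-≡α (case _)        = (λ ()) , (λ ())
  isAssertion-≡α (ν _)           = (λ ()) , (λ ())
  isAssertion-≡α (_ ∣ _)         = (λ ()) , (λ ())
  isAssertion-≡α (! _)           = (λ ()) , (λ ())
  isAssertion-≡α ⦅ e ⦆           = (λ { ⦅ f ⦆ → ⦅ A.trans f e ⦆ }) , (λ { ⦅ f ⦆ → ⦅ A.trans f (A.sym e) ⦆ })

  assertion-stuck : ∀ {Ψ Φ P α P′} → IsAssertion Φ P → ¬ (Ψ ▷ P ─[ α ]→ P′)
  assertion-stuck i     (alpha _ e d _) = assertion-stuck (proj₁ (isAssertion-≡α e) i) d
  assertion-stuck () (input _ _ _)
  assertion-stuck () (output _)
  assertion-stuck () (case _ _ _)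
  assertion-stuck () (comˡ _ _ _ _ _ _ _ _)
  assertion-stuck () (comʳ _ _ _ _ _ _ _ _)
  assertion-stuck () (parˡ _ _ _ _)
  assertion-stuck () (parʳ _ _ _ _)
  assertion-stuck () (scope _ _)
  assertion-stuck () (open′ _ _ _)
  assertion-stuck () (rep _)

  data Under (Φ : Assertion) (P : Preagent) : Preagent → Set ℓ where
    _∣_ : ∀ {Φ′ P′} → Φ A.≈ Φ′ → P ≡α P′ → Under Φ P (⦅ Φ′ ⦆ ∣ P′)

  under-≡α : ∀ {Φ R P Q} → P ≡α Q → (Under Φ R P → Under Φ R Q) × (Under Φ R Q → Under Φ R P)
  under-≡α refl            = id , id
  under-≡α (symα e)        = let f , g = under-≡α e in g , f
  under-≡α (transα e e′)   = let f , g = under-≡α e ; f′ , g′ = under-≡α e′ in f′ ∘ f , g ∘ g′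
  under-≡α (alpha-input _) = (λ ()) , (λ ())
  under-≡α (alpha-ν _)     = (λ ()) , (λ ())
  under-≡α (output _ _ _)  = (λ ()) , (λ ())
  under-≡α (input _ _ _)   = (λ ()) , (λ ())
  under-≡α (case _)        = (λ ()) , (λ ())
  under-≡α (ν _)           = (λ ()) , (λ ())
  under-≡α {Φ} {R} (e ∣ f) = forth e f , back e f
    where
    forth : ∀ {P P′ Q Q′} → P ≡α P′ → Q ≡α Q′ → Under Φ R (P ∣ Q) → Under Φ R (P′ ∣ Q′)
    forth e f (i ∣ j) with proj₁ (isAssertion-≡α e) ⦅ i ⦆
    ... | ⦅ i′ ⦆ = i′ ∣ transα j f
    back : ∀ {P P′ Q Q′} → P ≡α P′ → Q ≡α Q′ → Under Φ R (P′ ∣ Q′) → Under Φ R (P ∣ Q)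
    back e f (i ∣ j) with proj₂ (isAssertion-≡α e) ⦅ i ⦆
    ... | ⦅ i′ ⦆ = i′ ∣ transα j (symα f)
  under-≡α (! _)           = (λ ()) , (λ ())
  under-≡α ⦅ _ ⦆           = (λ ()) , (λ ())

  -- Freshness of `bn α` is part of the predicate because the binders of a label bind into the whole
  -- derivative: renaming them must leave the assertion beside `P` alone.
  data Underʳ (Φ : Assertion) (ρ : Action × Preagent) : Action × Preagent → Set ℓ where
    underʳ : ∀ {α Φ′ P} → Φ A.≈ Φ′ → bn α # A.supp Φ → ρ ≡ʳ (α , P) → Underʳ Φ ρ (α , (⦅ Φ′ ⦆ ∣ P))

  swaps-∣ : ∀ c̃ b̃ Φ P → swaps swap c̃ b̃ (⦅ Φ ⦆ ∣ P) ≡ (⦅ swaps A.swap c̃ b̃ Φ ⦆ ∣ swaps swap c̃ b̃ P)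
  swaps-∣ []      b̃       Φ P = refl
  swaps-∣ (c ∷ c̃) []      Φ P = refl
  swaps-∣ (c ∷ c̃) (b ∷ b̃) Φ P = cong (swap c b) (swaps-∣ c̃ b̃ Φ P)

  data IsUnder : Preagent → Set ℓ where
    isUnder : ∀ {Φ P} → IsUnder (⦅ Φ ⦆ ∣ P)

  isUnder-swap⁻ : ∀ a b P → IsUnder (swap a b P) → IsUnder P
  isUnder-swap⁻ a b (⦅ _ ⦆ ∣ _) _ = isUnder

  isUnder-swaps⁻ : ∀ c̃ b̃ P → IsUnder (swaps swap c̃ b̃ P) → IsUnder P
  isUnder-swaps⁻ []      b̃       P i = i
  isUnder-swaps⁻ (c ∷ c̃) []      P i = i
  isUnder-swaps⁻ (c ∷ c̃) (b ∷ b̃) P i = isUnder-swaps⁻ c̃ b̃ P (isUnder-swap⁻ c b (swaps swap c̃ b̃ P) i)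

  swaps-fixed : ∀ c̃ b̃ {Φ} → c̃ # A.supp Φ → b̃ # A.supp Φ → swaps A.swap c̃ b̃ Φ A.≈ Φ
  swaps-fixed c̃ b̃ {Φ} f g rewrite Aₙ.swaps≡act c̃ b̃ Φ = Aₙ.act-zip-fresh f g

  -- A name of `b̃` in `Φ` would turn up as a name of `c̃` in the renamed assertion.
  unrenamed : ∀ {c̃ b̃ A Φ} → FreshVariant c̃ b̃ A → c̃ # A.supp Φ → c̃ # A.supp (swaps A.swap c̃ b̃ Φ) → b̃ # A.supp Φ
  unrenamed {c̃} {b̃} {A} {Φ} v f g (p , q) rewrite Aₙ.swaps≡act c̃ b̃ Φ =
    g (rename-∈ v (λ r → avoids-old v r p) p , Aₙ.supp-act (zip c̃ b̃) q)

  underʳ-≡ʳ : ∀ {Φ ρ₀ ρ ρ′} → ρ ≡ʳ ρ′ → (Underʳ Φ ρ₀ ρ → Underʳ Φ ρ₀ ρ′) × (Underʳ Φ ρ₀ ρ′ → Underʳ Φ ρ₀ ρ)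
  underʳ-≡ʳ {Φ} {ρ₀} (out e f g) = forth e f g , forth (T.sym e) (T.sym f) (symα g)
    where
    forth : ∀ {M M′ ã N N′ P P′} → M T.≈ M′ → N T.≈ N′ → P ≡α P′ →
            Underʳ Φ ρ₀ (out M ã N , P) → Underʳ Φ ρ₀ (out M′ ã N′ , P′)
    forth e f g (underʳ i b# r) with proj₁ (under-≡α g) (i ∣ refl)
    ... | i′ ∣ j = underʳ i′ b# (transα r (out e f j))
  underʳ-≡ʳ {Φ} {ρ₀} (inp e f g) = forth e f g , forth (T.sym e) (T.sym f) (symα g)
    where
    forth : ∀ {M M′ N N′ P P′} → M T.≈ M′ → N T.≈ N′ → P ≡α P′ →
            Underʳ Φ ρ₀ (inp M N , P) → Underʳ Φ ρ₀ (inp M′ N′ , P′)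
    forth e f g (underʳ i b# r) with proj₁ (under-≡α g) (i ∣ refl)
    ... | i′ ∣ j = underʳ i′ b# (transα r (inp e f j))
  underʳ-≡ʳ {Φ} {ρ₀} (τ g) = forth g , forth (symα g)
    where
    forth : ∀ {P P′} → P ≡α P′ → Underʳ Φ ρ₀ (τ , P) → Underʳ Φ ρ₀ (τ , P′)
    forth g (underʳ i b# r) with proj₁ (under-≡α g) (i ∣ refl)
    ... | i′ ∣ j = underʳ i′ b# (transα r (τ j))
  -- From right to left only the renamed derivative is known to be a parallel composition with an
  -- assertion; the renaming computes once that shape has been pulled back to `P`.
  underʳ-≡ʳ {Φ} {ρ₀} (alpha {M} {ã} {c̃} {N} {P} v) = forth P v , λ u → back P v (isUnder-swaps⁻ c̃ ã P (form u)) u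
    where
    form : ∀ {α P} → Underʳ Φ ρ₀ (α , P) → IsUnder P
    form (underʳ _ _ _) = isUnder
    forth : ∀ P → FreshVariant c̃ ã (T.supp N ++ n P) → Underʳ Φ ρ₀ (out M ã N , P) →
            Underʳ Φ ρ₀ (out M c̃ (swaps T.swap c̃ ã N) , swaps swap c̃ ã P)
    forth _ v (underʳ {Φ′ = Φ′} {P} i ã# r) rewrite swaps-∣ c̃ ã Φ′ P = underʳ
      (A.trans i (A.sym (swaps-fixed c̃ ã c̃#Φ′ (λ (p , q) → ã# (p , Aₙ.supp-cong (A.sym i) q)))))
      (λ (p , q) → c̃#Φ′ (p , Aₙ.supp-cong i q))
      (transα r (alpha (variant-⊆
        (λ p → [ ∈-++⁺ˡ , ∈-++⁺ʳ (T.supp N) ∘ ∈-++⁺ʳ (A.supp Φ′) ]′ (∈-++⁻ (T.supp N) p)) v)))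
      where
      c̃#Φ′ : c̃ # A.supp Φ′
      c̃#Φ′ (p , q) = avoids-used v p (∈-++⁺ʳ (T.supp N) (∈-++⁺ˡ q))
    back : ∀ P → FreshVariant c̃ ã (T.supp N ++ n P) → IsUnder P →
           Underʳ Φ ρ₀ (out M c̃ (swaps T.swap c̃ ã N) , swaps swap c̃ ã P) → Underʳ Φ ρ₀ (out M ã N , P)
    back (⦅ Φ′ ⦆ ∣ P) v isUnder u rewrite swaps-∣ c̃ ã Φ′ P with u
    ... | underʳ i c̃# r = underʳ i′ (λ (p , q) → ã#Φ′ (p , Aₙ.supp-cong i′ q))
      (transα r (symα (alpha (variant-⊆
        (λ p → [ ∈-++⁺ˡ , ∈-++⁺ʳ (T.supp N) ∘ ∈-++⁺ʳ (A.supp Φ′) ]′ (∈-++⁻ (T.supp N) p)) v))))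
      where
      c̃#Φ′ : c̃ # A.supp Φ′
      c̃#Φ′ (p , q) = avoids-used v p (∈-++⁺ʳ (T.supp N) (∈-++⁺ˡ q))
      ã#Φ′ : ã # A.supp Φ′
      ã#Φ′ = unrenamed v c̃#Φ′ (λ (p , q) → c̃# (p , Aₙ.supp-cong (A.sym i) q))
      i′ : Φ A.≈ Φ′
      i′ = A.trans i (swaps-fixed c̃ ã c̃#Φ′ ã#Φ′)
  underʳ-≡ʳ (symα e)      = let f , g = underʳ-≡ʳ e in g , f
  underʳ-≡ʳ (transα e e′) = let f , g = underʳ-≡ʳ e ; f′ , g′ = underʳ-≡ʳ e′ in f′ ∘ f , g ∘ g′

  data Step (Φ Ψ : Assertion) (P : Preagent) (α : Action) : Preagent → Set ℓ where
    step : ∀ {Φ′ P′} → Φ A.≈ Φ′ → bn α # A.supp Φ → Φ ⊗ Ψ ▷ P ─[ α ]→ P′ → Step Φ Ψ P α (⦅ Φ′ ⦆ ∣ P′)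

  ≡ʳ-refl : ∀ {ρ} → ρ ≡ʳ ρ
  ≡ʳ-refl {α , P} = ≡α⇒≡ʳ α refl

  -- Alpha-equivalence preserves the number of binders, so `b̃` is empty and the only instance is
  -- the assertion itself.
  assertion-frame-unique : ∀ {Φ b̃ Ψ} → assertionFrame Φ ≡ᶠ ⟨ν b̃ ⟩ Ψ → Φ A.≈ Ψ
  assertion-frame-unique {b̃ = b̃} e with ≡ᶠ⇒≋ e
  assertion-frame-unique {b̃ = []} e | mk≋ _ (_ , i) = i (mkFresh [] refl (λ ()))

  -- Apart from `parʳ` and `alpha`, every rule that fits the shape makes the assertion perform a
  -- transition, and it has none. Since `alpha` may change both the agent and the residual, closure
  -- of `Under` and `Underʳ` under the respective equalities carries the induction.
  under-inversion : ∀ {Φ Ψ P X α Y} → Under Φ P X → Ψ ▷ X ─[ α ]→ Y → Step Φ Ψ P α Y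
  under-inversion u (alpha eΨ eP d r) with under-inversion (proj₁ (under-≡α eP) u) d
  ... | step i b# d′ with proj₁ (underʳ-≡ʳ r) (underʳ i b# ≡ʳ-refl)
  ...   | underʳ i′ b#′ r′ = step i′ b#′ (alpha (⊗-cong A.refl eΨ) refl d′ r′)
  under-inversion (i ∣ j) (parʳ f b̃# d b#) = step i (λ (p , q) → b# (p , Aₙ.supp-cong i q))
    (alpha (⊗-cong (A.trans i (assertion-frame-unique f)) A.refl) j d ≡ʳ-refl)
  under-inversion (i ∣ j) (parˡ _ _ d _) = contradiction d (assertion-stuck ⦅ i ⦆)
  under-inversion (i ∣ j) (comˡ _ _ _ _ d _ _ _) = contradiction d (assertion-stuck ⦅ i ⦆)
  under-inversion (i ∣ j) (comʳ _ _ _ _ d _ _ _) = contradiction d (assertion-stuck ⦅ i ⦆)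

  -- The association in which nested uses of `parʳ` extend the environment; it is related to `∏`
  -- only up to `≃`.
  env : List Assertion → Assertion → Assertion
  env []       Ψ = Ψ
  env (Φ ∷ Φs) Ψ = env Φs (Φ ⊗ Ψ)

  env-≃ : ∀ Φs Ψ → env Φs Ψ ≃ ∏ Φs ⊗ Ψ
  env-≃ []       Ψ = ≃-sym ⊗-identityˡ
  env-≃ (Φ ∷ Φs) Ψ = ≃-trans (env-≃ Φs (Φ ⊗ Ψ))
    (≃-trans (≃-sym ⊗-associative) (⊗-compositional ⊗-commutative))

  env-𝟏 : ∀ Φs → env Φs 𝟏 ≃ ∏ Φs
  env-𝟏 Φs = ≃-trans (env-≃ Φs 𝟏) ⊗-identity

  suppˢ : List Assertion → List Name
  suppˢ = concatMap A.supp

  supp-ctx : ∀ Φs {P} → suppˢ Φs ⊆ n (ctx Φs P)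
  supp-ctx (Φ ∷ Φs) p = [ ∈-++⁺ˡ , ∈-++⁺ʳ (A.supp Φ) ∘ supp-ctx Φs ]′ (∈-++⁻ (A.supp Φ) p)

  n-ctx : ∀ Φs {P} → n P ⊆ n (ctx Φs P)
  n-ctx []       p = p
  n-ctx (Φ ∷ Φs) p = ∈-++⁺ʳ (A.supp Φ) (n-ctx Φs p)

  ctx-intro : ∀ Φs {Ψ P α P′} → bn α # suppˢ Φs → env Φs Ψ ▷ P ─[ α ]→ P′ → Ψ ▷ ctx Φs P ─[ α ]→ ctx Φs P′
  ctx-intro []       b# d = d
  ctx-intro (Φ ∷ Φs) b# d = parʳ (cong-≈ A.refl) (λ ()) (ctx-intro Φs (#-sub (∈-++⁺ʳ (A.supp Φ)) b#) d) (#-sub ∈-++⁺ˡ b#)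

  ctx-inversion : ∀ Φs {Ψ P α Y} → Ψ ▷ ctx Φs P ─[ α ]→ Y →
    ∃₂ λ Φs′ P′ → Y ≡ ctx Φs′ P′ × Pointwise A._≈_ Φs Φs′ × env Φs Ψ ▷ P ─[ α ]→ P′
  ctx-inversion []       d = [] , _ , refl , [] , d
  ctx-inversion (Φ ∷ Φs) d with under-inversion (A.refl ∣ refl) d
  ... | step {Φ′} i b# d′ with ctx-inversion Φs d′
  ...   | Φs′ , P′ , refl , is , d″ = Φ′ ∷ Φs′ , P′ , refl , i ∷ is , d″

  ctx-≡α : ∀ Φs {P X} → ctx Φs P ≡α X → ∃₂ λ Φs′ P′ → X ≡ ctx Φs′ P′ × Pointwise A._≈_ Φs Φs′ × P ≡α P′
  ctx-≡α []       {X = X} e = [] , X , refl , [] , e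
  ctx-≡α (Φ ∷ Φs) e with proj₁ (under-≡α e) (A.refl ∣ refl)
  ... | _∣_ {Φ′} i j with ctx-≡α Φs j
  ...   | Φs′ , P′ , refl , is , f = Φ′ ∷ Φs′ , P′ , refl , i ∷ is , f

  ctx-cong : ∀ {Φs Φs′ P P′} → Pointwise A._≈_ Φs Φs′ → P ≡α P′ → ctx Φs P ≡α ctx Φs′ P′
  ctx-cong []       e = e
  ctx-cong (i ∷ is) e = ⦅ i ⦆ ∣ ctx-cong is e

  wf-ctx : ∀ Φs {P} → WellFormed P → WellFormed (ctx Φs P)
  wf-ctx []       w = w
  wf-ctx (Φ ∷ Φs) w = ⦅ Φ ⦆ ∣ wf-ctx Φs w

  wf-ctx⁻ : ∀ Φs {P} → WellFormed (ctx Φs P) → WellFormed P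
  wf-ctx⁻ []       w       = w
  wf-ctx⁻ (Φ ∷ Φs) (_ ∣ w) = wf-ctx⁻ Φs w

  ≃ᶠ-trans : ∀ {F G H} → F ≃ᶠ G → G ≃ᶠ H → F ≃ᶠ H
  ≃ᶠ-trans e f φ = Equivalence.trans (e φ) (f φ)

  ≃ᶠ-sym : ∀ {F G} → F ≃ᶠ G → G ≃ᶠ F
  ≃ᶠ-sym e φ = Equivalence.sym (e φ)

  supp-𝟏 : ∀ {x} → x ∉ A.supp 𝟏
  supp-𝟏 = Aₙ.supp-least [] λ z _ → 𝟏-equivariant

  supp-⊗ : ∀ {Ψ Φ x} → x ∈ A.supp (Ψ ⊗ Φ) → x ∈ A.supp Ψ ++ A.supp Φ
  supp-⊗ {Ψ} {Φ} {x} p with x ∈? A.supp Ψ ++ A.supp Φ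
  ... | yes q = q
  ... | no q  = contradiction p (Aₙ.supp-least (A.supp Ψ ++ A.supp Φ) λ z z∉ →
    A.trans ⊗-equivariant (⊗-cong (A.supp-supports (q ∘ ∈-++⁺ˡ) (z∉ ∘ ∈-++⁺ˡ))
      (A.supp-supports (q ∘ ∈-++⁺ʳ (A.supp Ψ)) (z∉ ∘ ∈-++⁺ʳ (A.supp Ψ)))))

  sym-≈ : ∀ {Ψs Φs} → Pointwise A._≈_ Ψs Φs → Pointwise A._≈_ Φs Ψs
  sym-≈ = Pointwise.symmetric A.sym

  -- From a bisimulation to a context bisimulation

  module FromBisimulation {R : Assertion → Agent → Agent → Set ℓ} (isBisim : IsBisimulation R) where
    private module R = IsBisimulation isBisim

    -- The product in the order in which extension builds it.
    ∏ʳ : List Assertion → Assertion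
    ∏ʳ []       = 𝟏
    ∏ʳ (Ψ ∷ Ψs) = ∏ʳ Ψs ⊗ Ψ

    ∏ʳ≃∏ : ∀ Ψs → ∏ʳ Ψs ≃ ∏ Ψs
    ∏ʳ≃∏ []       = ≃-refl
    ∏ʳ≃∏ (Ψ ∷ Ψs) = ≃-trans (⊗-compositional (∏ʳ≃∏ Ψs)) ⊗-commutative

    ∏ʳ-cong : ∀ {Ψs Φs} → Pointwise A._≈_ Ψs Φs → ∏ʳ Ψs A.≈ ∏ʳ Φs
    ∏ʳ-cong []       = A.refl
    ∏ʳ-cong (i ∷ is) = ⊗-cong (∏ʳ-cong is) i

    supp-∏ʳ : ∀ Ψs → A.supp (∏ʳ Ψs) ⊆ suppˢ Ψs
    supp-∏ʳ []       p = contradiction p supp-𝟏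
    supp-∏ʳ (Ψ ∷ Ψs) p = [ ∈-++⁺ʳ (A.supp Ψ) ∘ supp-∏ʳ Ψs , ∈-++⁺ˡ ]′ (∈-++⁻ (A.supp (∏ʳ Ψs)) (supp-⊗ p))

    -- The two sides carry separate contexts, equal only entry by entry, and arbitrary proofs of
    -- well-formedness, so that alpha-equivalence can act on each side independently.
    data S : Agent → Agent → Set ℓ where
      contexts : ∀ Ψs Φs {P Q w v} → Pointwise A._≈_ Ψs Φs → R (∏ʳ Ψs) P Q →
                 S (agent (ctx Ψs (pre P)) w) (agent (ctx Φs (pre Q)) v)

    trans-≈ : ∀ {Ψs Φs Θs} → Pointwise A._≈_ Ψs Φs → Pointwise A._≈_ Φs Θs → Pointwise A._≈_ Ψs Θs
    trans-≈ = Pointwise.transitive A.trans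

    suppˢ-cong : ∀ {Ψs Φs} → Pointwise A._≈_ Ψs Φs → suppˢ Ψs ⊆ suppˢ Φs
    suppˢ-cong (_∷_ {Ψ} {Φ} i is) p =
      [ ∈-++⁺ˡ ∘ Aₙ.supp-cong i , ∈-++⁺ʳ (A.supp Φ) ∘ suppˢ-cong is ]′ (∈-++⁻ (A.supp Ψ) p)

    respects : ∀ {P P′ Q Q′} → P ≡ₐ P′ → Q ≡ₐ Q′ → S P Q → S P′ Q′
    respects {P′ = agent _ w′} {Q′ = agent _ v′} e f (contexts Ψs Φs is r) with ctx-≡α Ψs e | ctx-≡α Φs f
    ... | Ψs′ , P₀ , refl , js , e′ | Φs′ , Q₀ , refl , ks , f′ =
      contexts Ψs′ Φs′ {agent P₀ (wf-ctx⁻ Ψs′ w′)} {agent Q₀ (wf-ctx⁻ Φs′ v′)}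
        (trans-≈ (sym-≈ js) (trans-≈ is ks)) (R.respects (∏ʳ-cong js) e′ f′ r)

    simulation : ∀ {P Q} → S P Q → ∀ α P′ → bn α # n (pre Q) → 𝟏 ▷ pre P ─[ α ]→ pre P′ →
                 ∃ λ Q′ → 𝟏 ▷ pre Q ─[ α ]→ pre Q′ × S P′ Q′
    simulation (contexts Ψs Φs {P} {Q} is r) α (agent _ w′) b# d with ctx-inversion Ψs d
    ... | Ψs′ , P₀′ , refl , js , d′
      with R.simulation r α (agent P₀′ (wf-ctx⁻ Ψs′ w′))
             -- In this direction freshness comes for free: bound names avoid the agent in its
             -- context, and the names of the product all occur in that context.
             (λ (p , q) → b# (p , [ supp-ctx Φs ∘ suppˢ-cong is ∘ supp-∏ʳ Ψs , n-ctx Φs ]′ (∈-++⁻ (A.supp (∏ʳ Ψs)) q)))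
             (transfer-≃ (wellFormed P) (≃-trans (env-𝟏 Ψs) (≃-sym (∏ʳ≃∏ Ψs))) d′)
    ... | Q₀′ , d″ , r′ = agent (ctx Φs (pre Q₀′)) (wf-ctx Φs (wellFormed Q₀′)) ,
      ctx-intro Φs (#-sub (supp-ctx Φs) b#)
        (transfer-≃ (wellFormed Q) (≃-trans (≈⇒≃ (∏ʳ-cong is)) (≃-trans (∏ʳ≃∏ Φs) (≃-sym (env-𝟏 Φs)))) d″) ,
      contexts Ψs′ Φs {agent P₀′ (wf-ctx⁻ Ψs′ w′)} {Q₀′} (trans-≈ (sym-≈ js) is) (R.respects (∏ʳ-cong js) refl refl r′)

    isContextBisimulation : IsContextBisimulation S
    isContextBisimulation = record
      { respects   = respects
      ; static     = λ { (contexts Ψs Φs {P} {Q} is r) → ≃ᶠ-trans (ctx-static Ψs (pre P) (∏ʳ≃∏ Ψs))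
          (≃ᶠ-trans (R.static r)
          (≃ᶠ-sym (ctx-static Φs (pre Q) (≃-trans (≈⇒≃ (∏ʳ-cong is)) (∏ʳ≃∏ Φs))))) }
      ; symmetric  = λ { (contexts Ψs Φs {P} {Q} is r) → contexts Φs Ψs {Q} {P} (sym-≈ is)
          (R.symmetric (R.respects (∏ʳ-cong is) refl refl r)) }
      ; extension  = λ { (contexts Ψs Φs is r) Ψ → contexts (Ψ ∷ Ψs) (Ψ ∷ Φs) (A.refl ∷ is) (R.extension r Ψ) }
      ; simulation = simulation
      }

  -- Alpha-converting the label to α₁ with fresh bound names; a matching
  -- transition labelled α₁ can be converted back.
  refresh : ∀ {Ψ P α P′} → Ψ ▷ P ─[ α ]→ P′ → ∀ A → ∃₂ λ σ α₁ →
    bn α₁ # A × (α , P′) ≡ʳ (α₁ , Pₙ.act σ P′) ×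
    (∀ {Φ} → bn α # A.supp Φ → bn α₁ # A.supp Φ → Aₙ.act σ Φ A.≈ Φ) ×
    (∀ {B Q} → Confined B (α₁ , Q) → bn α # B → (α₁ , Q) ≡ʳ (α , Pₙ.act (inverse σ) Q))
  refresh {α = inp M N} d A = [] , inp M N , (λ ()) , ≡ʳ-refl , (λ _ _ → A.refl) , (λ _ _ → ≡ʳ-refl)
  refresh {α = τ}       d A = [] , τ , (λ ()) , ≡ʳ-refl , (λ _ _ → A.refl) , (λ _ _ → ≡ʳ-refl)
  refresh {α = out M ã N} {P′} d A =
    σ , out M c̃ (swaps T.swap c̃ ã N) ,
    (λ (p , q) → avoids-used v p (∈-++⁺ʳ (T.supp N ++ n P′) q)) ,
    transα (alpha (variant-⊆ ∈-++⁺ˡ v)) (≡α⇒≡ʳ _ (NominalSet.reflexive 𝐏 (Pₙ.swaps≡act c̃ ã P′))) ,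
    (λ f g → Aₙ.act-zip-fresh g f) , back
    where
    c̃ : List Name
    c̃ = freshes (length ã) (ã ++ (T.supp N ++ n P′) ++ A)
    v : FreshVariant c̃ ã ((T.supp N ++ n P′) ++ A)
    v = freshVariant ã _
    σ : Perm
    σ = zip c̃ ã
    back : ∀ {B Q} → Confined B (out M c̃ (swaps T.swap c̃ ã N) , Q) → ã # B →
           (out M c̃ (swaps T.swap c̃ ã N) , Q) ≡ʳ (out M ã N , Pₙ.act (inverse σ) Q)
    back {B} {Q} c ã#B = transα (≡α⇒≡ʳ _ restored) (symα (alpha v′))
      where
      Q₀ : Preagent
      Q₀ = Pₙ.act (inverse σ) Q
      restored : Q ≡α swaps swap c̃ ã Q₀
      restored rewrite Pₙ.swaps≡act c̃ ã Q₀ = symα (Pₙ.act-inverse σ Q)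
      -- As `ã` is distinct, `σ` maps `c̃` back into `ã`. A name `x` of `c̃` free in `Q₀` would
      -- therefore give a name of `ã` free in `Q`, which confinement puts into `B`, contrary to `ã`
      -- being fresh for `B`.
      c̃#Q₀ : ∀ {x} → x ∈ c̃ → x ∉ n Q₀
      c̃#Q₀ {x} x∈ q = ã#B (x∈ã , c (∈-∖⁺ (∈-++⁺ʳ (T.supp (swaps T.swap c̃ ã N)) σx∈) (λ r → avoids-old v r x∈ã)))
        where
        x∈ã : σ · x ∈ ã
        x∈ã = rename-inverse (proj₁ (labelled d)) v x∈
        σx∈ : σ · x ∈ n Q
        σx∈ = from (n-≡α restored) (to (swaps-equiᵖ c̃ ã Q₀) q)
      v′ : FreshVariant c̃ ã (T.supp N ++ n Q₀)
      v′ = record { distinct = FreshVariant.distinct v ; sameLength = FreshVariant.sameLength v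
        ; avoids = λ (p , q) →
            [ avoids-old v p , ∉-++ {A = T.supp N} (avoids-used v p ∘ ∈-++⁺ˡ ∘ ∈-++⁺ˡ) (c̃#Q₀ p) ]′ (∈-++⁻ ã q) }

  actᵃ-inverse : ∀ π α {P} → (actᵃ (inverse π) (actᵃ π α) , P) ≡ʳ (α , P)
  actᵃ-inverse π (out M ã N)
    rewrite trans (sym (map-∘ {g = inverse π ·_} {f = π ·_} ã)) (trans (map-cong (·-inverse π) ã) (map-id ã))
    = out (Tₙ.inverse-act π M) (Tₙ.inverse-act π N) refl
  actᵃ-inverse π (inp M N) = inp (Tₙ.inverse-act π M) (Tₙ.inverse-act π N) refl
  actᵃ-inverse π τ         = τ refl

  -- From a context bisimulation to a bisimulation

  module FromContextBisimulation {R : Agent → Agent → Set ℓ} (isBisim : IsContextBisimulation R) where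
    private module R = IsContextBisimulation isBisim

    place : List Assertion → Perm → Agent → Agent
    place Ψs π P = agent (ctx Ψs (Pₙ.act π (pre P))) (wf-ctx Ψs (wf-act π (wellFormed P)))

    place-cong : ∀ Ψs π {P Q} → P ≡ₐ Q → place Ψs π P ≡ₐ place Ψs π Q
    place-cong Ψs π e = ctx-cong (Pointwise.refl A.refl) (Pₙ.act-cong π e)

    -- The permutation makes S closed under renaming of bound names in labels:
    -- these need only be fresh for Ψ, not for the assertions Ψs.
    S : Assertion → Agent → Agent → Set ℓ
    S Ψ P Q = ∃₂ λ Ψs π → ∏ Ψs ≃ Aₙ.act π Ψ × R (place Ψs π P) (place Ψs π Q)

    static : ∀ {Ψ P Q} → S Ψ P Q → assertionFrame Ψ ⊗ᶠ 𝓕 (pre P) ≃ᶠ assertionFrame Ψ ⊗ᶠ 𝓕 (pre Q)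
    static {Ψ} {P} {Q} (Ψs , π , e , r) φ = Equivalence.trans (moved P)
      (Equivalence.trans (≃ᶠ-trans (≃ᶠ-sym (ctx-static Ψs (Pₙ.act π (pre P)) (≃-sym e)))
                         (≃ᶠ-trans (R.static r) (ctx-static Ψs (Pₙ.act π (pre Q)) (≃-sym e))) (Cₙ.act π φ))
      (Equivalence.sym (moved Q)))
      where
      moved : ∀ P → assertionFrame Ψ ⊗ᶠ 𝓕 (pre P) ⊢ᶠ φ ⇔
                    assertionFrame (Aₙ.act π Ψ) ⊗ᶠ 𝓕 (Pₙ.act π (pre P)) ⊢ᶠ Cₙ.act π φ
      moved P = ▷-⊢ᶠ (⊗ᶠ-▷ (assertionFrame-▷ {π} A.refl) (𝓕-▷ π (pre P))) φ

    simulation : ∀ {Ψ P Q} → S Ψ P Q → ∀ α P′ → bn α # A.supp Ψ ++ n (pre Q) → Ψ ▷ pre P ─[ α ]→ pre P′ →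
                 ∃ λ Q′ → Ψ ▷ pre Q ─[ α ]→ pre Q′ × S Ψ P′ Q′
    simulation {Ψ} {P} {Q} (Ψs , π , e , r) α P′ b# d
      -- Being fresh for `Ψ` makes `σ` fix `Ψ`; being fresh for the preimage of the context under
      -- `π` makes the bound names of `π · α₁` avoid that context.
      with refresh d (A.supp Ψ ++ map (inverse π ·_) (n (pre (place Ψs π Q))))
    ... | σ , α₁ , b₁# , residual , fixed , back
      with R.simulation r (actᵃ π α₁) (place Ψs π (agent (Pₙ.act σ (pre P′)) (wf-act σ (wellFormed P′)))) πb₁#
             (ctx-intro Ψs (#-sub (supp-ctx Ψs) πb₁#)
               (transfer-≃ (wf-act π (wellFormed P)) (≃-sym (env-𝟏 Ψs))
                 (transfer (wellFormed P) (alpha A.refl refl d residual) π (≃-sym e))))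
      where
      πb₁# : bn (actᵃ π α₁) # n (pre (place Ψs π Q))
      πb₁# rewrite bn-act π α₁ = λ (p , q) → let x , x∈ , eq = ∈-map⁻ (π ·_) p in
        b₁# (x∈ , ∈-++⁺ʳ (A.supp Ψ) (subst (_∈ _) (·-inverse π x) (∈-map⁺ (inverse π ·_) (subst (_∈ _) eq q))))
    ... | agent _ w , d₁ , r₁ with ctx-inversion Ψs d₁
    ...   | Ψs′ , Q₁ , refl , is , d₂ =
      agent Q′ (wf-act (inverse σ) (wf-act (inverse π) (wf-ctx⁻ Ψs′ w))) ,
      -- The match was found under the fresh label. That `bn α` avoids `Q` is used here: confinement
      -- then allows the label to be converted back to `α`.
      alpha A.refl refl d₃ (back (confined (wellFormed Q) d₃) (#-sub (∈-++⁺ʳ (A.supp Ψ)) b#)) ,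
      -- `P′` was first renamed by `σ` and then placed under `π`, so the composite becomes the new
      -- permutation; `Q′` is the derivative of the match with both undone.
      Ψs , π ++ σ , e′ , R.respects
        (ctx-cong (Pointwise.refl A.refl) (NominalSet.reflexive 𝐏 (sym (Pₙ.act-++ π σ (pre P′)))))
        (ctx-cong (sym-≈ is) (symα (transα (NominalSet.reflexive 𝐏 (Pₙ.act-++ π σ Q′))
          (transα (Pₙ.act-cong π (Pₙ.act-inverse σ Q″)) (Pₙ.act-inverse π Q₁)))))
        r₁
      where
      Q″ Q′ : Preagent
      Q″ = Pₙ.act (inverse π) Q₁
      Q′ = Pₙ.act (inverse σ) Q″
      -- `transfer` along `inverse π` undoes the renaming and, in the same stroke, replaces the
      -- environment built by the context with `Ψ`.
      d₃ : Ψ ▷ pre Q ─[ α₁ ]→ Q″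
      d₃ = alpha A.refl (symα (Pₙ.inverse-act π (pre Q)))
        (transfer (wf-act π (wellFormed Q)) d₂ (inverse π)
          (≃-trans (act-≃ (inverse π) (≃-trans (env-𝟏 Ψs) e)) (≈⇒≃ (Aₙ.inverse-act π Ψ))))
        (actᵃ-inverse π α₁)
      -- `σ` exchanges old and new bound names, both fresh for `Ψ`, and so fixes `Ψ`.
      e′ : ∏ Ψs ≃ Aₙ.act (π ++ σ) Ψ
      e′ = ≃-trans e (≈⇒≃ (A.trans
        (Aₙ.act-cong π (A.sym (fixed (#-sub ∈-++⁺ˡ b#) (#-sub ∈-++⁺ˡ b₁#))))
        (A.reflexive (sym (Aₙ.act-++ π σ Ψ)))))

    isBisimulation : IsBisimulation S
    isBisimulation = record
      { respects   = λ {_} {_} {P} {P′} {Q} {Q′} i e f (Ψs , π , g , r) → Ψs , π , ≃-trans g (≈⇒≃ (Aₙ.act-cong π i)) ,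
          R.respects (place-cong Ψs π {P} {P′} e) (place-cong Ψs π {Q} {Q′} f) r
      ; static     = static
      ; symmetric  = λ (Ψs , π , g , r) → Ψs , π , g , R.symmetric r
      -- The context surrounds agents renamed by `π`, so the added assertion has to be renamed as
      -- well.
      ; extension  = λ (Ψs , π , g , r) Ψ′ → Aₙ.act π Ψ′ ∷ Ψs , π ,
          ≃-trans ⊗-commutative (≃-trans (⊗-compositional g) (≃-sym (≈⇒≃ (act-⊗ π)))) , R.extension r (Aₙ.act π Ψ′)
      ; simulation = simulation
      }

mainTheorem1 : ∀ {ℓ : Level} (𝓝 : Names) (𝒫 : PsiCalculus 𝓝 ℓ) →
    let open Psi 𝒫 in
    (P Q : Agent) → P ∼ Q ⇔ P ∼ᶜ Q
mainTheorem1 𝓝 𝒫 P Q = mk⇔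
  (λ (R , isBisim , r) → let open FromBisimulation isBisim in
    S , isContextBisimulation , contexts [] [] [] r)
  (λ (R , isBisim , r) → let open FromContextBisimulation isBisim in
    -- For the empty context and the identity permutation, both sides of the required equivalence
    -- are `𝟏`.
    S , isBisimulation , [] , [] , (λ φ → Equivalence.refl) , r)
  where open ContextProperties 𝒫
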